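{- The theory $\mathrm{RCA}_0^{\Omega}+\mathrm{STP}$ proves the equivalences $$\Sigma^0_1\text{ -DET}^{*}\leftrightarrow\mathrm{U}\Sigma^0_1\text{ -DET}^{\mathrm{st}}\leftrightarrow(S^2)^{\mathrm{st}}.$$
   Context: BASE THEORY. Finite types: $0$ (natural numbers), $\sigma\to\tau$, and $\sigma^{*}$ (finite sequences of objects of type $\sigma$); $1=0\to 0$, $2=1\to 0$, $3=2\to 0$. Superscripts indicate types; tuples are coded as single objects where convenient. Equality $=_0$ is primitive; for $\tau=\tau_1\to\dots\to\tau_k\to 0$, $x=_\tau y$ means $(\forall z_1\dots z_k)(xz_1\dots z_k=_0 yz_1\dots z_k)$. $\mathrm{RCA}_0^{\omega}$ is Kohlenbach's higher-order base theory: classical arithmetic in all finite types with combinators, zero, successor, the recursor $R_0$ (primitive recursion with type $0$ values), quantifier-free induction, extensionality $x=_\rho y\to\varphi(x)=_\tau\varphi(y)$ for all $\varphi^{\rho\to\tau}$, and $\mathrm{QF\text{ - }AC}^{1,0}$, where $\mathrm{QF\text{ - }AC}^{\sigma,\tau}$ is $(\forall x^\sigma)(\exists y^\tau)A_0(x,y)\to(\exists F^{\sigma\to\tau})(\forall x)A_0(x,F(x))$ for quantifier-free $A_0$. $\mathrm{RCA}_0^{\Omega}$ extends $\mathrm{RCA}_0^{\omega}$ (with the types $\sigma^*$) by a predicate $\mathrm{st}$ ("is standard") for each type. A formula is internal if it does not contain $\mathrm{st}$; $(\forall^{\mathrm{st}}x)A$ is $(\forall x)(\mathrm{st}(x)\to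 A)$, $(\exists^{\mathrm{st}}x)A$ is $(\exists x)(\mathrm{st}(x)\wedge A)$; $N\in\Omega$ means $\neg\mathrm{st}(N^0)$; $A^{\mathrm{st}}$ is $A$ with all quantifiers (except bounded number quantifiers) relativised to $\mathrm{st}$. Axioms: (i) standardness respects equality, closed terms are standard, a standard functional applied to a standard object is standard, and numbers below a standard number are standard; (ii) Idealization: $(\forall^{\mathrm{st}}x^{\sigma^*})(\exists y^\tau)(\forall z\in x)\varphi(z,y)\to(\exists y)(\forall^{\mathrm{st}}z^{\sigma})\varphi(z,y)$ for internal $\varphi$; (iii) $\mathrm{HAC}_{\mathrm{int}}$: $(\forall^{\mathrm{st}}x^{\rho})(\exists^{\mathrm{st}}y^{\tau})\varphi(x,y)\to(\exists^{\mathrm{st}}\Phi^{\rho\to\tau^*})(\forall^{\mathrm{st}}x)(\exists y\in\Phi(x))\varphi(x,y)$ for internal $\varphi$; (iv) $\mathrm{PF\text{ - }TP}_\forall$: $(\forall^{\mathrm{st}}x^\tau)\varphi(x)\to(\forall x^\tau)\varphi(x)$ for internal $\varphi(x)$ with no parameters other than $x$; (v) for certain functionals uniquely specified by a parameter-free internal formula $D$ (e.g. the Suslin functional in $(S^2)$), a constant $\Xi_0$ with the axiom $\mathrm{st}(\Xi_0)\wedge(\forall^{\mathrm{st}}\Xi)[D^{\mathrm{st}}(\Xi)\to \Xi_0$ and $\Xi$ agree on all standard inputs$]$; these constants do not count as parameters in (iv). NOTATION. $\overline{h}k$ is the (code of the) initial segment of $h$ of length $k$. Sets $X^1$ are given by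 characteristic functions. A strategy for player 0 is a function $S_0$ from finite sequences of natural numbers of even length to $\mathbb{N}$; a strategy for player 1 is a function $S_1$ from finite sequences of odd length to $\mathbb{N}$ (both coded as type $1$ objects). $S_0\otimes S_1$ is the resulting play, i.e. the unique $h^1$ with $h(2n)=S_0(\overline{h}(2n))$ and $h(2n+1)=S_1(\overline{h}(2n+1))$ for all $n$. Let $\varphi(h^1,f^1)\equiv(\exists k^0)f(\overline{h}k)=0$. PRINCIPLES. $\mathrm{STP}$: $(\forall X^1)(\exists^{\mathrm{st}}Y^1)(\forall^{\mathrm{st}}x^0)(x\in X\leftrightarrow x\in Y)$. $(S^2)$: $(\exists S^2)(\forall f^1)[S(f)=_00\leftrightarrow(\exists g^1)(\forall x^0)(f(\overline{g}x)\neq0)]$. $\Sigma^0_1\text{ -DET}$: $(\forall f^1)\big[(\exists S_0)(\forall S_1)\varphi(S_0\otimes S_1,f)\vee(\exists S_1)(\forall S_0)\neg\varphi(S_0\otimes S_1,f)\big]$. $\Sigma^0_1\text{ -DET}^*$: $\Sigma^0_1\text{ -DET}^{\mathrm{st}}$ without '$\mathrm{st}$' in the innermost $\Pi^1_1$-formulas, i.e. $(\forall^{\mathrm{st}}f^1)\big[(\exists^{\mathrm{st}}S_0)(\forall S_1)\varphi(S_0\otimes S_1,f)\vee(\exists^{\mathrm{st}}S_1)(\forall S_0)\neg\varphi(S_0\otimes S_1,f)\big]$. $\mathrm{U}\Sigma^0_1\text{ -DET}$: $(\exists\Phi^{1\to(1\times1)})(\forall f^1)\big[(\forall S_1)\varphi(\Phi(f)(1)\otimes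 S_1,f)\vee(\forall S_0)\neg\varphi(S_0\otimes\Phi(f)(2),f)\big]$, where $\Phi(f)(1),\Phi(f)(2)$ are the two components of $\Phi(f)$. -}

module Defs where

open import Data.Empty using (⊥)
open import Data.List.Base using (List; []; _∷_; map)
open import Data.List.Membership.Propositional using (_∈_)
open import Data.List.Relation.Unary.Any using (here; there)
open import Data.Product.Base using (_×_)
open import Data.Sum.Base using (_⊎_; inj₁; inj₂; [_,_]′)
open import Data.Unit.Base using (⊤)
open import Relation.Binary.PropositionalEquality.Core using (refl)

------------------------------------------------------------------------
-- Types and terms

infixr 7 _⟶_
infix  8 _✶

-- N is the type 0 of natural numbers and σ ✶ the type of finite sequences.
data Ty : Set where
  N   : Ty
  _⟶_ : Ty → Ty → Ty
  _✶  : Ty → Ty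

type1 type2 : Ty
type1 = N ⟶ N
type2 = type1 ⟶ N

Ctx : Set
Ctx = List Ty

-- A finite sequence is given by its length and its entries, and tab g n is
-- the sequence g 0 , … , g (n-1).  The empty sequence, cons, append and list
-- recursion with values in N are definable from these and R₀.
-- Ξ₀ is the constant for the Suslin functional.
data Con : Ty → Set where
  𝗞    : ∀ {σ τ} → Con (σ ⟶ τ ⟶ σ)
  𝗦    : ∀ {ρ σ τ} → Con ((ρ ⟶ σ ⟶ τ) ⟶ (ρ ⟶ σ) ⟶ ρ ⟶ τ)
  zero : Con N
  suc  : Con (N ⟶ N)
  R₀   : Con (N ⟶ N ⟶ (N ⟶ N ⟶ N) ⟶ N)
  len  : ∀ {σ} → Con (σ ✶ ⟶ N)
  ent  : ∀ {σ} → Con (σ ✶ ⟶ N ⟶ σ)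
  tab  : ∀ {σ} → Con ((N ⟶ σ) ⟶ N ⟶ σ ✶)
  Ξ₀   : Con type2

infixl 9 _·_

data Tm (Γ : Ctx) : Ty → Set where
  var : ∀ {σ} → σ ∈ Γ → Tm Γ σ
  con : ∀ {σ} → Con σ → Tm Γ σ
  _·_ : ∀ {σ τ} → Tm Γ (σ ⟶ τ) → Tm Γ σ → Tm Γ τ

Sub : Ctx → Ctx → Set
Sub Γ Δ = ∀ {σ} → σ ∈ Γ → Tm Δ σ

_⟦_⟧ᵗ : ∀ {Γ Δ σ} → Tm Γ σ → Sub Γ Δ → Tm Δ σ
var x   ⟦ s ⟧ᵗ = s x
con c   ⟦ s ⟧ᵗ = con c
(t · u) ⟦ s ⟧ᵗ = (t ⟦ s ⟧ᵗ) · (u ⟦ s ⟧ᵗ)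

infixl 5 _▸_

_▸_ : ∀ {Γ Δ σ} → Sub Γ Δ → Tm Δ σ → Sub (σ ∷ Γ) Δ
(s ▸ t) (here refl) = t
(s ▸ t) (there x)   = s x

skip₁ : ∀ {Γ σ} → Sub Γ (σ ∷ Γ)
skip₁ x = var (there x)

skip₂ : ∀ {Γ σ τ} → Sub Γ (σ ∷ τ ∷ Γ)
skip₂ x = var (there (there x))

skip₃ : ∀ {Γ ρ σ τ} → Sub Γ (ρ ∷ σ ∷ τ ∷ Γ)
skip₃ x = var (there (there (there x)))

wk : ∀ {Γ σ τ} → Tm Γ τ → Tm (σ ∷ Γ) τ
wk t = t ⟦ skip₁ ⟧ᵗ

v₀ : ∀ {Γ σ} → Tm (σ ∷ Γ) σ
v₀ = var (here refl)

lift : ∀ {Γ Δ σ} → Sub Γ Δ → Sub (σ ∷ Γ) (σ ∷ Δ)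
lift s = (λ x → wk (s x)) ▸ v₀

v₁ : ∀ {Γ σ τ} → Tm (τ ∷ σ ∷ Γ) σ
v₁ = wk v₀

v₂ : ∀ {Γ ρ σ τ} → Tm (τ ∷ ρ ∷ σ ∷ Γ) σ
v₂ = wk v₁

v₃ : ∀ {Γ π ρ σ τ} → Tm (τ ∷ ρ ∷ π ∷ σ ∷ Γ) σ
v₃ = wk v₂

-- Bracket abstraction: λ is not a term former, but is compiled into 𝗦 and 𝗞.
-- abstracted t is inj₁ of t itself if v₀ does not occur in t, and otherwise
-- inj₂ of the abstraction of t.
applyᵃ : ∀ {Γ ρ σ τ} → Tm Γ (σ ⟶ τ) ⊎ Tm Γ (ρ ⟶ σ ⟶ τ) →
         Tm Γ σ ⊎ Tm Γ (ρ ⟶ σ) → Tm Γ τ ⊎ Tm Γ (ρ ⟶ τ)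
applyᵃ (inj₁ t) (inj₁ u) = inj₁ (t · u)
applyᵃ (inj₁ t) (inj₂ u) = inj₂ (con 𝗦 · (con 𝗞 · t) · u)
applyᵃ (inj₂ t) (inj₁ u) = inj₂ (con 𝗦 · t · (con 𝗞 · u))
applyᵃ (inj₂ t) (inj₂ u) = inj₂ (con 𝗦 · t · u)

abstracted : ∀ {Γ σ τ} → Tm (σ ∷ Γ) τ → Tm Γ τ ⊎ Tm Γ (σ ⟶ τ)
abstracted {σ = σ} (var (here refl)) = inj₂ (con 𝗦 · con 𝗞 · con (𝗞 {σ} {σ}))
abstracted (var (there x))           = inj₁ (var x)
abstracted (con c)                   = inj₁ (con c)
abstracted (t · u)                   = applyᵃ (abstracted t) (abstracted u)

ƛ_ : ∀ {Γ σ τ} → Tm (σ ∷ Γ) τ → Tm Γ (σ ⟶ τ)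
ƛ t = [ (λ u → con 𝗞 · u) , (λ u → u) ]′ (abstracted t)

infixr 6 ƛ_

------------------------------------------------------------------------
-- Primitive recursive terms and the coding of number sequences

𝟎 𝟏 𝟐 : ∀ {Γ} → Tm Γ N
𝟎 = con zero
𝟏 = con suc · 𝟎
𝟐 = con suc · 𝟏

add : ∀ {Γ} → Tm Γ (N ⟶ N ⟶ N)
add = ƛ ƛ con R₀ · v₀ · v₁ · (ƛ ƛ con suc · v₁)

pred : ∀ {Γ} → Tm Γ (N ⟶ N)
pred = ƛ con R₀ · v₀ · 𝟎 · (ƛ ƛ v₀)

-- Truncated subtraction.
monus : ∀ {Γ} → Tm Γ (N ⟶ N ⟶ N)
monus = ƛ ƛ con R₀ · v₀ · v₁ · (ƛ ƛ pred · v₁)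

-- ifz c a b is a if c = 0, and b otherwise.
ifz : ∀ {Γ} → Tm Γ (N ⟶ N ⟶ N ⟶ N)
ifz = ƛ ƛ ƛ con R₀ · v₂ · v₁ · (ƛ ƛ v₂)

-- 0 on even numbers and 1 on odd ones.
parity : ∀ {Γ} → Tm Γ (N ⟶ N)
parity = ƛ con R₀ · v₀ · 𝟎 · (ƛ ƛ monus · 𝟏 · v₁)

triangle : ∀ {Γ} → Tm Γ (N ⟶ N)
triangle = ƛ con R₀ · v₀ · 𝟎 · (ƛ ƛ add · (con suc · v₀) · v₁)

-- The Cantor pairing, a bijection.
pair : ∀ {Γ} → Tm Γ (N ⟶ N ⟶ N)
pair = ƛ ƛ add · (triangle · (add · v₁ · v₀)) · v₀

-- Codes of finite sequences of numbers: ⟨⟩ is 0 and s * ⟨n⟩ is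
-- 1 + pair s n, so every number codes exactly one sequence.
⟨⟩ : ∀ {Γ} → Tm Γ N
⟨⟩ = 𝟎

snoc : ∀ {Γ} → Tm Γ (N ⟶ N ⟶ N)
snoc = ƛ ƛ con suc · (pair · v₁ · v₀)

-- initial · h · k is the code of the initial segment of h of length k.
initial : ∀ {Γ} → Tm Γ (type1 ⟶ N ⟶ N)
initial = ƛ ƛ con R₀ · v₀ · ⟨⟩ · (ƛ ƛ snoc · v₁ · (v₃ · v₀))

-- A strategy for either player is a type 1 object acting on codes; its values
-- at codes of sequences of the wrong parity of length are never consulted.
Strategy : Ty
Strategy = type1

-- move · S₀ · S₁ · n · p is the n-th move, made at the position coded by p.
move : ∀ {Γ} → Tm Γ (Strategy ⟶ Strategy ⟶ N ⟶ N ⟶ N)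
move = ƛ ƛ ƛ ƛ ifz · (parity · v₁) · (v₃ · v₀) · (v₂ · v₀)

-- position · S₀ · S₁ · n is the code of the first n moves.
position : ∀ {Γ} → Tm Γ (Strategy ⟶ Strategy ⟶ N ⟶ N)
position = ƛ ƛ ƛ con R₀ · v₀ · ⟨⟩ ·
  (ƛ ƛ snoc · v₁ · (move · wk v₃ · v₃ · v₀ · v₁))

play : ∀ {Γ} → Tm Γ (Strategy ⟶ Strategy ⟶ type1)
play = ƛ ƛ ƛ move · v₂ · v₁ · v₀ · (position · v₂ · v₁ · v₀)

infix 8 _⊗_

_⊗_ : ∀ {Γ} → Tm Γ Strategy → Tm Γ Strategy → Tm Γ type1
S₀ ⊗ S₁ = play · S₀ · S₁

zeroAt : ∀ {Γ} σ → Tm Γ σ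
zeroAt N       = 𝟎
zeroAt (σ ⟶ τ) = con 𝗞 · zeroAt τ
zeroAt (σ ✶)   = con tab · (con 𝗞 · zeroAt σ) · 𝟎

------------------------------------------------------------------------
-- Formulas

infix  6 _≐_
infixr 5 _∧_
infixr 4 _∨_
infixr 3 _⇒_
infix  2 _⇔_
infix  6 ¬_
infixr 1 ∀[_]_ ∃[_]_ ∀ˢᵗ[_]_ ∃ˢᵗ[_]_

data Fm (Γ : Ctx) : Set where
  _≐_   : Tm Γ N → Tm Γ N → Fm Γ
  st    : ∀ {σ} → Tm Γ σ → Fm Γ
  ⊥̇     : Fm Γ
  _∧_   : Fm Γ → Fm Γ → Fm Γ
  _∨_   : Fm Γ → Fm Γ → Fm Γ
  _⇒_   : Fm Γ → Fm Γ → Fm Γ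
  ∀[_]_ : (σ : Ty) → Fm (σ ∷ Γ) → Fm Γ
  ∃[_]_ : (σ : Ty) → Fm (σ ∷ Γ) → Fm Γ

¬_ : ∀ {Γ} → Fm Γ → Fm Γ
¬ A = A ⇒ ⊥̇

_⇔_ : ∀ {Γ} → Fm Γ → Fm Γ → Fm Γ
A ⇔ B = (A ⇒ B) ∧ (B ⇒ A)

∀ˢᵗ[_]_ ∃ˢᵗ[_]_ : ∀ {Γ} σ → Fm (σ ∷ Γ) → Fm Γ
∀ˢᵗ[ σ ] A = ∀[ σ ] (st v₀ ⇒ A)
∃ˢᵗ[ σ ] A = ∃[ σ ] (st v₀ ∧ A)

_⟦_⟧ : ∀ {Γ Δ} → Fm Γ → Sub Γ Δ → Fm Δ
(t ≐ u)    ⟦ s ⟧ = (t ⟦ s ⟧ᵗ) ≐ (u ⟦ s ⟧ᵗ)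
st t       ⟦ s ⟧ = st (t ⟦ s ⟧ᵗ)
⊥̇          ⟦ s ⟧ = ⊥̇
(A ∧ B)    ⟦ s ⟧ = (A ⟦ s ⟧) ∧ (B ⟦ s ⟧)
(A ∨ B)    ⟦ s ⟧ = (A ⟦ s ⟧) ∨ (B ⟦ s ⟧)
(A ⇒ B)    ⟦ s ⟧ = (A ⟦ s ⟧) ⇒ (B ⟦ s ⟧)
(∀[ σ ] A) ⟦ s ⟧ = ∀[ σ ] (A ⟦ lift s ⟧)
(∃[ σ ] A) ⟦ s ⟧ = ∃[ σ ] (A ⟦ lift s ⟧)

infix 20 _⟦_⟧ _⟦_⟧ᵗ _ˢᵗ

wkF : ∀ {Γ σ} → Fm Γ → Fm (σ ∷ Γ)
wkF A = A ⟦ skip₁ ⟧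

_[_] : ∀ {Γ σ} → Fm (σ ∷ Γ) → Tm Γ σ → Fm Γ
A [ t ] = A ⟦ var ▸ t ⟧

closedᵗ : ∀ {Γ σ} → Tm [] σ → Tm Γ σ
closedᵗ t = t ⟦ (λ ()) ⟧ᵗ

closed : ∀ {Γ} → Fm [] → Fm Γ
closed A = A ⟦ (λ ()) ⟧

-- There is no primitive bounded quantifier, hence none to exempt here; the
-- formulas relativised below do not contain bounded number quantifiers.
_ˢᵗ : ∀ {Γ} → Fm Γ → Fm Γ
(t ≐ u) ˢᵗ    = t ≐ u
(st t) ˢᵗ     = st t
⊥̇ ˢᵗ          = ⊥̇
(A ∧ B) ˢᵗ    = (A ˢᵗ) ∧ (B ˢᵗ)
(A ∨ B) ˢᵗ    = (A ˢᵗ) ∨ (B ˢᵗ)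
(A ⇒ B) ˢᵗ    = (A ˢᵗ) ⇒ (B ˢᵗ)
(∀[ σ ] A) ˢᵗ = ∀ˢᵗ[ σ ] (A ˢᵗ)
(∃[ σ ] A) ˢᵗ = ∃ˢᵗ[ σ ] (A ˢᵗ)

Internal : ∀ {Γ} → Fm Γ → Set
Internal (t ≐ u)    = ⊤
Internal (st t)     = ⊥
Internal ⊥̇          = ⊤
Internal (A ∧ B)    = Internal A × Internal B
Internal (A ∨ B)    = Internal A × Internal B
Internal (A ⇒ B)    = Internal A × Internal B
Internal (∀[ σ ] A) = Internal A
Internal (∃[ σ ] A) = Internal A

-- Quantifier-free and internal.
QuantifierFree : ∀ {Γ} → Fm Γ → Set
QuantifierFree (t ≐ u)    = ⊤
QuantifierFree (st t)     = ⊥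
QuantifierFree ⊥̇          = ⊤
QuantifierFree (A ∧ B)    = QuantifierFree A × QuantifierFree B
QuantifierFree (A ∨ B)    = QuantifierFree A × QuantifierFree B
QuantifierFree (A ⇒ B)    = QuantifierFree A × QuantifierFree B
QuantifierFree (∀[ σ ] A) = ⊥
QuantifierFree (∃[ σ ] A) = ⊥

infix 6 _<̇_ _≈_ _∈̇_

_<̇_ : ∀ {Γ} → Tm Γ N → Tm Γ N → Fm Γ
t <̇ u = monus · (con suc · t) · u ≐ 𝟎

-- Equality at higher types is defined, pointwise at function types and
-- entrywise at sequence types.
_≈_ : ∀ {Γ σ} → Tm Γ σ → Tm Γ σ → Fm Γ
_≈_ {σ = N}     t u = t ≐ u
_≈_ {σ = σ ⟶ τ} t u = ∀[ σ ] wk t · v₀ ≈ wk u · v₀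
_≈_ {σ = σ ✶}   t u =
  con len · t ≐ con len · u ∧
  (∀[ N ] v₀ <̇ con len · wk t ⇒ con ent · wk t · v₀ ≈ con ent · wk u · v₀)

_∈̇_ : ∀ {Γ σ} → Tm Γ σ → Tm Γ (σ ✶) → Fm Γ
t ∈̇ s = ∃[ N ] v₀ <̇ con len · wk s ∧ wk t ≈ con ent · wk s · v₀

------------------------------------------------------------------------
-- Classical many-sorted natural deduction over a set of axioms

Theory : Set₁
Theory = ∀ {Γ} → Fm Γ → Set

data Derivation (T : Theory) (Γ : Ctx) (Δ : List (Fm Γ)) : Fm Γ → Set where
  axiom : ∀ {A} → T A → Derivation T Γ Δ A
  hyp   : ∀ {A} → A ∈ Δ → Derivation T Γ Δ A
  raa   : ∀ {A} → Derivation T Γ ((¬ A) ∷ Δ) ⊥̇ → Derivation T Γ Δ A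
  ∧I    : ∀ {A B} → Derivation T Γ Δ A → Derivation T Γ Δ B →
          Derivation T Γ Δ (A ∧ B)
  ∧E₁   : ∀ {A B} → Derivation T Γ Δ (A ∧ B) → Derivation T Γ Δ A
  ∧E₂   : ∀ {A B} → Derivation T Γ Δ (A ∧ B) → Derivation T Γ Δ B
  ∨I₁   : ∀ {A B} → Derivation T Γ Δ A → Derivation T Γ Δ (A ∨ B)
  ∨I₂   : ∀ {A B} → Derivation T Γ Δ B → Derivation T Γ Δ (A ∨ B)
  ∨E    : ∀ {A B C} → Derivation T Γ Δ (A ∨ B) →
          Derivation T Γ (A ∷ Δ) C → Derivation T Γ (B ∷ Δ) C →
          Derivation T Γ Δ C
  ⇒I    : ∀ {A B} → Derivation T Γ (A ∷ Δ) B → Derivation T Γ Δ (A ⇒ B)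
  ⇒E    : ∀ {A B} → Derivation T Γ Δ (A ⇒ B) → Derivation T Γ Δ A →
          Derivation T Γ Δ B
  ∀I    : ∀ {σ A} → Derivation T (σ ∷ Γ) (map wkF Δ) A →
          Derivation T Γ Δ (∀[ σ ] A)
  ∀E    : ∀ {σ A} → Derivation T Γ Δ (∀[ σ ] A) → (t : Tm Γ σ) →
          Derivation T Γ Δ (A [ t ])
  ∃I    : ∀ {σ A} (t : Tm Γ σ) → Derivation T Γ Δ (A [ t ]) →
          Derivation T Γ Δ (∃[ σ ] A)
  ∃E    : ∀ {σ A C} → Derivation T Γ Δ (∃[ σ ] A) →
          Derivation T (σ ∷ Γ) (A ∷ map wkF Δ) (wkF C) →
          Derivation T Γ Δ C

infix 0 _⊢_

_⊢_ : Theory → Fm [] → Set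
T ⊢ A = Derivation T [] [] A

------------------------------------------------------------------------
-- The principles

-- A set is a type 1 object, with x ∈ X meaning X x = 1.
_∈ˢ_ : ∀ {Γ} → Tm Γ N → Tm Γ type1 → Fm Γ
x ∈ˢ X = X · x ≐ 𝟏

infix 6 _∈ˢ_

STP : Fm []
STP = ∀[ type1 ] ∃ˢᵗ[ type1 ] ∀ˢᵗ[ N ] (v₀ ∈ˢ v₂ ⇔ v₀ ∈ˢ v₁)

-- The free variable is S².
suslin : Fm (type2 ∷ [])
suslin = ∀[ type1 ]
  (v₁ · v₀ ≐ 𝟎 ⇔ (∃[ type1 ] ∀[ N ] ¬ (v₂ · (initial · v₁ · v₀) ≐ 𝟎)))

S² : Fm []
S² = ∃[ type2 ] suslin

-- `suslin' leaves the nonzero values of S open, so it does not specify S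
-- uniquely; the normalisation to values 0 and 1 does.
uniqueSuslin : Fm (type2 ∷ [])
uniqueSuslin = suslin ∧ (∀[ type1 ] (v₁ · v₀ ≐ 𝟎 ∨ v₁ · v₀ ≐ 𝟏))

-- Player 0 wins the play h of the game with payoff f.
φ : ∀ {Γ} → Tm Γ type1 → Tm Γ type1 → Fm Γ
φ h f = ∃[ N ] wk f · (initial · wk h · v₀) ≐ 𝟎

Σ⁰₁-DET* : Fm []
Σ⁰₁-DET* = ∀ˢᵗ[ type1 ]
  ( (∃ˢᵗ[ Strategy ] ∀[ Strategy ] φ (v₁ ⊗ v₀) v₂)
  ∨ (∃ˢᵗ[ Strategy ] ∀[ Strategy ] ¬ φ (v₀ ⊗ v₁) v₂) )

-- An element p of the type 1 × 1 is coded as an object of type 0 → 1, with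
-- components p 1 and p 2.
UΣ⁰₁-DET : Fm []
UΣ⁰₁-DET = ∃[ type1 ⟶ (N ⟶ Strategy) ] ∀[ type1 ]
  ( (∀[ Strategy ] φ ((v₂ · v₁ · 𝟏) ⊗ v₀) v₁)
  ∨ (∀[ Strategy ] ¬ φ (v₀ ⊗ (v₂ · v₁ · 𝟐)) v₁) )

------------------------------------------------------------------------
-- The theories.  Axioms may have parameters, namely the variables in Γ.

data RCA₀ω {Γ : Ctx} : Fm Γ → Set where
  ≐-refl  : (t : Tm Γ N) → RCA₀ω (t ≐ t)
  ≐-sym   : (t u : Tm Γ N) → RCA₀ω (t ≐ u ⇒ u ≐ t)
  ≐-trans : (t u w : Tm Γ N) → RCA₀ω (t ≐ u ⇒ u ≐ w ⇒ t ≐ w)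
  𝗞-eq    : ∀ {σ τ} (x : Tm Γ σ) (y : Tm Γ τ) → RCA₀ω (con 𝗞 · x · y ≈ x)
  𝗦-eq    : ∀ {ρ σ τ}
            (x : Tm Γ (ρ ⟶ σ ⟶ τ)) (y : Tm Γ (ρ ⟶ σ)) (z : Tm Γ ρ) →
            RCA₀ω (con 𝗦 · x · y · z ≈ x · z · (y · z))
  suc≠0   : (n : Tm Γ N) → RCA₀ω (¬ (con suc · n ≐ 𝟎))
  suc-inj : (m n : Tm Γ N) → RCA₀ω (con suc · m ≐ con suc · n ⇒ m ≐ n)
  R₀-zero : (y : Tm Γ N) (z : Tm Γ (N ⟶ N ⟶ N)) →
            RCA₀ω (con R₀ · 𝟎 · y · z ≐ y)
  R₀-suc  : (n y : Tm Γ N) (z : Tm Γ (N ⟶ N ⟶ N)) →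
            RCA₀ω (con R₀ · (con suc · n) · y · z ≐
                   z · (con R₀ · n · y · z) · n)
  len-tab : ∀ {σ} (g : Tm Γ (N ⟶ σ)) (n : Tm Γ N) →
            RCA₀ω (con len · (con tab · g · n) ≐ n)
  ent-tab : ∀ {σ} (g : Tm Γ (N ⟶ σ)) (n i : Tm Γ N) →
            RCA₀ω (i <̇ n ⇒ con ent · (con tab · g · n) · i ≈ g · i)
  -- By convention the entries beyond the length are zero.
  ent-out : ∀ {σ} (s : Tm Γ (σ ✶)) (i : Tm Γ N) →
            RCA₀ω (¬ (i <̇ con len · s) ⇒ con ent · s · i ≈ zeroAt σ)
  ext     : ∀ {ρ τ} (x y : Tm Γ ρ) (F : Tm Γ (ρ ⟶ τ)) →
            RCA₀ω (x ≈ y ⇒ F · x ≈ F · y)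
  QF-IND  : (A : Fm (N ∷ Γ)) → QuantifierFree A →
            RCA₀ω (A [ 𝟎 ] ∧ (∀[ N ] A ⇒ A ⟦ skip₁ ▸ con suc · v₀ ⟧) ⇒
                   (∀[ N ] A))
  QF-AC¹⁰ : (A : Fm (N ∷ type1 ∷ Γ)) → QuantifierFree A →
            RCA₀ω ((∀[ type1 ] ∃[ N ] A) ⇒
                   (∃[ type2 ] ∀[ type1 ] A ⟦ skip₂ ▸ v₀ ▸ v₁ · v₀ ⟧))

data RCA₀Ω {Γ : Ctx} : Fm Γ → Set where
  rca₀ω     : ∀ {A} → RCA₀ω A → RCA₀Ω A
  st-≈      : ∀ {σ} (x y : Tm Γ σ) → RCA₀Ω (st x ⇒ x ≈ y ⇒ st y)
  st-closed : ∀ {σ} (t : Tm [] σ) → RCA₀Ω (st (closedᵗ t))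
  st-app    : ∀ {σ τ} (F : Tm Γ (σ ⟶ τ)) (x : Tm Γ σ) →
              RCA₀Ω (st F ⇒ st x ⇒ st (F · x))
  st-<      : (m n : Tm Γ N) → RCA₀Ω (st n ⇒ m <̇ n ⇒ st m)
  -- In A, the variables v₀ and v₁ are z and y.
  I         : ∀ {σ τ} (A : Fm (σ ∷ τ ∷ Γ)) → Internal A →
              RCA₀Ω ((∀ˢᵗ[ σ ✶ ] ∃[ τ ] ∀[ σ ]
                        v₀ ∈̇ v₂ ⇒ A ⟦ skip₃ ▸ v₁ ▸ v₀ ⟧) ⇒
                     (∃[ τ ] ∀ˢᵗ[ σ ] A))
  -- In A, the variables v₀ and v₁ are y and x.
  HAC-int   : ∀ {ρ τ} (A : Fm (τ ∷ ρ ∷ Γ)) → Internal A →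
              RCA₀Ω ((∀ˢᵗ[ ρ ] ∃ˢᵗ[ τ ] A) ⇒
                     (∃ˢᵗ[ ρ ⟶ τ ✶ ] ∀ˢᵗ[ ρ ] ∃[ τ ]
                        v₀ ∈̇ v₂ · v₁ ∧ A ⟦ skip₃ ▸ v₁ ▸ v₀ ⟧))
  PF-TP∀    : ∀ {τ} (A : Fm (τ ∷ [])) → Internal A →
              RCA₀Ω (closed ((∀ˢᵗ[ τ ] A) ⇒ (∀[ τ ] A)))
  Ξ₀-ax     : RCA₀Ω (closed
                (st (con Ξ₀) ∧
                 (∀ˢᵗ[ type2 ]
                    uniqueSuslin ˢᵗ ⇒ (∀ˢᵗ[ type1 ] con Ξ₀ · v₀ ≐ v₁ · v₀))))

data RCA₀Ω+STP {Γ : Ctx} : Fm Γ → Set where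
  rca₀Ω : ∀ {A} → RCA₀Ω A → RCA₀Ω+STP A
  stp   : RCA₀Ω+STP (closed STP)

module Submission where

-- (S²)ˢᵗ yields uniform determinacy as follows.  By PF-TP∀, Ξ₀ is the Suslin
-- functional on all inputs, and it decides greatest fixed points, that is, the
-- largest X with x ∈ X → ∀ a ∃ r (c x a r ≠ 0 ∧ nx x a r ∈ X).  Ordinal ranks
-- are avoided by comparing two positions t and u of a game with the greatest
-- relation such that t is won already, or u is not and the moves of the player
-- to move can be matched (`rel').  Player 0 moves to a least successor.  If a
-- play t₀, t₁, … against this strategy is lost, then player 1 can remain forever
-- among the positions that are above some tₖ or start an infinite descending
-- chain, and so wins.  By HAC-int and Π⁰₁-transfer there is a standard selection
-- functional for zeros of standard functions, which makes the strategies
-- standard and uniform in the game.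
--
-- Conversely, determinacy of the games in which player 0 has to open with a zero
-- of j, or in which player 1 builds a path through f, yields a standard
-- selection functional and decides whether f has a path.
--
-- The derivations are written in higher-order abstract syntax, as elements of
-- Pf A, and are translated by the partial function check.

open import Defs
open import Data.Bool.Base using (Bool; true; false; T) renaming (_∨_ to _∨ᵇ_)
open import Data.Empty using (⊥; ⊥-elim)
open import Data.List.Base using (List; []; _∷_; map; _++_; length)
open import Data.List.Membership.Propositional using (_∈_)
open import Data.List.Membership.Propositional.Properties using (∈-map⁺)
open import Data.List.Relation.Unary.All using (All; []; _∷_)
open import Data.List.Relation.Unary.Any using (here; there)
open import Data.Maybe using (Maybe; just; nothing; _>>=_; is-just; to-witness-T)
open import Data.Nat.Base using (ℕ; _≡ᵇ_)
import Data.Nat.Base as ℕ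
import Data.Nat.Properties as ℕ
open import Data.Product.Base using (Σ; _×_; _,_; proj₁; proj₂)
open import Data.Sum.Base using (_⊎_; inj₁; inj₂)
open import Data.Unit.Base using (⊤; tt)
open import Relation.Binary.PropositionalEquality
  using (_≡_; refl; sym; trans; cong; cong₂; subst; subst₂)
open import Relation.Nullary using (yes; no)

-- Substitution

-- The obstacle is that PF-TP∀ forbids parameters: a standard S as in (S²)ˢᵗ cannot occur in a
-- transferred formula, but the constant `Ξ₀`, which agrees with a normalised S, can. Transfer with
-- a standard parameter f is then recovered: "if f has a zero then `Ξ₀` vanishes at a tree computed
-- from f" is parameter-free and transfers, and its converse is applied at the standard f only. In
-- terms of ordinals `rel f f b t u` means that the rank of t is at most the rank of u, where
-- positions not won by player 0 have rank infinity. An infinite descending chain would then be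
-- absurd, but this needs well-foundedness. Instead, positions that start such a chain are counted
-- as good for player 1, and this set is shown to be closed under the moves of the game. Greatest
-- fixed points are decided by terms of type 0. Statements about them are therefore arithmetical, or
-- even equations, and so within reach of quantifier-free induction, of QF-AC and of further fixed
-- points.

sub-cong : ∀ {Γ Δ τ} {s r : Sub Γ Δ} → (∀ {σ} (x : σ ∈ Γ) → s x ≡ r x) →
           (t : Tm Γ τ) → t ⟦ s ⟧ᵗ ≡ t ⟦ r ⟧ᵗ
sub-cong e (var x) = e x
sub-cong e (con c) = refl
sub-cong e (t · u) = cong₂ _·_ (sub-cong e t) (sub-cong e u)

sub-var : ∀ {Γ τ} (t : Tm Γ τ) → t ⟦ var ⟧ᵗ ≡ t
sub-var (var x) = refl
sub-var (con c) = refl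
sub-var (t · u) = cong₂ _·_ (sub-var t) (sub-var u)

sub-sub : ∀ {Γ Δ Θ τ} (s : Sub Γ Δ) (r : Sub Δ Θ) (t : Tm Γ τ) →
          t ⟦ s ⟧ᵗ ⟦ r ⟧ᵗ ≡ t ⟦ (λ x → s x ⟦ r ⟧ᵗ) ⟧ᵗ
sub-sub s r (var x) = refl
sub-sub s r (con c) = refl
sub-sub s r (t · u) = cong₂ _·_ (sub-sub s r t) (sub-sub s r u)

wk-sub : ∀ {Γ Δ σ τ} (s : Sub (σ ∷ Γ) Δ) (t : Tm Γ τ) →
         wk t ⟦ s ⟧ᵗ ≡ t ⟦ (λ x → s (there x)) ⟧ᵗ
wk-sub s t = sub-sub skip₁ s t

wk-inst : ∀ {Γ σ τ} (u : Tm Γ σ) (t : Tm Γ τ) → wk t ⟦ var ▸ u ⟧ᵗ ≡ t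
wk-inst u t = trans (wk-sub (var ▸ u) t) (sub-var t)

wk-lift : ∀ {Γ Δ σ τ} (s : Sub Γ Δ) (t : Tm Γ τ) →
          wk {σ = σ} t ⟦ lift s ⟧ᵗ ≡ wk (t ⟦ s ⟧ᵗ)
wk-lift s t = trans (wk-sub (lift s) t) (sym (sub-sub s skip₁ t))

lift-cong : ∀ {Γ Δ τ} {s r : Sub Γ Δ} → (∀ {σ} (x : σ ∈ Γ) → s x ≡ r x) →
            ∀ {σ} (x : σ ∈ τ ∷ Γ) → lift s x ≡ lift r x
lift-cong e (here refl) = refl
lift-cong e (there x)   = cong wk (e x)

lift-var : ∀ {Γ τ σ} (x : σ ∈ τ ∷ Γ) → lift {Γ} var x ≡ var x
lift-var (here refl) = refl
lift-var (there x)   = refl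

lift-sub : ∀ {Γ Δ Θ τ} (s : Sub Γ Δ) (r : Sub Δ Θ) →
           ∀ {σ} (x : σ ∈ τ ∷ Γ) →
           lift s x ⟦ lift r ⟧ᵗ ≡ lift (λ y → s y ⟦ r ⟧ᵗ) x
lift-sub s r (here refl) = refl
lift-sub s r (there x)   = wk-lift r (s x)

fsub-cong : ∀ {Γ Δ} {s r : Sub Γ Δ} → (∀ {σ} (x : σ ∈ Γ) → s x ≡ r x) →
            (A : Fm Γ) → A ⟦ s ⟧ ≡ A ⟦ r ⟧
fsub-cong e (t ≐ u)    = cong₂ _≐_ (sub-cong e t) (sub-cong e u)
fsub-cong e (st t)     = cong st (sub-cong e t)
fsub-cong e ⊥̇          = refl
fsub-cong e (A ∧ B)    = cong₂ _∧_ (fsub-cong e A) (fsub-cong e B)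
fsub-cong e (A ∨ B)    = cong₂ _∨_ (fsub-cong e A) (fsub-cong e B)
fsub-cong e (A ⇒ B)    = cong₂ _⇒_ (fsub-cong e A) (fsub-cong e B)
fsub-cong e (∀[ σ ] A) = cong (∀[ σ ]_) (fsub-cong (lift-cong e) A)
fsub-cong e (∃[ σ ] A) = cong (∃[ σ ]_) (fsub-cong (lift-cong e) A)

fsub-var : ∀ {Γ} (A : Fm Γ) → A ⟦ var ⟧ ≡ A
fsub-var (t ≐ u)    = cong₂ _≐_ (sub-var t) (sub-var u)
fsub-var (st t)     = cong st (sub-var t)
fsub-var ⊥̇          = refl
fsub-var (A ∧ B)    = cong₂ _∧_ (fsub-var A) (fsub-var B)
fsub-var (A ∨ B)    = cong₂ _∨_ (fsub-var A) (fsub-var B)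
fsub-var (A ⇒ B)    = cong₂ _⇒_ (fsub-var A) (fsub-var B)
fsub-var (∀[ σ ] A) =
  cong (∀[ σ ]_) (trans (fsub-cong lift-var A) (fsub-var A))
fsub-var (∃[ σ ] A) =
  cong (∃[ σ ]_) (trans (fsub-cong lift-var A) (fsub-var A))

fsub-sub : ∀ {Γ Δ Θ} (s : Sub Γ Δ) (r : Sub Δ Θ) (A : Fm Γ) →
           A ⟦ s ⟧ ⟦ r ⟧ ≡ A ⟦ (λ x → s x ⟦ r ⟧ᵗ) ⟧
fsub-sub s r (t ≐ u)    = cong₂ _≐_ (sub-sub s r t) (sub-sub s r u)
fsub-sub s r (st t)     = cong st (sub-sub s r t)
fsub-sub s r ⊥̇          = refl
fsub-sub s r (A ∧ B)    = cong₂ _∧_ (fsub-sub s r A) (fsub-sub s r B)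
fsub-sub s r (A ∨ B)    = cong₂ _∨_ (fsub-sub s r A) (fsub-sub s r B)
fsub-sub s r (A ⇒ B)    = cong₂ _⇒_ (fsub-sub s r A) (fsub-sub s r B)
fsub-sub s r (∀[ σ ] A) = cong (∀[ σ ]_)
  (trans (fsub-sub (lift s) (lift r) A) (fsub-cong (lift-sub s r) A))
fsub-sub s r (∃[ σ ] A) = cong (∃[ σ ]_)
  (trans (fsub-sub (lift s) (lift r) A) (fsub-cong (lift-sub s r) A))

inst-v₀ : ∀ {Γ σ} (A : Fm (σ ∷ Γ)) → A ⟦ lift skip₁ ⟧ ⟦ var ▸ v₀ ⟧ ≡ A
inst-v₀ A = trans (fsub-sub (lift skip₁) (var ▸ v₀) A)
  (trans (fsub-cong (λ { (here refl) → refl ; (there x) → refl }) A)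
         (fsub-var A))

≈-sub : ∀ {Γ Δ} σ (s : Sub Γ Δ) (t u : Tm Γ σ) →
        (t ≈ u) ⟦ s ⟧ ≡ (t ⟦ s ⟧ᵗ ≈ u ⟦ s ⟧ᵗ)
≈-sub N       s t u = refl
≈-sub (σ ⟶ τ) s t u = cong (∀[ σ ]_)
  (trans (≈-sub τ (lift s) (wk t · v₀) (wk u · v₀))
         (cong₂ (λ a b → a · v₀ ≈ b · v₀) (wk-lift s t) (wk-lift s u)))
≈-sub (σ ✶)   s t u = cong (λ A → con len · (t ⟦ s ⟧ᵗ) ≐ con len · (u ⟦ s ⟧ᵗ) ∧
    (∀[ N ] A))
  (cong₂ _⇒_ (cong (λ a → v₀ <̇ con len · a) (wk-lift s t))
    (trans (≈-sub σ (lift s) (con ent · wk t · v₀) (con ent · wk u · v₀))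
           (cong₂ (λ a b → con ent · a · v₀ ≈ con ent · b · v₀)
                  (wk-lift s t) (wk-lift s u))))

-- Derived rules

D : (Γ : Ctx) → List (Fm Γ) → Fm Γ → Set
D Γ Δ A = Derivation RCA₀Ω+STP Γ Δ A

ω : ∀ {Γ Δ A} → RCA₀ω A → D Γ Δ A
ω a = axiom (rca₀Ω (rca₀ω a))

h₀ : ∀ {Γ Δ A} → D Γ (A ∷ Δ) A
h₀ = hyp (here refl)

h₁ : ∀ {Γ Δ A B} → D Γ (B ∷ A ∷ Δ) A
h₁ = hyp (there (here refl))

h₂ : ∀ {Γ Δ A B C} → D Γ (C ∷ B ∷ A ∷ Δ) A
h₂ = hyp (there (there (here refl)))

h₃ : ∀ {Γ Δ A B C E} → D Γ (E ∷ C ∷ B ∷ A ∷ Δ) A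
h₃ = hyp (there (there (there (here refl))))

∀E≡ : ∀ {Γ Δ σ A B} → D Γ Δ (∀[ σ ] A) → (t : Tm Γ σ) → A ⟦ var ▸ t ⟧ ≡ B →
      D Γ Δ B
∀E≡ p t refl = ∀E p t

∃I≡ : ∀ {Γ Δ σ B} A (t : Tm Γ σ) → A ⟦ var ▸ t ⟧ ≡ B → D Γ Δ B →
      D Γ Δ (∃[ σ ] A)
∃I≡ A t refl p = ∃I t p

∀v₀ : ∀ {Γ σ A} {Δ : List (Fm (σ ∷ Γ))} → D (σ ∷ Γ) Δ (wkF (∀[ σ ] A)) → D (σ ∷ Γ) Δ A
∀v₀ {A = A} p = ∀E≡ p v₀ (inst-v₀ A)

∃v₀ : ∀ {Γ σ A} {Δ : List (Fm (σ ∷ Γ))} → D (σ ∷ Γ) Δ A → D (σ ∷ Γ) Δ (wkF (∃[ σ ] A))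
∃v₀ {A = A} p = ∃I≡ (A ⟦ lift skip₁ ⟧) v₀ (inst-v₀ A) p

≐r : ∀ {Γ Δ} (t : Tm Γ N) → D Γ Δ (t ≐ t)
≐r t = ω (≐-refl t)

≐s : ∀ {Γ Δ} {t u : Tm Γ N} → D Γ Δ (t ≐ u) → D Γ Δ (u ≐ t)
≐s p = ⇒E (ω (≐-sym _ _)) p

≐t : ∀ {Γ Δ} {t u w : Tm Γ N} → D Γ Δ (t ≐ u) → D Γ Δ (u ≐ w) → D Γ Δ (t ≐ w)
≐t p q = ⇒E (⇒E (ω (≐-trans _ _ _)) p) q

<-resp : ∀ {Γ Δ} {i t u : Tm Γ N} → D Γ Δ (t ≐ u) → D Γ Δ (i <̇ u) → D Γ Δ (i <̇ t)
<-resp p q = ≐t (⇒E (ω (ext _ _ (monus · (con suc · _)))) p) q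

≈-refl : ∀ {Γ Δ} σ (t : Tm Γ σ) → D Γ Δ (t ≈ t)
≈-refl N       t = ≐r t
≈-refl (σ ⟶ τ) t = ∀I (≈-refl τ (wk t · v₀))
≈-refl (σ ✶)   t = ∧I (≐r _) (∀I (⇒I (≈-refl σ _)))

≈-sym : ∀ {Γ Δ} σ (t u : Tm Γ σ) → D Γ Δ (t ≈ u ⇒ u ≈ t)
≈-sym N       t u = ω (≐-sym t u)
≈-sym (σ ⟶ τ) t u =
  ⇒I (∀I (⇒E (≈-sym τ (wk t · v₀) (wk u · v₀)) (∀v₀ h₀)))
≈-sym (σ ✶)   t u = ⇒I (∧I (≐s (∧E₁ h₀))
  (∀I (⇒I (⇒E (≈-sym σ (con ent · wk t · v₀) (con ent · wk u · v₀))
    (⇒E (∀v₀ (∧E₂ h₁)) (<-resp (∧E₁ h₁) h₀))))))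

≈-trans : ∀ {Γ Δ} σ (t u w : Tm Γ σ) → D Γ Δ (t ≈ u ⇒ u ≈ w ⇒ t ≈ w)
≈-trans N       t u w = ω (≐-trans t u w)
≈-trans (σ ⟶ τ) t u w = ⇒I (⇒I (∀I
  (⇒E (⇒E (≈-trans τ (wk t · v₀) (wk u · v₀) (wk w · v₀)) (∀v₀ h₁)) (∀v₀ h₀))))
≈-trans (σ ✶)   t u w = ⇒I (⇒I (∧I (≐t (∧E₁ h₁) (∧E₁ h₀)) (∀I (⇒I
  (⇒E (⇒E (≈-trans σ (con ent · wk t · v₀) (con ent · wk u · v₀)
                     (con ent · wk w · v₀))
          (⇒E (∀v₀ (∧E₂ h₂)) h₀))
      (⇒E (∀v₀ (∧E₂ h₁)) (<-resp (≐s (∧E₁ h₂)) h₀)))))))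

≈s : ∀ {Γ Δ σ} {t u : Tm Γ σ} → D Γ Δ (t ≈ u) → D Γ Δ (u ≈ t)
≈s {t = t} {u} p = ⇒E (≈-sym _ t u) p

≈t : ∀ {Γ Δ σ} {t u w : Tm Γ σ} → D Γ Δ (t ≈ u) → D Γ Δ (u ≈ w) → D Γ Δ (t ≈ w)
≈t {t = t} {u} {w} p q = ⇒E (⇒E (≈-trans _ t u w) p) q

≈-app : ∀ {Γ Δ σ τ} {F G : Tm Γ (σ ⟶ τ)} {t u : Tm Γ σ} →
        D Γ Δ (F ≈ G) → D Γ Δ (t ≈ u) → D Γ Δ (F · t ≈ G · u)
≈-app {τ = τ} {F} {G} {t} {u} p q = ≈t {u = F · u} (⇒E (ω (ext t u F)) q)
  (∀E≡ p u (trans (≈-sub τ (var ▸ u) (wk F · v₀) (wk G · v₀))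
    (cong₂ (λ a b → a · u ≈ b · u) (wk-inst u F) (wk-inst u G))))

≡⇒≈ : ∀ {Γ Δ σ} {t u : Tm Γ σ} → t ≡ u → D Γ Δ (t ≈ u)
≡⇒≈ refl = ≈-refl _ _

-- The equation is required as a hypothesis, not as a derivation, because membership in the context
-- survives `map wkF`; going under a quantifier then needs no weakening of derivations.
Agree : ∀ {Γ} → List (Fm Γ) → ∀ {σ} → Tm Γ σ → Tm Γ σ → Set
Agree Δ t u = t ≡ u ⊎ (t ≈ u) ∈ Δ

agree-≈ : ∀ {Γ Δ σ} {t u : Tm Γ σ} → Agree Δ t u → D Γ Δ (t ≈ u)
agree-≈ (inj₁ e) = ≡⇒≈ e
agree-≈ (inj₂ x) = hyp x

agree-lift : ∀ {Γ Γ′ τ} {Δ : List (Fm Γ)} {s r : Sub Γ′ Γ} →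
             (∀ {σ} (x : σ ∈ Γ′) → Agree Δ (s x) (r x)) →
             ∀ {σ} (x : σ ∈ τ ∷ Γ′) → Agree (map wkF Δ) (lift s x) (lift r x)
agree-lift a (here refl) = inj₁ refl
agree-lift {Δ = Δ} {s} {r} a (there x) with a x
... | inj₁ e = inj₁ (cong wk e)
... | inj₂ y = inj₂ (subst (_∈ map wkF Δ) (≈-sub _ skip₁ (s x) (r x)) (∈-map⁺ wkF y))

leibniz-tm : ∀ {Γ Γ′ Δ τ} {s r : Sub Γ′ Γ} →
             (∀ {σ} (x : σ ∈ Γ′) → Agree Δ (s x) (r x)) →
             (t : Tm Γ′ τ) → D Γ Δ (t ⟦ s ⟧ᵗ ≈ t ⟦ r ⟧ᵗ)
leibniz-tm a (var x) = agree-≈ (a x)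
leibniz-tm a (con c) = ≈-refl _ _
leibniz-tm a (t · u) = ≈-app (leibniz-tm a t) (leibniz-tm a u)

⇔-st : ∀ {Γ Δ σ} {t u : Tm Γ σ} → D Γ Δ (t ≈ u ⇒ (st t ⇔ st u))
⇔-st {t = t} {u} = ⇒I (∧I
  (⇒I (⇒E (⇒E (axiom (rca₀Ω (st-≈ t u))) h₀) h₁))
  (⇒I (⇒E (⇒E (axiom (rca₀Ω (st-≈ u t))) h₀) (≈s h₁))))

⇔-≐ : ∀ {Γ Δ} {t t′ u u′ : Tm Γ N} → D Γ Δ (t ≐ t′) → D Γ Δ (u ≐ u′) →
      D Γ Δ (t ≐ u ⇔ t′ ≐ u′)
⇔-≐ p q = ⇒E (⇒E (⇒I (⇒I (∧I (⇒I (≐t (≐s h₂) (≐t h₀ h₁)))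
                             (⇒I (≐t h₂ (≐t h₀ (≐s h₁))))))) p) q

-- The premises are object-level implications: they enter the context through `⇒I` and stay usable
-- below further hypotheses, which derivations from Δ would not.
⇔-∧ : ∀ {Γ Δ} {A A′ B B′ : Fm Γ} →
      D Γ Δ ((A ⇔ A′) ⇒ (B ⇔ B′) ⇒ (A ∧ B ⇔ A′ ∧ B′))
⇔-∧ = ⇒I (⇒I (∧I
  (⇒I (∧I (⇒E (∧E₁ h₂) (∧E₁ h₀)) (⇒E (∧E₁ h₁) (∧E₂ h₀))))
  (⇒I (∧I (⇒E (∧E₂ h₂) (∧E₁ h₀)) (⇒E (∧E₂ h₁) (∧E₂ h₀))))))

⇔-∨ : ∀ {Γ Δ} {A A′ B B′ : Fm Γ} →
      D Γ Δ ((A ⇔ A′) ⇒ (B ⇔ B′) ⇒ (A ∨ B ⇔ A′ ∨ B′))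
⇔-∨ = ⇒I (⇒I (∧I
  (⇒I (∨E h₀ (∨I₁ (⇒E (∧E₁ h₃) h₀)) (∨I₂ (⇒E (∧E₁ h₂) h₀))))
  (⇒I (∨E h₀ (∨I₁ (⇒E (∧E₂ h₃) h₀)) (∨I₂ (⇒E (∧E₂ h₂) h₀))))))

⇔-⇒ : ∀ {Γ Δ} {A A′ B B′ : Fm Γ} →
      D Γ Δ ((A ⇔ A′) ⇒ (B ⇔ B′) ⇒ ((A ⇒ B) ⇔ (A′ ⇒ B′)))
⇔-⇒ = ⇒I (⇒I (∧I
  (⇒I (⇒I (⇒E (∧E₁ h₂) (⇒E h₁ (⇒E (∧E₂ h₃) h₀)))))
  (⇒I (⇒I (⇒E (∧E₂ h₂) (⇒E h₁ (⇒E (∧E₁ h₃) h₀)))))))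

⇔-∀ : ∀ {Γ Δ σ} {A A′ : Fm (σ ∷ Γ)} →
      D Γ Δ ((∀[ σ ] (A ⇔ A′)) ⇒ ((∀[ σ ] A) ⇔ (∀[ σ ] A′)))
⇔-∀ = ⇒I (∧I (⇒I (∀I (⇒E (∧E₁ (∀v₀ h₁)) (∀v₀ h₀))))
             (⇒I (∀I (⇒E (∧E₂ (∀v₀ h₁)) (∀v₀ h₀)))))

⇔-∃ : ∀ {Γ Δ σ} {A A′ : Fm (σ ∷ Γ)} →
      D Γ Δ ((∀[ σ ] (A ⇔ A′)) ⇒ ((∃[ σ ] A) ⇔ (∃[ σ ] A′)))
⇔-∃ = ⇒I (∧I (⇒I (∃E h₀ (∃v₀ (⇒E (∧E₁ (∀v₀ h₂)) h₀))))
             (⇒I (∃E h₀ (∃v₀ (⇒E (∧E₂ (∀v₀ h₂)) h₀)))))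

⇒E₂ : ∀ {Γ Δ A B C} → D Γ Δ (A ⇒ B ⇒ C) → D Γ Δ A → D Γ Δ B → D Γ Δ C
⇒E₂ r p q = ⇒E (⇒E r p) q

leibniz-fm : ∀ {Γ Γ′ Δ} {s r : Sub Γ′ Γ} →
             (∀ {σ} (x : σ ∈ Γ′) → Agree Δ (s x) (r x)) →
             (A : Fm Γ′) → D Γ Δ (A ⟦ s ⟧ ⇔ A ⟦ r ⟧)
leibniz-fm a (t ≐ u)    = ⇔-≐ (leibniz-tm a t) (leibniz-tm a u)
leibniz-fm a (st t)     = ⇒E ⇔-st (leibniz-tm a t)
leibniz-fm a ⊥̇          = ∧I (⇒I h₀) (⇒I h₀)
leibniz-fm a (A ∧ B)    = ⇒E₂ ⇔-∧ (leibniz-fm a A) (leibniz-fm a B)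
leibniz-fm a (A ∨ B)    = ⇒E₂ ⇔-∨ (leibniz-fm a A) (leibniz-fm a B)
leibniz-fm a (A ⇒ B)    = ⇒E₂ ⇔-⇒ (leibniz-fm a A) (leibniz-fm a B)
leibniz-fm a (∀[ σ ] A) = ⇒E ⇔-∀ (∀I (leibniz-fm (agree-lift a) A))
leibniz-fm a (∃[ σ ] A) = ⇒E ⇔-∃ (∀I (leibniz-fm (agree-lift a) A))

leibniz : ∀ {Γ Δ σ} (A : Fm (σ ∷ Γ)) (t u : Tm Γ σ) →
          D Γ Δ (t ≈ u ⇒ A [ t ] ⇒ A [ u ])
leibniz A t u = ⇒I (∧E₁ (leibniz-fm
  (λ { (here refl) → inj₂ (here refl) ; (there x) → inj₁ refl }) A))

-- Syntax with constants

nth : {A : Set} → A → List A → ℕ → A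
nth d []       n           = d
nth d (x ∷ xs) ℕ.zero    = x
nth d (x ∷ xs) (ℕ.suc n) = nth d xs n

nthᴬ : {A : Set} {P : A → Set} {d : A} {xs : List A} → P d → All P xs → (n : ℕ) → P (nth d xs n)
nthᴬ p []       n           = p
nthᴬ p (q ∷ qs) ℕ.zero    = q
nthᴬ p (q ∷ qs) (ℕ.suc n) = nthᴬ p qs n

-- The type of the data `c` and `nx` of a fixed point problem, applied to a state, a challenge and a
-- reply; it is not the pure type 3.
type3 : Ty
type3 = N ⟶ N ⟶ N ⟶ N

-- Entries 0 to 11 are the arithmetical and game terms of the statement, in its order. Their
-- `bodies` repeat the definitions and `abstr` repeats `ƛ_`, so that the translated formulas reduce
-- to those of the theorem.
tys : List Ty
tys =
  (N ⟶ N ⟶ N) ∷ (N ⟶ N) ∷ (N ⟶ N ⟶ N) ∷ (N ⟶ N ⟶ N ⟶ N) ∷ (N ⟶ N) ∷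
  (N ⟶ N) ∷ (N ⟶ N ⟶ N) ∷ (N ⟶ N ⟶ N) ∷ (type1 ⟶ N ⟶ N) ∷
  (Strategy ⟶ Strategy ⟶ N ⟶ N ⟶ N) ∷ (Strategy ⟶ Strategy ⟶ N ⟶ N) ∷
  (Strategy ⟶ Strategy ⟶ type1) ∷
  (N ⟶ N) ∷ (N ⟶ N) ∷ (N ⟶ N) ∷ (N ⟶ N) ∷ (N ⟶ N) ∷ (N ⟶ N ⟶ N) ∷
  (N ⟶ N) ∷ (N ⟶ N ⟶ N) ∷ (N ✶ ⟶ type1 ⟶ N ⟶ N) ∷ (N ⟶ N) ∷
  (type3 ⟶ type3 ⟶ N ⟶ N) ∷ (type1 ⟶ N) ∷
  (type1 ⟶ type1 ⟶ N ⟶ N ⟶ N ⟶ N) ∷ (type1 ⟶ N ⟶ N ⟶ N) ∷ []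

size : ℕ
size = 26

ty : ℕ → Ty
ty = nth N tys

-- Terms and formulas in higher-order abstract syntax.  lev n is the n-th bound
-- variable, counted from the outermost one, and cst k the k-th entry of bodies.
data HTm : Ty → Set where
  lev  : ∀ {σ} → ℕ → HTm σ
  con  : ∀ {σ} → Con σ → HTm σ
  cst  : (k : ℕ) → HTm (ty k)
  _·_  : ∀ {σ τ} → HTm (σ ⟶ τ) → HTm σ → HTm τ
  lam′ : ∀ {σ τ} → (ℕ → HTm τ) → HTm (σ ⟶ τ)

lam : ∀ {σ τ} → (HTm σ → HTm τ) → HTm (σ ⟶ τ)
lam f = lam′ (λ n → f (lev n))

data HFm : Set where
  _≐_ : HTm N → HTm N → HFm
  st  : ∀ {σ} → HTm σ → HFm
  ⊥̇   : HFm
  _∧_ : HFm → HFm → HFm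
  _∨_ : HFm → HFm → HFm
  _⇒_ : HFm → HFm → HFm
  all : (σ : Ty) → (HTm σ → HFm) → HFm
  exi : (σ : Ty) → (HTm σ → HFm) → HFm


infix 4 _≟ᵀ_
infixr 10 1+_
infixl 9 _·_
infix  6 _≐_
infixr 5 _∧_
infixr 4 _∨_
infixr 3 _⇒_
infixl 7 _+_ _∸_
infixl 8 _⁀_ _‼_ _↾_

O : HTm N
O = con zero

1+_ pre par tri root left right init last ∣_∣ half : HTm N → HTm N
1+ t    = con suc · t
pre t   = cst 1 · t
par t   = cst 4 · t
tri t   = cst 5 · t
root t  = cst 12 · t
right t = cst 13 · t
left t  = cst 14 · t
init t  = cst 15 · t
last t  = cst 16 · t
∣ t ∣   = cst 18 · t
half t  = cst 21 · t

_+_ _∸_ ⟪_,_⟫ _⁀_ drop _‼_ : HTm N → HTm N → HTm N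
t + u     = cst 0 · t · u
t ∸ u     = cst 2 · t · u
⟪ t , u ⟫ = cst 6 · t · u
t ⁀ u     = cst 7 · t · u
drop t u  = cst 17 · t · u
t ‼ u     = cst 19 · t · u

if0 : HTm N → HTm N → HTm N → HTm N
if0 t u w = cst 3 · t · u · w

_↾_ : HTm type1 → HTm N → HTm N
h ↾ k = cst 8 · h · k

mv : HTm Strategy → HTm Strategy → HTm N → HTm N → HTm N
mv S₀ S₁ n p = cst 9 · S₀ · S₁ · n · p

pos : HTm Strategy → HTm Strategy → HTm N → HTm N
pos S₀ S₁ n = cst 10 · S₀ · S₁ · n

plays : HTm Strategy → HTm Strategy → HTm type1
plays S₀ S₁ = cst 11 · S₀ · S₁

search : HTm (N ✶) → HTm type1 → HTm N → HTm N
search L f n = cst 20 · L · f · n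

rec : HTm N → HTm N → (HTm N → HTm N → HTm N) → HTm N
rec n t u = con R₀ · n · t · (lam λ a → lam λ i → u a i)

eqOr : HTm N → HTm N → HTm N → HTm N
eqOr x₀ x m = if0 ((x ∸ x₀) + (x₀ ∸ x)) O m

-- The condition on x and a is tested at all codes d of length y such that
-- left y = ⟪ x , a ⟫ and d has the three entries that are consulted.
module _ (c nx : HTm type3) (x₀ : HTm N) where

  -- A zero rejects, since the paths of the Suslin functional avoid zeros. In contrast, m and m′ are
  -- membership values of x and of its successor, for which 0 means yes.
  val : HTm N → HTm N → HTm N → HTm N → HTm N → HTm N
  val x a m r m′ = if0 (eqOr x₀ x m) (if0 (c · x · a · r) O (if0 m′ (1+ O) O)) (1+ O)

  guard : HTm N → HTm N → HTm N → HTm N → HTm N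
  guard l x a r = (1+ ⟪ x , O ⟫ ∸ l) + (1+ ⟪ x , 1+ a ⟫ ∸ l) + (1+ ⟪ nx · x · a · r , O ⟫ ∸ l)

  guarded : HTm N → HTm N → HTm N → HTm N → HTm N
  guarded l x a d = if0 (guard l x a r) (val x a (d ‼ ⟪ x , O ⟫) r (d ‼ ⟪ nx · x · a · r , O ⟫)) (1+ O)
    where r = d ‼ ⟪ x , 1+ a ⟫

  tree : HTm type1
  tree = lam λ d → guarded ∣ d ∣ (left (left ∣ d ∣)) (right (left ∣ d ∣)) d

  decᵗ : HTm N
  decᵗ = con Ξ₀ · tree

dec : HTm type3 → HTm type3 → HTm N → HTm N
dec c nx x = cst 22 · c · nx · x

ex0 : HTm type1 → HTm N
ex0 f = cst 23 · f

-- rel g f b t u = 0 compares the position t of the game g with the position u of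
-- f, where b is the parity of their length.  chain f b t = 0 means that t starts
-- an infinite sequence no term of which is related to the next one.
rel : HTm type1 → HTm type1 → HTm N → HTm N → HTm N → HTm N
rel g f b t u = cst 24 · g · f · b · t · u

chain : HTm type1 → HTm N → HTm N → HTm N
chain f b t = cst 25 · f · b · t

-- The challenge a is a move at u when b = 0 and a move at t otherwise; the reply r is made at the
-- other position. Once g t = 0 the state repeats itself, and this accepting loop relates t to u
-- whatever f u is.
relC relN : HTm type1 → HTm type1 → HTm type3
relC g f = lam λ x → lam λ a → lam λ r → if0 (g · left (right x)) (1+ O) (f · right (right x))
relN g f = lam λ x → lam λ a → lam λ r → if0 (g · left (right x)) x
  (if0 (left x) ⟪ 1+ O , ⟪ left (right x) ⁀ r , right (right x) ⁀ a ⟫ ⟫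
                ⟪ O , ⟪ left (right x) ⁀ a , right (right x) ⁀ r ⟫ ⟫)

chainC : HTm type1 → HTm N → HTm type3
chainC f b = lam λ x → lam λ a → lam λ r → rel f f b x r

chainN : HTm type3
chainN = lam λ x → lam λ a → lam λ r → r

-- The search for a zero as a fixed point problem with the single state 0: a reply is accepted
-- exactly if it is a zero of f.
ex0C : HTm type1 → HTm type3
ex0C f = lam λ x → lam λ a → lam λ r → if0 (f · r) (1+ O) O

ex0N : HTm type3
ex0N = lam λ x → lam λ a → lam λ r → O

-- root z is the largest w with tri w ≤ z, so that left and right invert the
-- pairing; init c and last c split off the last entry of the code c, and drop
-- iterates init; search L f n is a zero of f among the first n entries of L,
-- if there is one.
bodies : All HTm tys
bodies =
  (lam λ x → lam λ y → rec y x λ a i → 1+ a) ∷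
  (lam λ x → rec x O λ a i → i) ∷
  (lam λ x → lam λ y → rec y x λ a i → pre a) ∷
  (lam λ c → lam λ x → lam λ y → rec c x λ a i → y) ∷
  (lam λ x → rec x O λ a i → 1+ O ∸ a) ∷
  (lam λ x → rec x O λ a i → 1+ i + a) ∷
  (lam λ x → lam λ y → tri (x + y) + y) ∷
  (lam λ x → lam λ y → 1+ ⟪ x , y ⟫) ∷
  (lam λ h → lam λ k → rec k O λ a i → a ⁀ (h · i)) ∷
  (lam λ S₀ → lam λ S₁ → lam λ n → lam λ p → if0 (par n) (S₀ · p) (S₁ · p)) ∷
  (lam λ S₀ → lam λ S₁ → lam λ n → rec n O λ a i → a ⁀ mv S₀ S₁ i a) ∷
  (lam λ S₀ → lam λ S₁ → lam λ n → mv S₀ S₁ n (pos S₀ S₁ n)) ∷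
  (lam λ z → rec z O λ a i → if0 (tri (1+ a) ∸ 1+ i) (1+ a) a) ∷
  (lam λ z → z ∸ tri (root z)) ∷
  (lam λ z → root z ∸ right z) ∷
  (lam λ c → left (pre c)) ∷
  (lam λ c → right (pre c)) ∷
  (lam λ c → lam λ k → rec k c λ a i → init a) ∷
  (lam λ c → rec c O λ a i → if0 (drop c i) a (1+ a)) ∷
  (lam λ c → lam λ i → last (drop c (∣ c ∣ ∸ 1+ i))) ∷
  (lam λ L → lam λ f → lam λ n → rec n O λ a i →
    if0 (f · (con ent · L · i)) (con ent · L · i) a) ∷
  (lam λ x → rec x O λ a i → a + par i) ∷
  (lam λ c → lam λ nx → lam λ x → decᵗ c nx x) ∷
  (lam λ f → dec (ex0C f) ex0N O) ∷
  (lam λ g → lam λ f → lam λ b → lam λ t → lam λ u → dec (relC g f) (relN g f) ⟪ b , ⟪ t , u ⟫ ⟫) ∷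
  (lam λ f → lam λ b → lam λ t → dec (chainC f b) chainN t) ∷ []

body : (k : ℕ) → HTm (ty k)
body = nthᴬ O bodies

-- First-order counterparts of HTm and HFm.
data Ex (Γ : Ctx) : Ty → Set where
  var : ∀ {σ} → σ ∈ Γ → Ex Γ σ
  con : ∀ {σ} → Con σ → Ex Γ σ
  cst : ∀ {σ} (k : ℕ) → ty k ≡ σ → Ex Γ σ
  _·_ : ∀ {σ τ} → Ex Γ (σ ⟶ τ) → Ex Γ σ → Ex Γ τ

data Fo (Γ : Ctx) : Set where
  _≐_ : Ex Γ N → Ex Γ N → Fo Γ
  st  : ∀ {σ} → Ex Γ σ → Fo Γ
  ⊥̇   : Fo Γ
  _∧_ : Fo Γ → Fo Γ → Fo Γ
  _∨_ : Fo Γ → Fo Γ → Fo Γ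
  _⇒_ : Fo Γ → Fo Γ → Fo Γ
  all : (σ : Ty) → Fo (σ ∷ Γ) → Fo Γ
  exi : (σ : Ty) → Fo (σ ∷ Γ) → Fo Γ

ESub : Ctx → Ctx → Set
ESub Γ Δ = ∀ {σ} → σ ∈ Γ → Ex Δ σ

esub : ∀ {Γ Δ σ} → ESub Γ Δ → Ex Γ σ → Ex Δ σ
esub r (var x)   = r x
esub r (con c)   = con c
esub r (cst k e) = cst k e
esub r (t · u)   = esub r t · esub r u

ewk : ∀ {Γ σ τ} → Ex Γ τ → Ex (σ ∷ Γ) τ
ewk = esub (λ x → var (there x))

infixl 5 _▹_

_▹_ : ∀ {Γ Δ σ} → ESub Γ Δ → Ex Δ σ → ESub (σ ∷ Γ) Δ
(r ▹ t) (here refl) = t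
(r ▹ t) (there x)   = r x

elift : ∀ {Γ Δ σ} → ESub Γ Δ → ESub (σ ∷ Γ) (σ ∷ Δ)
elift r = (λ x → ewk (r x)) ▹ var (here refl)

osub : ∀ {Γ Δ} → ESub Γ Δ → Fo Γ → Fo Δ
osub r (t ≐ u)   = esub r t ≐ esub r u
osub r (st t)    = st (esub r t)
osub r ⊥̇         = ⊥̇
osub r (A ∧ B)   = osub r A ∧ osub r B
osub r (A ∨ B)   = osub r A ∨ osub r B
osub r (A ⇒ B)   = osub r A ⇒ osub r B
osub r (all σ A) = all σ (osub (elift r) A)
osub r (exi σ A) = exi σ (osub (elift r) A)

owk : ∀ {Γ σ} → Fo Γ → Fo (σ ∷ Γ)
owk = osub (λ x → var (there x))

-- Bracket abstraction, as in ƛ_; the first component is the term itself if it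
-- does not contain the variable.
abstr : ∀ {Γ σ τ} → Ex (σ ∷ Γ) τ → Maybe (Ex Γ τ) × Ex Γ (σ ⟶ τ)
abstr {σ = σ} (var (here refl)) = nothing , con 𝗦 · con 𝗞 · con (𝗞 {σ} {σ})
abstr (var (there x))           = just (var x) , con 𝗞 · var x
abstr (con c)                   = just (con c) , con 𝗞 · con c
abstr (cst k e)                 = just (cst k e) , con 𝗞 · cst k e
abstr (t · u) with abstr t | abstr u
... | just t′ , _ | just u′ , _ = just (t′ · u′) , con 𝗞 · (t′ · u′)
... | _ , t′      | _ , u′      = nothing , con 𝗦 · t′ · u′

_≟ᵀ_ : (σ τ : Ty) → Maybe (σ ≡ τ)
N       ≟ᵀ N         = just refl
(σ ⟶ τ) ≟ᵀ (σ′ ⟶ τ′) with σ ≟ᵀ σ′ | τ ≟ᵀ τ′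
... | just refl | just refl = just refl
... | _         | _         = nothing
(σ ✶)   ≟ᵀ (σ′ ✶)    with σ ≟ᵀ σ′
... | just refl = just refl
... | _         = nothing
_       ≟ᵀ _         = nothing

zeroᴱ : ∀ {Γ} σ → Ex Γ σ
zeroᴱ N       = con zero
zeroᴱ (σ ⟶ τ) = con 𝗞 · zeroᴱ τ
zeroᴱ (σ ✶)   = con tab · (con 𝗞 · zeroᴱ σ) · con zero

-- Γ₁ lists the variables that lev counts; a level out of range or of the wrong
-- type denotes zeroᴱ.
level : ∀ {Γ₀} (Γ₁ : Ctx) → ℕ → ∀ σ → Ex (Γ₁ ++ Γ₀) σ
level []       n σ = zeroᴱ σ
level (τ ∷ Γ₁) n σ with n ≡ᵇ length Γ₁ | τ ≟ᵀ σ
... | true  | just refl = var (here refl)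
... | true  | nothing   = zeroᴱ σ
... | false | _         = ewk (level Γ₁ n σ)

ex : ∀ {Γ₀} (Γ₁ : Ctx) {σ} → HTm σ → Ex (Γ₁ ++ Γ₀) σ
ex Γ₁ {σ} (lev n) = level Γ₁ n σ
ex Γ₁ (con c)     = con c
ex Γ₁ (cst k)     = cst k refl
ex Γ₁ (t · u)     = ex Γ₁ t · ex Γ₁ u
ex Γ₁ (lam′ {σ} f) = proj₂ (abstr (ex (σ ∷ Γ₁) (f (length Γ₁))))

fo : ∀ {Γ₀} (Γ₁ : Ctx) → HFm → Fo (Γ₁ ++ Γ₀)
fo Γ₁ (t ≐ u)   = ex Γ₁ t ≐ ex Γ₁ u
fo Γ₁ (st t)    = st (ex Γ₁ t)
fo Γ₁ ⊥̇         = ⊥̇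
fo Γ₁ (A ∧ B)   = fo Γ₁ A ∧ fo Γ₁ B
fo Γ₁ (A ∨ B)   = fo Γ₁ A ∨ fo Γ₁ B
fo Γ₁ (A ⇒ B)   = fo Γ₁ A ⇒ fo Γ₁ B
fo Γ₁ (all σ A) = all σ (fo (σ ∷ Γ₁) (A (lev (length Γ₁))))
fo Γ₁ (exi σ A) = exi σ (fo (σ ∷ Γ₁) (A (lev (length Γ₁))))

-- Interpretation

Env : Set
Env = (k : ℕ) → Tm [] (ty k)

trᴱ : Env → ∀ {Γ σ} → Ex Γ σ → Tm Γ σ
trᴱ e (var x)      = var x
trᴱ e (con c)      = con c
trᴱ e (cst k refl) = closedᵗ (e k)
trᴱ e (t · u)      = trᴱ e t · trᴱ e u

bodyᴱ : (k : ℕ) → Ex [] (ty k)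
bodyᴱ k = ex [] (body k)

-- The constants from n on denote zero here, so that the recursion through bodies
-- is well-founded.
stage : ℕ → Env
stage ℕ.zero    k = zeroAt (ty k)
stage (ℕ.suc n) k with k ℕ.≟ n
... | yes _ = trᴱ (stage n) (bodyᴱ k)
... | no  _ = stage n k

env : Env
env = stage size

data Below (n : ℕ) : ∀ {Γ σ} → Ex Γ σ → Set where
  var : ∀ {Γ σ} {x : σ ∈ Γ} → Below n (var x)
  con : ∀ {Γ σ} {c : Con σ} → Below n {Γ} (con c)
  cst : ∀ {Γ σ k} {e : ty k ≡ σ} → k ℕ.< n → Below n {Γ} (cst k e)
  _·_ : ∀ {Γ σ τ} {t : Ex Γ (σ ⟶ τ)} {u} → Below n t → Below n u → Below n (t · u)

below? : ∀ n {Γ σ} (t : Ex Γ σ) → Maybe (Below n t)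
below? n (var x) = just var
below? n (con c) = just con
below? n (cst k e) with k ℕ.<? n
... | yes p = just (cst p)
... | no  _ = nothing
below? n (t · u) = below? n t >>= λ p → below? n u >>= λ q → just (p · q)

stage-self : ∀ k → stage (ℕ.suc k) k ≡ trᴱ (stage k) (bodyᴱ k)
stage-self k with k ℕ.≟ k
... | yes _ = refl
... | no ¬p = ⊥-elim (¬p refl)

stage-stable : ∀ {n k} → ℕ.suc k ℕ.≤′ n → stage n k ≡ stage (ℕ.suc k) k
stage-stable ℕ.≤′-refl = refl
stage-stable {ℕ.suc n} {k} (ℕ.≤′-step p) with k ℕ.≟ n
... | yes refl = sym (trans (stage-self k) refl)
... | no  _    = stage-stable p

trᴱ-stage : ∀ {n m Γ σ} {t : Ex Γ σ} → Below n t → n ℕ.≤ m → trᴱ (stage n) t ≡ trᴱ (stage m) t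
trᴱ-stage var le = refl
trᴱ-stage con le = refl
trᴱ-stage (cst {e = refl} p) le = cong closedᵗ
  (trans (stage-stable (ℕ.≤⇒≤′ p)) (sym (stage-stable (ℕ.≤⇒≤′ (ℕ.≤-trans p le)))))
trᴱ-stage (p · q) le = cong₂ _·_ (trᴱ-stage p le) (trᴱ-stage q le)

tr : ∀ {Γ σ} → Ex Γ σ → Tm Γ σ
tr = trᴱ env

-- This equation licenses unfolding: the constant is evaluated at stage k, and by `Below` the later
-- stages no longer change its body.
tr-body : ∀ k → k ℕ.< size → Below k (bodyᴱ k) → tr (bodyᴱ k) ≡ env k
tr-body k k< b = trans (sym (trᴱ-stage b (ℕ.<⇒≤ k<)))
  (trans (sym (stage-self k)) (sym (stage-stable (ℕ.≤⇒≤′ k<))))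

trF : ∀ {Γ} → Fo Γ → Fm Γ
trF (t ≐ u)   = tr t ≐ tr u
trF (st t)    = st (tr t)
trF ⊥̇         = ⊥̇
trF (A ∧ B)   = trF A ∧ trF B
trF (A ∨ B)   = trF A ∨ trF B
trF (A ⇒ B)   = trF A ⇒ trF B
trF (all σ A) = ∀[ σ ] trF A
trF (exi σ A) = ∃[ σ ] trF A

closed-sub : ∀ {Γ Δ σ} (s : Sub Γ Δ) (t : Tm [] σ) → closedᵗ t ⟦ s ⟧ᵗ ≡ closedᵗ t
closed-sub s t = trans (sub-sub (λ ()) s t) (sub-cong (λ ()) t)

tr-sub : ∀ {Γ Δ σ} (r : ESub Γ Δ) (s : Sub Γ Δ) → (∀ {τ} (x : τ ∈ Γ) → tr (r x) ≡ s x) →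
         (t : Ex Γ σ) → tr (esub r t) ≡ tr t ⟦ s ⟧ᵗ
tr-sub r s e (var x)      = e x
tr-sub r s e (con c)      = refl
tr-sub r s e (cst k refl) = sym (closed-sub s (env k))
tr-sub r s e (t · u)      = cong₂ _·_ (tr-sub r s e t) (tr-sub r s e u)

tr-wk : ∀ {Γ σ τ} (t : Ex Γ τ) → tr (ewk {σ = σ} t) ≡ wk (tr t)
tr-wk = tr-sub _ skip₁ (λ _ → refl)

tr-lift : ∀ {Γ Δ τ} (r : ESub Γ Δ) (s : Sub Γ Δ) → (∀ {σ} (x : σ ∈ Γ) → tr (r x) ≡ s x) →
          ∀ {σ} (x : σ ∈ τ ∷ Γ) → tr (elift r x) ≡ lift s x
tr-lift r s e (here refl) = refl
tr-lift r s e (there x)   = trans (tr-wk (r x)) (cong wk (e x))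

trF-sub : ∀ {Γ Δ} (r : ESub Γ Δ) (s : Sub Γ Δ) → (∀ {τ} (x : τ ∈ Γ) → tr (r x) ≡ s x) →
          (A : Fo Γ) → trF (osub r A) ≡ trF A ⟦ s ⟧
trF-sub r s e (t ≐ u)   = cong₂ _≐_ (tr-sub r s e t) (tr-sub r s e u)
trF-sub r s e (st t)    = cong st (tr-sub r s e t)
trF-sub r s e ⊥̇         = refl
trF-sub r s e (A ∧ B)   = cong₂ _∧_ (trF-sub r s e A) (trF-sub r s e B)
trF-sub r s e (A ∨ B)   = cong₂ _∨_ (trF-sub r s e A) (trF-sub r s e B)
trF-sub r s e (A ⇒ B)   = cong₂ _⇒_ (trF-sub r s e A) (trF-sub r s e B)
trF-sub r s e (all σ A) = cong (∀[ σ ]_) (trF-sub (elift r) (lift s) (tr-lift r s e) A)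
trF-sub r s e (exi σ A) = cong (∃[ σ ]_) (trF-sub (elift r) (lift s) (tr-lift r s e) A)

trF-wk : ∀ {Γ σ} (A : Fo Γ) → trF (owk {σ = σ} A) ≡ wkF (trF A)
trF-wk = trF-sub _ skip₁ (λ _ → refl)

trF-wks : ∀ {Γ σ} (Δ : List (Fo Γ)) (Δ′ : List (Fm Γ)) →
          map wkF (map trF Δ ++ Δ′) ≡ map trF (map (owk {σ = σ}) Δ) ++ map wkF Δ′
trF-wks []      Δ′ = refl
trF-wks (A ∷ Δ) Δ′ = cong₂ _∷_ (sym (trF-wk A)) (trF-wks Δ Δ′)

_[_]ᴼ : ∀ {Γ σ} → Fo (σ ∷ Γ) → Ex Γ σ → Fo Γ
A [ t ]ᴼ = osub (var ▹ t) A

trF-inst : ∀ {Γ σ} (A : Fo (σ ∷ Γ)) (t : Ex Γ σ) → trF (A [ t ]ᴼ) ≡ trF A [ tr t ]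
trF-inst A t = trF-sub (var ▹ t) (var ▸ tr t) (λ { (here refl) → refl ; (there x) → refl }) A

infix 6 _≈ᴱ_ _<ᴱ_

_<ᴱ_ : ∀ {Γ} → Ex Γ N → Ex Γ N → Fo Γ
t <ᴱ u = cst 2 refl · (con suc · t) · u ≐ con zero

_≈ᴱ_ : ∀ {Γ σ} → Ex Γ σ → Ex Γ σ → Fo Γ
_≈ᴱ_ {σ = N}     t u = t ≐ u
_≈ᴱ_ {σ = σ ⟶ τ} t u = all σ (ewk t · var (here refl) ≈ᴱ ewk u · var (here refl))
_≈ᴱ_ {σ = σ ✶}   t u = con len · t ≐ con len · u ∧ all N (var (here refl) <ᴱ con len · ewk t ⇒
  con ent · ewk t · var (here refl) ≈ᴱ con ent · ewk u · var (here refl))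

trF-≈ : ∀ {Γ} σ (t u : Ex Γ σ) → trF (t ≈ᴱ u) ≡ (tr t ≈ tr u)
trF-≈ N       t u = refl
trF-≈ (σ ⟶ τ) t u = cong (∀[ σ ]_) (trans (trF-≈ τ _ _)
  (cong₂ (λ a b → a · v₀ ≈ b · v₀) (tr-wk t) (tr-wk u)))
trF-≈ (σ ✶)   t u = cong (λ A → con len · tr t ≐ con len · tr u ∧ (∀[ N ] A))
  (cong₂ _⇒_ (cong (λ a → v₀ <̇ con len · a) (tr-wk t))
    (trans (trF-≈ σ _ _) (cong₂ (λ a b → con ent · a · v₀ ≈ con ent · b · v₀) (tr-wk t) (tr-wk u))))

-- Normalisation of terms by the equations for 𝗞, 𝗦, R₀ and the constants k
-- with δ k; the number bounds the depth of the recursion.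

data View {Γ} : ∀ {σ τ} → Ex Γ (σ ⟶ τ) → Set where
  is𝗞   : ∀ {σ τ} (t : Ex Γ σ) → View (con (𝗞 {σ} {τ}) · t)
  is𝗦   : ∀ {ρ σ τ} (t : Ex Γ (ρ ⟶ σ ⟶ τ)) u → View (con 𝗦 · t · u)
  isR₀  : ∀ n t → View (con R₀ · n · t)
  other : ∀ {σ τ} {t : Ex Γ (σ ⟶ τ)} → View t

view : ∀ {Γ σ τ} (t : Ex Γ (σ ⟶ τ)) → View t
view (con 𝗞 · t)     = is𝗞 t
view (con 𝗦 · t · u) = is𝗦 t u
view (con R₀ · t · u) = isR₀ t u
view _               = other

data NView {Γ} : Ex Γ N → Set where
  is0   : NView (con zero)
  isS   : ∀ t → NView (con suc · t)
  other : ∀ {t} → NView t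

nview : ∀ {Γ} (t : Ex Γ N) → NView t
nview (con zero)    = is0
nview (con suc · t) = isS t
nview _             = other

mutual
  app : ∀ {Γ σ τ} → ℕ → Ex Γ (σ ⟶ τ) → Ex Γ σ → Ex Γ τ
  app ℕ.zero    f a = f · a
  app (ℕ.suc n) f a = appV n (view f) a

  appV : ∀ {Γ σ τ} → ℕ → {f : Ex Γ (σ ⟶ τ)} → View f → Ex Γ σ → Ex Γ τ
  appV n (is𝗞 t)       a = t
  appV n (is𝗦 t u)     a = app n (app n t a) (app n u a)
  appV n (isR₀ m t)    a = recV n (nview m) t a
  appV n (other {t = t}) a = t · a

  recV : ∀ {Γ} → ℕ → {m : Ex Γ N} → NView m → Ex Γ N → Ex Γ (N ⟶ N ⟶ N) → Ex Γ N
  recV ℕ.zero    {m} _       t a = con R₀ · m · t · a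
  recV (ℕ.suc n) is0         t a = t
  recV (ℕ.suc n) (isS m)     t a = app n (app n a (recV n (nview m) t a)) m
  recV (ℕ.suc n) (other {m}) t a = con R₀ · m · t · a

unfoldable : (k : ℕ) → Maybe (k ℕ.< size × Below k (bodyᴱ k))
unfoldable k with k ℕ.<? size
... | yes p = below? k (bodyᴱ k) >>= λ q → just (p , q)
... | no  _ = nothing

nf : ∀ {Γ σ} → (ℕ → Bool) → ℕ → Ex Γ σ → Ex Γ σ
nf δ n (var x) = var x
nf δ n (con c) = con c
nf δ ℕ.zero (cst k e) = cst k e
nf δ (ℕ.suc n) (cst k e) with δ k | unfoldable k
nf δ (ℕ.suc n) (cst k refl) | true | just _ = nf δ n (esub (λ ()) (bodyᴱ k))
... | _    | _       = cst k e
nf δ n (t · u) = app n (nf δ n t) (nf δ n u)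

nfF : ∀ {Γ} → (ℕ → Bool) → ℕ → Fo Γ → Fo Γ
nfF δ n (t ≐ u)   = nf δ n t ≐ nf δ n u
nfF δ n (st t)    = st (nf δ n t)
nfF δ n ⊥̇         = ⊥̇
nfF δ n (A ∧ B)   = nfF δ n A ∧ nfF δ n B
nfF δ n (A ∨ B)   = nfF δ n A ∨ nfF δ n B
nfF δ n (A ⇒ B)   = nfF δ n A ⇒ nfF δ n B
nfF δ n (all σ A) = all σ (nfF δ n A)
nfF δ n (exi σ A) = exi σ (nfF δ n A)

mutual
  -- Every reduction is an instance of an axiom under congruence, so exhausted fuel costs
  -- completeness but not soundness.
  app-≈ : ∀ {Γ Δ σ τ} n (f : Ex Γ (σ ⟶ τ)) a → D Γ Δ (tr (f · a) ≈ tr (app n f a))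
  app-≈ ℕ.zero    f a = ≈-refl _ _
  app-≈ (ℕ.suc n) f a = appV-≈ n (view f) a

  appV-≈ : ∀ {Γ Δ σ τ} n {f : Ex Γ (σ ⟶ τ)} (v : View f) a → D Γ Δ (tr (f · a) ≈ tr (appV n v a))
  appV-≈ n (is𝗞 t)    a = ω (𝗞-eq (tr t) (tr a))
  appV-≈ n (is𝗦 t u)  a = ≈t (ω (𝗦-eq (tr t) (tr u) (tr a)))
    (≈t (≈-app (app-≈ n t a) (app-≈ n u a)) (app-≈ n (app n t a) (app n u a)))
  appV-≈ n (isR₀ m t) a = recV-≈ n (nview m) t a
  appV-≈ n other      a = ≈-refl _ _

  recV-≈ : ∀ {Γ Δ} n {m : Ex Γ N} (v : NView m) t a →
           D Γ Δ (con R₀ · tr m · tr t · tr a ≐ tr (recV n v t a))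
  recV-≈ ℕ.zero    _       t a = ≐r _
  recV-≈ (ℕ.suc n) is0     t a = ω (R₀-zero (tr t) (tr a))
  recV-≈ (ℕ.suc n) (isS m) t a = ≐t (ω (R₀-suc (tr m) (tr t) (tr a)))
    (≐t (≈-app {F = tr a · (con R₀ · tr m · tr t · tr a)} {tr (app n a r)} {tr m}
          (≈t {t = tr a · (con R₀ · tr m · tr t · tr a)} {tr a · tr r} {tr (app n a r)}
            (⇒E (ω (ext _ _ (tr a))) (recV-≈ n (nview m) t a)) (app-≈ n a r))
          (≐r (tr m)))
        (app-≈ n (app n a r) m))
    where r = recV n (nview m) t a
  recV-≈ (ℕ.suc n) other   t a = ≐r _

nf-≈ : ∀ {Γ Δ σ} δ n (t : Ex Γ σ) → D Γ Δ (tr t ≈ tr (nf δ n t))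
nf-≈ δ n (var x) = ≈-refl _ _
nf-≈ δ n (con c) = ≈-refl _ _
nf-≈ δ ℕ.zero (cst k e) = ≈-refl _ _
nf-≈ δ (ℕ.suc n) (cst k e) with δ k | unfoldable k
nf-≈ δ (ℕ.suc n) (cst k refl) | true | just (k< , b) =
  ≈t (≡⇒≈ (sym (trans (tr-sub (λ ()) (λ ()) (λ ()) (bodyᴱ k)) (cong closedᵗ (tr-body k k< b)))))
     (nf-≈ δ n (esub (λ ()) (bodyᴱ k)))
nf-≈ δ (ℕ.suc n) (cst k refl) | true  | nothing = ≈-refl _ _
nf-≈ δ (ℕ.suc n) (cst k refl) | false | _       = ≈-refl _ _
nf-≈ δ n (t · u) = ≈t (≈-app (nf-≈ δ n t) (nf-≈ δ n u)) (app-≈ n (nf δ n t) (nf δ n u))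

nfF-⇔ : ∀ {Γ Δ} δ n (A : Fo Γ) → D Γ Δ (trF A ⇔ trF (nfF δ n A))
nfF-⇔ δ n (t ≐ u)   = ⇔-≐ (nf-≈ δ n t) (nf-≈ δ n u)
nfF-⇔ δ n (st t)    = ⇒E ⇔-st (nf-≈ δ n t)
nfF-⇔ δ n ⊥̇         = ∧I (⇒I h₀) (⇒I h₀)
nfF-⇔ δ n (A ∧ B)   = ⇒E₂ ⇔-∧ (nfF-⇔ δ n A) (nfF-⇔ δ n B)
nfF-⇔ δ n (A ∨ B)   = ⇒E₂ ⇔-∨ (nfF-⇔ δ n A) (nfF-⇔ δ n B)
nfF-⇔ δ n (A ⇒ B)   = ⇒E₂ ⇔-⇒ (nfF-⇔ δ n A) (nfF-⇔ δ n B)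
nfF-⇔ δ n (all σ A) = ⇒E ⇔-∀ (∀I (nfF-⇔ δ n A))
nfF-⇔ δ n (exi σ A) = ⇒E ⇔-∃ (∀I (nfF-⇔ δ n A))

-- Syntactic equality and recognition of internal and quantifier-free formulas

infix 4 _≟ⱽ_ _≟ᶜ_ _≟ᴱ_ _≟ᶠ_
data _≅_ {Γ} : ∀ {σ τ} → Ex Γ σ → Ex Γ τ → Set where
  refl : ∀ {σ} {t : Ex Γ σ} → t ≅ t

data _≅ⱽ_ {Γ : Ctx} : ∀ {σ τ} → σ ∈ Γ → τ ∈ Γ → Set where
  refl : ∀ {σ} {x : σ ∈ Γ} → x ≅ⱽ x

data _≅ᶜ_ : ∀ {σ τ} → Con σ → Con τ → Set where
  refl : ∀ {σ} {c : Con σ} → c ≅ᶜ c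

_≟ⱽ_ : ∀ {Γ : Ctx} {σ τ} (x : σ ∈ Γ) (y : τ ∈ Γ) → Maybe (x ≅ⱽ y)
here refl ≟ⱽ here refl = just refl
there x   ≟ⱽ there y with x ≟ⱽ y
... | just refl = just refl
... | nothing   = nothing
_ ≟ⱽ _ = nothing

_≟ᶜ_ : ∀ {σ τ} (c : Con σ) (d : Con τ) → Maybe (c ≅ᶜ d)
𝗞 {σ} {τ} ≟ᶜ 𝗞 {σ′} {τ′} with σ ≟ᵀ σ′ | τ ≟ᵀ τ′
... | just refl | just refl = just refl
... | _         | _         = nothing
𝗦 {ρ} {σ} {τ} ≟ᶜ 𝗦 {ρ′} {σ′} {τ′} with ρ ≟ᵀ ρ′ | σ ≟ᵀ σ′ | τ ≟ᵀ τ′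
... | just refl | just refl | just refl = just refl
... | _         | _         | _         = nothing
zero ≟ᶜ zero = just refl
suc  ≟ᶜ suc  = just refl
R₀   ≟ᶜ R₀   = just refl
len {σ} ≟ᶜ len {σ′} with σ ≟ᵀ σ′
... | just refl = just refl
... | nothing   = nothing
ent {σ} ≟ᶜ ent {σ′} with σ ≟ᵀ σ′
... | just refl = just refl
... | nothing   = nothing
tab {σ} ≟ᶜ tab {σ′} with σ ≟ᵀ σ′
... | just refl = just refl
... | nothing   = nothing
Ξ₀   ≟ᶜ Ξ₀   = just refl
_    ≟ᶜ _    = nothing

_≟ᴱ_ : ∀ {Γ σ τ} (t : Ex Γ σ) (u : Ex Γ τ) → Maybe (t ≅ u)
var x ≟ᴱ var y with x ≟ⱽ y
... | just refl = just refl
... | nothing   = nothing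
con c ≟ᴱ con d with c ≟ᶜ d
... | just refl = just refl
... | nothing   = nothing
cst j refl ≟ᴱ cst k refl with j ℕ.≟ k
... | yes refl = just refl
... | no  _    = nothing
(t · u) ≟ᴱ (t′ · u′) with t ≟ᴱ t′
... | nothing = nothing
... | just refl with u ≟ᴱ u′
...   | just refl = just refl
...   | nothing   = nothing
_ ≟ᴱ _ = nothing

_≟ᶠ_ : ∀ {Γ} (A B : Fo Γ) → Maybe (A ≡ B)
(t ≐ u) ≟ᶠ (t′ ≐ u′) with t ≟ᴱ t′
... | nothing = nothing
... | just refl with u ≟ᴱ u′
...   | just refl = just refl
...   | nothing   = nothing
st t ≟ᶠ st u with t ≟ᴱ u
... | just refl = just refl
... | nothing   = nothing
⊥̇ ≟ᶠ ⊥̇ = just refl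
(A ∧ B) ≟ᶠ (A′ ∧ B′) with A ≟ᶠ A′
... | nothing = nothing
... | just refl with B ≟ᶠ B′
...   | just refl = just refl
...   | nothing   = nothing
(A ∨ B) ≟ᶠ (A′ ∨ B′) with A ≟ᶠ A′
... | nothing = nothing
... | just refl with B ≟ᶠ B′
...   | just refl = just refl
...   | nothing   = nothing
(A ⇒ B) ≟ᶠ (A′ ⇒ B′) with A ≟ᶠ A′
... | nothing = nothing
... | just refl with B ≟ᶠ B′
...   | just refl = just refl
...   | nothing   = nothing
all σ A ≟ᶠ all τ B with σ ≟ᵀ τ
... | nothing = nothing
... | just refl with A ≟ᶠ B
...   | just refl = just refl
...   | nothing   = nothing
exi σ A ≟ᶠ exi τ B with σ ≟ᵀ τ
... | nothing = nothing
... | just refl with A ≟ᶠ B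
...   | just refl = just refl
...   | nothing   = nothing
_ ≟ᶠ _ = nothing

internal? : ∀ {Γ} (A : Fo Γ) → Maybe (Internal (trF A))
internal? (t ≐ u)   = just _
internal? (st t)    = nothing
internal? ⊥̇         = just _
internal? (A ∧ B)   = internal? A >>= λ p → internal? B >>= λ q → just (p , q)
internal? (A ∨ B)   = internal? A >>= λ p → internal? B >>= λ q → just (p , q)
internal? (A ⇒ B)   = internal? A >>= λ p → internal? B >>= λ q → just (p , q)
internal? (all σ A) = internal? A
internal? (exi σ A) = internal? A

quantifierFree? : ∀ {Γ} (A : Fo Γ) → Maybe (QuantifierFree (trF A))
quantifierFree? (t ≐ u)   = just _
quantifierFree? (st t)    = nothing
quantifierFree? ⊥̇         = just _
quantifierFree? (A ∧ B)   = quantifierFree? A >>= λ p → quantifierFree? B >>= λ q → just (p , q)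
quantifierFree? (A ∨ B)   = quantifierFree? A >>= λ p → quantifierFree? B >>= λ q → just (p , q)
quantifierFree? (A ⇒ B)   = quantifierFree? A >>= λ p → quantifierFree? B >>= λ q → just (p , q)
quantifierFree? (all σ A) = nothing
quantifierFree? (exi σ A) = nothing

-- Proofs

infix 6 ~_
infixr 2 _↔_
infix 6 _≋_ _<_

~_ : HFm → HFm
~ A = A ⇒ ⊥̇

_↔_ : HFm → HFm → HFm
A ↔ B = (A ⇒ B) ∧ (B ⇒ A)

allˢᵗ exiˢᵗ : ∀ σ → (HTm σ → HFm) → HFm
allˢᵗ σ A = all σ λ x → st x ⇒ A x
exiˢᵗ σ A = exi σ λ x → st x ∧ A x

_<_ : HTm N → HTm N → HFm
t < u = (1+ t) ∸ u ≐ O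

_≋_ : ∀ {σ} → HTm σ → HTm σ → HFm
_≋_ {N}     t u = t ≐ u
_≋_ {σ ⟶ τ} t u = all σ λ x → t · x ≋ u · x
_≋_ {σ ✶}   t u = con len · t ≐ con len · u ∧
  all N λ i → i < con len · t ⇒ con ent · t · i ≋ con ent · u · i

suslinᴴ uniqueˢᵗ : HTm type2 → HFm
suslinᴴ S = allˢᵗ type1 λ f →
  S · f ≐ O ↔ (exiˢᵗ type1 λ g → allˢᵗ N λ x → ~ (f · (g ↾ x) ≐ O))
uniqueˢᵗ S = suslinᴴ S ∧ allˢᵗ type1 λ f → S · f ≐ O ∨ S · f ≐ 1+ O

data Pf : HFm → Set where
  hyp   : ∀ {A} → ℕ → Pf A
  raa′  : ∀ {A} → (ℕ → Pf ⊥̇) → Pf A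
  ∧I    : ∀ {A B} → Pf A → Pf B → Pf (A ∧ B)
  ∧E₁   : ∀ {A B} → Pf (A ∧ B) → Pf A
  ∧E₂   : ∀ {A B} → Pf (A ∧ B) → Pf B
  ∨I₁   : ∀ {A B} → Pf A → Pf (A ∨ B)
  ∨I₂   : ∀ {A B} → Pf B → Pf (A ∨ B)
  ∨E′   : ∀ {A B C} → Pf (A ∨ B) → (ℕ → Pf C) → (ℕ → Pf C) → Pf C
  ⇒I′   : ∀ {A B} → (ℕ → Pf B) → Pf (A ⇒ B)
  ⇒E    : ∀ {A B} → Pf (A ⇒ B) → Pf A → Pf B
  ∀I    : ∀ {σ A} → ((x : HTm σ) → Pf (A x)) → Pf (all σ A)
  ∀E    : ∀ {σ A} → Pf (all σ A) → (t : HTm σ) → Pf (A t)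
  ∃I′   : ∀ {σ} A (t : HTm σ) → Pf (A t) → Pf (exi σ A)
  ∃E′   : ∀ {σ A C} → Pf (exi σ A) → (HTm σ → ℕ → Pf C) → Pf C
  rfl   : ∀ {t} → Pf (t ≐ t)
  symᵖ  : ∀ {t u} → Pf (t ≐ u) → Pf (u ≐ t)
  trᵖ   : ∀ {t u w} → Pf (t ≐ u) → Pf (u ≐ w) → Pf (t ≐ w)
  conv  : ∀ {A B} → (ℕ → Bool) → Pf A → Pf B
  leib  : ∀ {σ} (A : HTm σ → HFm) {t u : HTm σ} → Pf (t ≋ u) → Pf (A t) → Pf (A u)
  1+≢0  : ∀ {t} → Pf (1+ t ≐ O) → Pf ⊥̇
  ind   : ∀ A → Pf (A O) → Pf (all N λ n → A n ⇒ A (1+ n)) → Pf (all N A)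
  qfac  : ∀ (A : HTm type1 → HTm N → HFm) → Pf (all type1 λ x → exi N λ y → A x y) →
          Pf (exi type2 λ F → all type1 λ x → A x (F · x))
  stᵖ   : ∀ {σ} (t : HTm σ) → Pf (st t)
  st<   : ∀ {m n} → Pf (st n) → Pf (m < n) → Pf (st m)
  hac   : ∀ {ρ τ} (A : HTm ρ → HTm τ → HFm) →
          Pf (allˢᵗ ρ λ x → exiˢᵗ τ λ y → A x y) →
          Pf (exiˢᵗ (ρ ⟶ τ ✶) λ Φ → allˢᵗ ρ λ x → exi τ λ y →
            (exi N λ i → i < con len · (Φ · x) ∧ y ≋ con ent · (Φ · x) · i) ∧ A x y)
  pftp  : ∀ {τ} (A : HTm τ → HFm) → Pf (allˢᵗ τ A) → Pf (all τ A)
  ξ-ax  : Pf (st (con Ξ₀) ∧ allˢᵗ type2 λ S →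
            uniqueˢᵗ S ⇒ allˢᵗ type1 λ f → con Ξ₀ · f ≐ S · f)
  thm   : ∀ {A} → (∀ {Γ Δ} → D Γ Δ (trF (fo {Γ} [] A))) → Pf A

find : ∀ {Γ} (Δ : List (Fo Γ)) → ℕ → Maybe (Σ (Fo Γ) λ A → A ∈ Δ)
find []      n = nothing
find (A ∷ Δ) n with n ≡ᵇ length Δ
... | true  = just (A , here refl)
... | false = find Δ n >>= λ (B , x) → just (B , there x)

findSt : ∀ {Γ σ} (Δ : List (Fo Γ)) (t : Ex Γ σ) → Maybe (st t ∈ Δ)
findSt []         t = nothing
findSt (st u ∷ Δ) t with u ≟ᴱ t
... | just refl = just (here refl)
... | nothing   = findSt Δ t >>= λ x → just (there x)
findSt (_ ∷ Δ)    t = findSt Δ t >>= λ x → just (there x)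

hyp-tr : ∀ {Γ A} (Δ : List (Fo Γ)) {Δ′} → A ∈ Δ → D Γ (map trF Δ ++ Δ′) (trF A)
hyp-tr Δ x = hyp (go Δ x)
  where
  go : ∀ {Γ A} (Δ : List (Fo Γ)) {Δ′} → A ∈ Δ → trF A ∈ map trF Δ ++ Δ′
  go (_ ∷ Δ) (here refl) = here refl
  go (_ ∷ Δ) (there x)   = there (go Δ x)

-- Only variables need a hypothesis: constants, `Ξ₀` included, are closed, and application preserves
-- standardness.
standard : ∀ {Γ σ} (Δ : List (Fo Γ)) {Δ′} (t : Ex Γ σ) →
           Maybe (D Γ (map trF Δ ++ Δ′) (st (tr t)))
standard Δ (var x)      = findSt Δ (var x) >>= λ y → just (hyp-tr Δ y)
standard Δ (con c)      = just (axiom (rca₀Ω (st-closed (con c))))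
standard Δ (cst k refl) = just (axiom (rca₀Ω (st-closed (env k))))
standard Δ (t · u)      = standard Δ t >>= λ p → standard Δ u >>= λ q →
  just (⇒E (⇒E (axiom (rca₀Ω (st-app (tr t) (tr u)))) p) q)

fuel : ℕ
fuel = 10000

Judgement : ∀ {Γ₀} (Γ₁ : Ctx) → List (Fo (Γ₁ ++ Γ₀)) → List (Fm (Γ₁ ++ Γ₀)) → HFm → Set
Judgement {Γ₀} Γ₁ Δ Δ′ A = D (Γ₁ ++ Γ₀) (map trF Δ ++ Δ′) (trF (fo Γ₁ A))

-- The type of a `Pf` does not ensure scoping, and its predicates are arbitrary Agda functions.
-- Scoping and commutation with substitution are therefore tested syntactically on the translated
-- formulas.
check : ∀ {Γ₀} Γ₁ (Δ : List (Fo (Γ₁ ++ Γ₀))) (Δ′ : List (Fm (Γ₁ ++ Γ₀))) {A} →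
        Pf A → Maybe (Judgement Γ₁ Δ Δ′ A)
check Γ₁ Δ Δ′ {A} (hyp n) = find Δ n >>= λ (B , x) → B ≟ᶠ fo Γ₁ A >>= λ e →
  just (subst (λ C → D _ _ (trF C)) e (hyp-tr Δ x))
check Γ₁ Δ Δ′ {A} (raa′ p) = check Γ₁ ((fo Γ₁ A ⇒ ⊥̇) ∷ Δ) Δ′ (p (length Δ)) >>= λ d → just (raa d)
check Γ₁ Δ Δ′ (∧I p q) = check Γ₁ Δ Δ′ p >>= λ d → check Γ₁ Δ Δ′ q >>= λ e → just (∧I d e)
check Γ₁ Δ Δ′ (∧E₁ p) = check Γ₁ Δ Δ′ p >>= λ d → just (∧E₁ d)
check Γ₁ Δ Δ′ (∧E₂ p) = check Γ₁ Δ Δ′ p >>= λ d → just (∧E₂ d)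
check Γ₁ Δ Δ′ (∨I₁ p) = check Γ₁ Δ Δ′ p >>= λ d → just (∨I₁ d)
check Γ₁ Δ Δ′ (∨I₂ p) = check Γ₁ Δ Δ′ p >>= λ d → just (∨I₂ d)
check Γ₁ Δ Δ′ (∨E′ {A} {B} p q r) = check Γ₁ Δ Δ′ p >>= λ d →
  check Γ₁ (fo Γ₁ A ∷ Δ) Δ′ (q (length Δ)) >>= λ e →
  check Γ₁ (fo Γ₁ B ∷ Δ) Δ′ (r (length Δ)) >>= λ f → just (∨E d e f)
check Γ₁ Δ Δ′ (⇒I′ {A} p) = check Γ₁ (fo Γ₁ A ∷ Δ) Δ′ (p (length Δ)) >>= λ d → just (⇒I d)
check Γ₁ Δ Δ′ (⇒E p q) = check Γ₁ Δ Δ′ p >>= λ d → check Γ₁ Δ Δ′ q >>= λ e → just (⇒E d e)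
check Γ₁ Δ Δ′ (∀I {σ} p) = check (σ ∷ Γ₁) (map owk Δ) (map wkF Δ′) (p (lev (length Γ₁))) >>= λ d →
  just (∀I (subst (λ Δ″ → D _ Δ″ _) (sym (trF-wks Δ Δ′)) d))
check Γ₁ Δ Δ′ (∀E {σ} {A} p t) = check Γ₁ Δ Δ′ p >>= λ d →
  fo (σ ∷ Γ₁) (A (lev (length Γ₁))) [ ex Γ₁ t ]ᴼ ≟ᶠ fo Γ₁ (A t) >>= λ e →
  just (∀E≡ d (tr (ex Γ₁ t)) (trans (sym (trF-inst _ (ex Γ₁ t))) (cong trF e)))
check Γ₁ Δ Δ′ (∃I′ {σ} A t p) = check Γ₁ Δ Δ′ p >>= λ d →
  fo (σ ∷ Γ₁) (A (lev (length Γ₁))) [ ex Γ₁ t ]ᴼ ≟ᶠ fo Γ₁ (A t) >>= λ e →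
  just (∃I≡ _ (tr (ex Γ₁ t)) (trans (sym (trF-inst _ (ex Γ₁ t))) (cong trF e)) d)
check Γ₁ Δ Δ′ (∃E′ {σ} {A} {C} p q) = check Γ₁ Δ Δ′ p >>= λ d →
  check (σ ∷ Γ₁) (fo (σ ∷ Γ₁) (A (lev (length Γ₁))) ∷ map owk Δ) (map wkF Δ′)
        (q (lev (length Γ₁)) (length Δ)) >>= λ e →
  -- Levels count from the outside, so this tests that C does not mention the witness.
  owk (fo Γ₁ C) ≟ᶠ fo (σ ∷ Γ₁) C >>= λ eq →
  just (∃E d (subst₂ (D _) (cong (_ ∷_) (sym (trF-wks Δ Δ′)))
    (trans (sym (cong trF eq)) (trF-wk (fo Γ₁ C))) e))
check Γ₁ Δ Δ′ (rfl {t}) = just (≐r _)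
check Γ₁ Δ Δ′ (symᵖ p) = check Γ₁ Δ Δ′ p >>= λ d → just (≐s d)
check Γ₁ Δ Δ′ (trᵖ p q) = check Γ₁ Δ Δ′ p >>= λ d → check Γ₁ Δ Δ′ q >>= λ e → just (≐t d e)
check Γ₁ Δ Δ′ (conv {A} {B} δ p) = check Γ₁ Δ Δ′ p >>= λ d →
  nfF δ fuel (fo Γ₁ A) ≟ᶠ nfF δ fuel (fo Γ₁ B) >>= λ e →
  just (⇒E (∧E₂ (nfF-⇔ δ fuel (fo Γ₁ B)))
    (subst (λ C → D _ _ (trF C)) e (⇒E (∧E₁ (nfF-⇔ δ fuel (fo Γ₁ A))) d)))
check Γ₁ Δ Δ′ (leib {σ} A {t} {u} p q) = check Γ₁ Δ Δ′ p >>= λ d → check Γ₁ Δ Δ′ q >>= λ d′ →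
  fo Γ₁ (t ≋ u) ≟ᶠ (ex Γ₁ t ≈ᴱ ex Γ₁ u) >>= λ e →
  fo (σ ∷ Γ₁) (A (lev (length Γ₁))) [ ex Γ₁ t ]ᴼ ≟ᶠ fo Γ₁ (A t) >>= λ e₁ →
  fo (σ ∷ Γ₁) (A (lev (length Γ₁))) [ ex Γ₁ u ]ᴼ ≟ᶠ fo Γ₁ (A u) >>= λ e₂ →
  just (subst (D _ _) (trans (sym (trF-inst _ (ex Γ₁ u))) (cong trF e₂))
    (⇒E (⇒E (leibniz (trF (fo (σ ∷ Γ₁) (A (lev (length Γ₁))))) (tr (ex Γ₁ t)) (tr (ex Γ₁ u)))
            (subst (D _ _) (trans (cong trF e) (trF-≈ σ _ _)) d))
        (subst (D _ _) (trans (cong trF (sym e₁)) (trF-inst _ (ex Γ₁ t))) d′)))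
check Γ₁ Δ Δ′ (1+≢0 p) = check Γ₁ Δ Δ′ p >>= λ d → just (⇒E (ω (suc≠0 _)) d)
check {Γ₀} Γ₁ Δ Δ′ (ind A p q) = check Γ₁ Δ Δ′ p >>= λ d → check Γ₁ Δ Δ′ q >>= λ d′ →
  quantifierFree? B >>= λ qf →
  B [ con zero ]ᴼ ≟ᶠ fo Γ₁ (A O) >>= λ e₀ →
  osub succ B ≟ᶠ fo (N ∷ Γ₁) (A (1+ (lev (length Γ₁)))) >>= λ e₁ →
  just (⇒E (ω (QF-IND (trF B) qf)) (∧I
    (subst (D _ _) (trans (cong trF (sym e₀)) (trF-inst B (con zero))) d)
    (subst (λ C → D _ _ (∀[ N ] trF B ⇒ C))
      (trans (cong trF (sym e₁)) (trF-sub succ (skip₁ ▸ con suc · v₀)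
        (λ { (here refl) → refl ; (there x) → refl }) B)) d′)))
  where
  B : Fo (N ∷ Γ₁ ++ Γ₀)
  B = fo (N ∷ Γ₁) (A (lev (length Γ₁)))
  succ : ESub (N ∷ Γ₁ ++ Γ₀) (N ∷ Γ₁ ++ Γ₀)
  succ = (λ x → var (there x)) ▹ con suc · var (here refl)
check {Γ₀} Γ₁ Δ Δ′ (qfac A p) = check Γ₁ Δ Δ′ p >>= λ d →
  quantifierFree? B >>= λ qf →
  osub r B ≟ᶠ fo (type1 ∷ type2 ∷ Γ₁) (A (lev (ℕ.suc (length Γ₁)))
    (lev (length Γ₁) · lev (ℕ.suc (length Γ₁)))) >>= λ e →
  just (subst (λ C → D _ _ (∃[ type2 ] ∀[ type1 ] C))
    (trans (sym (trF-sub r (skip₂ ▸ v₀ ▸ v₁ · v₀)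
      (λ { (here refl) → refl ; (there (here refl)) → refl ; (there (there x)) → refl }) B)) (cong trF e))
    (⇒E (ω (QF-AC¹⁰ (trF B) qf)) d))
  where
  B : Fo (N ∷ type1 ∷ Γ₁ ++ Γ₀)
  B = fo (N ∷ type1 ∷ Γ₁) (A (lev (length Γ₁)) (lev (ℕ.suc (length Γ₁))))
  r : ESub (N ∷ type1 ∷ Γ₁ ++ Γ₀) (type1 ∷ type2 ∷ Γ₁ ++ Γ₀)
  r = (λ x → var (there (there x))) ▹ var (here refl) ▹ var (there (here refl)) · var (here refl)
check Γ₁ Δ Δ′ (stᵖ t) = standard Δ (ex Γ₁ t)
check Γ₁ Δ Δ′ (st< p q) = check Γ₁ Δ Δ′ p >>= λ d → check Γ₁ Δ Δ′ q >>= λ e →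
  just (⇒E (⇒E (axiom (rca₀Ω (st-< _ _))) d) e)
check {Γ₀} Γ₁ Δ Δ′ (hac {ρ} {τ} A p) = check Γ₁ Δ Δ′ p >>= λ d →
  internal? B >>= λ i →
  fo Γ₁ (exiˢᵗ (ρ ⟶ τ ✶) λ Φ → allˢᵗ ρ λ x → exi τ λ y →
            (exi N λ i → i < con len · (Φ · x) ∧ y ≋ con ent · (Φ · x) · i) ∧ A x y) ≟ᶠ G >>= λ e →
  fo Γ₁ (allˢᵗ ρ λ x → exiˢᵗ τ λ y → A x y) ≟ᶠ
    all ρ (st (var (here refl)) ⇒ exi τ (st (var (here refl)) ∧ B)) >>= λ e′ →
  just (subst (D _ _) (trans (sym G-tr) (cong trF (sym e)))
    (⇒E (axiom (rca₀Ω (HAC-int (trF B) i))) (subst (D _ _) (cong trF e′) d)))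
  where
  B : Fo (τ ∷ ρ ∷ Γ₁ ++ Γ₀)
  B = fo (τ ∷ ρ ∷ Γ₁) (A (lev (length Γ₁)) (lev (ℕ.suc (length Γ₁))))
  r : ESub (τ ∷ ρ ∷ Γ₁ ++ Γ₀) (τ ∷ ρ ∷ (ρ ⟶ τ ✶) ∷ Γ₁ ++ Γ₀)
  r = (λ x → var (there (there (there x)))) ▹ var (there (here refl)) ▹ var (here refl)
  G : Fo (Γ₁ ++ Γ₀)
  G = exi (ρ ⟶ τ ✶) (st (var (here refl)) ∧ all ρ (st (var (here refl)) ⇒ exi τ
    ((exi N (var (here refl) <ᴱ con len · (var (there (there (there (here refl)))) · var (there (there (here refl))))
            ∧ var (there (here refl)) ≈ᴱ con ent · (var (there (there (there (here refl)))) · var (there (there (here refl)))) · var (here refl)))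
     ∧ osub r B)))
  G-tr : trF G ≡ (∃ˢᵗ[ ρ ⟶ τ ✶ ] ∀ˢᵗ[ ρ ] ∃[ τ ] v₀ ∈̇ v₂ · v₁ ∧ trF B ⟦ skip₃ ▸ v₁ ▸ v₀ ⟧)
  G-tr = cong₂ (λ X Y → ∃ˢᵗ[ ρ ⟶ τ ✶ ] ∀ˢᵗ[ ρ ] ∃[ τ ]
      (∃[ N ] v₀ <̇ con len · (v₃ · v₂) ∧ X) ∧ Y)
    (trF-≈ τ _ _)
    (trF-sub r (skip₃ ▸ v₁ ▸ v₀)
      (λ { (here refl) → refl ; (there (here refl)) → refl ; (there (there x)) → refl }) B)
check {Γ₀} Γ₁ Δ Δ′ (pftp {τ} A p) = check Γ₁ Δ Δ′ p >>= λ d →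
  internal? B >>= λ i →
  -- B is A read in the context of its own variable alone; agreement with A in the full context
  -- excludes parameters.
  osub (elift (λ ())) B ≟ᶠ fo (τ ∷ Γ₁) (A (lev (length Γ₁))) >>= λ e →
  fo Γ₁ (allˢᵗ τ A) ≟ᶠ all τ (st (var (here refl)) ⇒ osub (elift (λ ())) B) >>= λ e′ →
  just (subst (λ C → D _ _ (∀[ τ ] C)) (trans (sym B-tr) (cong trF e))
    (⇒E (axiom (rca₀Ω (PF-TP∀ (trF B) i)))
      (subst (D _ _) (trans (cong trF e′) (cong (λ C → ∀ˢᵗ[ τ ] C) B-tr)) d)))
  where
  B : Fo (τ ∷ [])
  B = fo (τ ∷ []) (A (lev 0))
  B-tr : trF (osub (elift (λ ())) B) ≡ trF B ⟦ lift {[]} {Γ₁ ++ Γ₀} (λ ()) ⟧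
  B-tr = trF-sub (elift (λ ())) (lift (λ ())) (λ { (here refl) → refl ; (there ()) }) B
check {Γ₀} Γ₁ Δ Δ′ {A} ξ-ax = fo Γ₁ A ≟ᶠ osub (λ ()) (fo {[]} [] A) >>= λ e →
  just (subst (D _ _) (trans (sym (trF-sub (λ ()) (λ ()) (λ ()) (fo {[]} [] A))) (cong trF (sym e)))
    (axiom (rca₀Ω Ξ₀-ax)))
check {Γ₀} Γ₁ Δ Δ′ {A} (thm d) = fo {Γ₁ ++ Γ₀} [] A ≟ᶠ fo Γ₁ A >>= λ e →
  just (subst (λ C → D _ _ (trF C)) e d)

-- Notation for the higher-order proofs

infixl 5 _$_ _∙_
infixr 2 _⟫_
infix 1 Λʰ_

_$_ : ∀ {A B} → Pf (A ⇒ B) → Pf A → Pf B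
_$_ = ⇒E

_∙_ : ∀ {σ A} → Pf (all σ A) → (t : HTm σ) → Pf (A t)
_∙_ = ∀E

Λʰ_ : ∀ {A B} → (Pf A → Pf B) → Pf (A ⇒ B)
Λʰ p = ⇒I′ (λ n → p (hyp n))

-- A sealed lemma can be used without checking its proof again.
Ok : ∀ {A} → Pf A → Set
Ok p = ∀ Γ Δ → T (is-just (check {Γ} [] [] Δ p))

-- It is accepted as a proof of `Ok p` because `check` evaluates to `just` already for variable Γ
-- and Δ; this is the point at which a proof is actually checked.
ok : ∀ (Γ : Ctx) (Δ : List (Fm Γ)) → ⊤
ok _ _ = tt

seal : ∀ {A} (p : Pf A) → Ok p → Pf A
seal p o = thm λ {Γ} {Δ} → to-witness-T (check [] [] Δ p) (o Γ Δ)

derivation : ∀ {A} (p : Pf A) → Ok p → D [] [] (trF (fo [] A))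
derivation p o = to-witness-T (check [] [] [] p) (o [] [])

cases : ∀ {A B C} → Pf (A ∨ B) → (Pf A → Pf C) → (Pf B → Pf C) → Pf C
cases p q r = ∨E′ p (λ n → q (hyp n)) (λ n → r (hyp n))

byContra : ∀ {A} → (Pf (~ A) → Pf ⊥̇) → Pf A
byContra p = raa′ (λ n → p (hyp n))

absurd : ∀ {A} → Pf ⊥̇ → Pf A
absurd p = raa′ (λ _ → p)

unpack : ∀ {σ A C} → Pf (exi σ A) → ((x : HTm σ) → Pf (A x) → Pf C) → Pf C
unpack p q = ∃E′ p (λ x n → q x (hyp n))

witness : ∀ {σ A} (t : HTm σ) → Pf (A t) → Pf (exi σ A)
witness t p = ∃I′ _ t p

have : ∀ {A C} → Pf A → (Pf A → Pf C) → Pf C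
have p q = ⇒E (Λʰ q) p

em : ∀ A {C} → (Pf A → Pf C) → (Pf (~ A) → Pf C) → Pf C
em A p q = byContra λ nc → nc $ q (Λʰ λ a → nc $ p a)

_⟫_ : ∀ {t u w} → Pf (t ≐ u) → Pf (u ≐ w) → Pf (t ≐ w)
_⟫_ = trᵖ

-- These say which constants `conv` unfolds. With `none` only the combinator and recursor equations
-- remain, and large constants such as `rel` stay folded.
every none : ℕ → Bool
every _ = true
none _  = false

≐β : ∀ {t u} → Pf (t ≐ u)
≐β {t} = conv {t ≐ t} every rfl

β : ∀ {A B} → Pf A → Pf B
β = conv none

rw : ∀ (A : HTm N → HFm) {t u} → Pf (t ≐ u) → Pf (A t) → Pf (A u)
rw = leib

ap : ∀ (f : HTm N → HTm N) {t u} → Pf (t ≐ u) → Pf (f t ≐ f u)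
ap f {t} p = leib (λ x → f t ≐ f x) p rfl

infixr 2 _≐⟨_⟩_ _≐⟨⟩_
infix  3 _□

_≐⟨_⟩_ : ∀ t {u w} → Pf (t ≐ u) → Pf (u ≐ w) → Pf (t ≐ w)
_ ≐⟨ p ⟩ q = trᵖ p q

_≐⟨⟩_ : ∀ t {u w} → Pf (u ≐ w) → Pf (t ≐ w)
t ≐⟨⟩ q = trᵖ (≐β {t}) q

_□ : ∀ t → Pf (t ≐ t)
_ □ = rfl

-- Arithmetic

zero-or-suc : Pf (all N λ x → x ≐ O ∨ x ≐ 1+ pre x)
zero-or-suc = seal (ind (λ x → x ≐ O ∨ x ≐ 1+ pre x) (∨I₁ rfl)
  (∀I λ x → Λʰ λ _ → ∨I₂ (≐β {u = 1+ pre (1+ x)}))) ok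

ncase : ∀ {A} t → (Pf (t ≐ O) → Pf A) → (Pf (t ≐ 1+ pre t) → Pf A) → Pf A
ncase t = cases (zero-or-suc ∙ t)

0≢1+ : ∀ {A t u} → Pf (t ≐ O) → Pf (t ≐ 1+ u) → Pf A
0≢1+ p q = absurd (1+≢0 (symᵖ q ⟫ p))

add-0ˡ : Pf (all N λ x → O + x ≐ x)
add-0ˡ = seal (ind (λ x → O + x ≐ x) ≐β (∀I λ x → Λʰ λ h → ≐β {u = 1+ (O + x)} ⟫ ap 1+_ h)) ok

add-sˡ : Pf (all N λ x → all N λ y → 1+ x + y ≐ 1+ (x + y))
add-sˡ = seal (∀I λ x → ind (λ y → 1+ x + y ≐ 1+ (x + y)) ≐β
  (∀I λ y → Λʰ λ h → ≐β {u = 1+ (1+ x + y)} ⟫ ap 1+_ h ⟫ ≐β)) ok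

add-comm : Pf (all N λ x → all N λ y → x + y ≐ y + x)
add-comm = seal (∀I λ x → ind (λ y → x + y ≐ y + x) (≐β {u = x} ⟫ symᵖ (add-0ˡ ∙ x))
  (∀I λ y → Λʰ λ h → ≐β {u = 1+ (x + y)} ⟫ ap 1+_ h ⟫ symᵖ (add-sˡ ∙ y ∙ x))) ok

0∸ : Pf (all N λ x → O ∸ x ≐ O)
0∸ = seal (ind (λ x → O ∸ x ≐ O) ≐β (∀I λ x → Λʰ λ h → ≐β {u = pre (O ∸ x)} ⟫ ap pre h ⟫ ≐β)) ok

s∸s : Pf (all N λ x → all N λ y → 1+ x ∸ 1+ y ≐ x ∸ y)
s∸s = seal (∀I λ x → ind (λ y → 1+ x ∸ 1+ y ≐ x ∸ y) ≐β
  (∀I λ y → Λʰ λ h → ≐β {u = pre (1+ x ∸ 1+ y)} ⟫ ap pre h ⟫ ≐β)) ok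

∸-self : Pf (all N λ x → x ∸ x ≐ O)
∸-self = seal (ind (λ x → x ∸ x ≐ O) ≐β (∀I λ x → Λʰ λ h → s∸s ∙ x ∙ x ⟫ h)) ok

add-∸-cancel : Pf (all N λ a → all N λ b → all N λ c → (a + c) ∸ (b + c) ≐ a ∸ b)
add-∸-cancel = seal (∀I λ a → ∀I λ b → ind (λ c → (a + c) ∸ (b + c) ≐ a ∸ b) ≐β
  (∀I λ c → Λʰ λ h → ≐β {u = 1+ (a + c) ∸ 1+ (b + c)} ⟫ s∸s ∙ (a + c) ∙ (b + c) ⟫ h)) ok

add-∸ : Pf (all N λ x → all N λ y → (x + y) ∸ y ≐ x)
add-∸ = seal (∀I λ x → ∀I λ y → ap (λ z → (x + y) ∸ z) (symᵖ (add-0ˡ ∙ y)) ⟫ add-∸-cancel ∙ x ∙ O ∙ y ⟫ ≐β) ok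

∸-add : Pf (all N λ y → all N λ x → y ∸ (x + y) ≐ O)
∸-add = seal (∀I λ y → ∀I λ x → ap (λ z → z ∸ (x + y)) (symᵖ (add-0ˡ ∙ y)) ⟫ add-∸-cancel ∙ O ∙ x ∙ y ⟫ 0∸ ∙ x) ok

≤-pred : Pf (all N λ y → all N λ w → 1+ y ∸ w ≐ O ⇒ y ∸ w ≐ O)
≤-pred = seal (∀I λ y → ∀I λ w → Λʰ λ h → symᵖ (s∸s ∙ y ∙ w) ⟫ ≐β {u = pre (1+ y ∸ w)} ⟫ ap pre h ⟫ ≐β) ok

1+∸ : Pf (all N λ w → 1+ w ∸ w ≐ 1+ O)
1+∸ = seal (∀I λ w →
  1+ w ∸ w              ≐⟨ ap (λ v → 1+ v ∸ w) (symᵖ (add-0ˡ ∙ w)) ⟩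
  1+ (O + w) ∸ w        ≐⟨ ap (_∸ w) (symᵖ (add-sˡ ∙ O ∙ w)) ⟩
  (1+ O + w) ∸ w        ≐⟨ add-∸ ∙ (1+ O) ∙ w ⟩
  1+ O                  □) ok

<-irrefl : ∀ {A t u} → Pf (t < u) → Pf (t ≐ u) → Pf A
<-irrefl {t = t} {u} h e = 0≢1+ (rw (λ v → 1+ v ∸ u ≐ O) e h) (1+∸ ∙ u)

≤-add : Pf (all N λ w → all N λ y → y ∸ w ≐ O ⇒ y + (w ∸ y) ≐ w)
≤-add = seal (∀I λ w → ind (λ y → y ∸ w ≐ O ⇒ y + (w ∸ y) ≐ w)
  (Λʰ λ _ → O + (w ∸ O) ≐⟨ add-0ˡ ∙ (w ∸ O) ⟩ w ∸ O ≐⟨⟩ w □)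
  (∀I λ y → Λʰ λ ih → Λʰ λ h → have (ih $ (≤-pred ∙ y ∙ w $ h)) λ e →
    ncase (w ∸ y)
      (λ z → <-irrefl h (y ≐⟨⟩ y + O ≐⟨ ap (y +_) (symᵖ z) ⟩ y + (w ∸ y) ≐⟨ e ⟩ w □))
      (λ p →
        1+ y + (w ∸ 1+ y)      ≐⟨⟩
        1+ y + pre (w ∸ y)     ≐⟨ add-sˡ ∙ y ∙ pre (w ∸ y) ⟩
        1+ (y + pre (w ∸ y))   ≐⟨⟩
        y + 1+ pre (w ∸ y)     ≐⟨ ap (y +_) (symᵖ p) ⟩
        y + (w ∸ y)            ≐⟨ e ⟩
        w                      □))) ok

<-∸ : Pf (all N λ y → all N λ w → y < w ⇒ w ∸ y ≐ 1+ (w ∸ 1+ y))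
<-∸ = seal (∀I λ y → ∀I λ w → Λʰ λ h → ncase (w ∸ y)
  (λ z → <-irrefl h
    (y ≐⟨⟩ y + O ≐⟨ ap (y +_) (symᵖ z) ⟩ y + (w ∸ y) ≐⟨ ≤-add ∙ w ∙ y $ (≤-pred ∙ y ∙ w $ h) ⟩ w □))
  (λ p → w ∸ y ≐⟨ p ⟩ 1+ pre (w ∸ y) ≐⟨⟩ 1+ (w ∸ 1+ y) □)) ok

≤-+ : Pf (all N λ x → all N λ a → all N λ b → x ∸ a ≐ O ⇒ x ∸ (a + b) ≐ O)
≤-+ = seal (∀I λ x → ∀I λ a → ind (λ b → x ∸ a ≐ O ⇒ x ∸ (a + b) ≐ O)
  (Λʰ λ h → conv every h)
  (∀I λ b → Λʰ λ ih → Λʰ λ h →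
    x ∸ (a + 1+ b) ≐⟨⟩ pre (x ∸ (a + b)) ≐⟨ ap pre (ih $ h) ⟩ pre O ≐⟨⟩ O □)) ok

if0-0 : Pf (all N λ t → all N λ u → all N λ w → t ≐ O ⇒ if0 t u w ≐ u)
if0-0 = seal (∀I λ t → ∀I λ u → ∀I λ w → Λʰ λ h →
  if0 t u w ≐⟨ ap (λ z → if0 z u w) h ⟩ if0 O u w ≐⟨⟩ u □) ok

if0-s : Pf (all N λ t → all N λ u → all N λ w → ~ (t ≐ O) ⇒ if0 t u w ≐ w)
if0-s = seal (∀I λ t → ∀I λ u → ∀I λ w → Λʰ λ h → ncase t (λ z → absurd (h $ z)) λ p →
  if0 t u w ≐⟨ ap (λ z → if0 z u w) p ⟩ if0 (1+ pre t) u w ≐⟨⟩ w □) ok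

+≐0ˡ : Pf (all N λ x → all N λ y → x + y ≐ O ⇒ x ≐ O)
+≐0ˡ = seal (∀I λ x → ∀I λ y → Λʰ λ h → ncase x (λ z → z)
  (λ p → 0≢1+ h (x + y ≐⟨ ap (_+ y) p ⟩ 1+ pre x + y ≐⟨ add-sˡ ∙ pre x ∙ y ⟩ 1+ (pre x + y) □))) ok

+≐0ʳ : Pf (all N λ x → all N λ y → x + y ≐ O ⇒ y ≐ O)
+≐0ʳ = seal (∀I λ x → ∀I λ y → Λʰ λ h → +≐0ˡ ∙ y ∙ x $ (add-comm ∙ y ∙ x ⟫ h)) ok

-- The pairing and its inverses

-- The root does not advance on the block from tri w to tri w + w, because the next triangular
-- number is tri w + 1 + w. Its value at tri w is a premise since `root-tri` obtains that value from
-- the previous block.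
root-step : Pf (all N λ w → root (tri w) ≐ w ⇒ all N λ y → y ∸ w ≐ O ⇒ root (y + tri w) ≐ w)
root-step = seal (∀I λ w → Λʰ λ h → ind (λ y → y ∸ w ≐ O ⇒ root (y + tri w) ≐ w)
  (Λʰ λ _ → root (O + tri w) ≐⟨ ap root (add-0ˡ ∙ tri w) ⟩ root (tri w) ≐⟨ h ⟩ w □)
  (∀I λ y → Λʰ λ ih → Λʰ λ le →
    have (ih $ (≤-pred ∙ y ∙ w $ le)) λ e →
    root (1+ y + tri w)       ≐⟨ ap root (add-sˡ ∙ y ∙ tri w) ⟩
    root (1+ (y + tri w))     ≐⟨⟩
    if0 (tri (1+ root (y + tri w)) ∸ 1+ (y + tri w)) (1+ root (y + tri w)) (root (y + tri w))
                              ≐⟨ ap (λ r → if0 (tri (1+ r) ∸ 1+ (y + tri w)) (1+ r) r) e ⟩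
    if0 (tri (1+ w) ∸ 1+ (y + tri w)) (1+ w) w
                              ≐⟨ ap (λ z → if0 z (1+ w) w)
      (tri (1+ w) ∸ 1+ (y + tri w)      ≐⟨⟩
       (1+ w + tri w) ∸ 1+ (y + tri w)  ≐⟨ ap (1+ w + tri w ∸_) (symᵖ (add-sˡ ∙ y ∙ tri w)) ⟩
       (1+ w + tri w) ∸ (1+ y + tri w)  ≐⟨ add-∸-cancel ∙ 1+ w ∙ 1+ y ∙ tri w ⟩
       1+ w ∸ 1+ y                      ≐⟨ s∸s ∙ w ∙ y ⟩
       w ∸ y                            ≐⟨ <-∸ ∙ y ∙ w $ le ⟩
       1+ (w ∸ 1+ y)                    □) ⟩
    if0 (1+ (w ∸ 1+ y)) (1+ w) w ≐⟨⟩
    w                         □)) ok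

root-tri : Pf (all N λ w → root (tri w) ≐ w)
root-tri = seal (ind (λ w → root (tri w) ≐ w) ≐β (∀I λ w → Λʰ λ h →
  have (root-step ∙ w $ h ∙ w $ (∸-self ∙ w)) λ e →
  root (tri (1+ w))     ≐⟨⟩
  root (1+ w + tri w)   ≐⟨ ap root (add-sˡ ∙ w ∙ tri w) ⟩
  root (1+ (w + tri w)) ≐⟨⟩
  if0 (tri (1+ root (w + tri w)) ∸ 1+ (w + tri w)) (1+ root (w + tri w)) (root (w + tri w))
                        ≐⟨ ap (λ r → if0 (tri (1+ r) ∸ 1+ (w + tri w)) (1+ r) r) e ⟩
  if0 (tri (1+ w) ∸ 1+ (w + tri w)) (1+ w) w ≐⟨⟩
  if0 (1+ w + tri w ∸ 1+ (w + tri w)) (1+ w) w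
                        ≐⟨ ap (λ z → if0 (z ∸ 1+ (w + tri w)) (1+ w) w) (add-sˡ ∙ w ∙ tri w) ⟩
  if0 (1+ (w + tri w) ∸ 1+ (w + tri w)) (1+ w) w
                        ≐⟨ ap (λ z → if0 z (1+ w) w) (∸-self ∙ 1+ (w + tri w)) ⟩
  if0 O (1+ w) w        ≐⟨⟩
  1+ w                  □)) ok

pair-eq : Pf (all N λ x → all N λ y → ⟪ x , y ⟫ ≐ y + tri (x + y))
pair-eq = seal (∀I λ x → ∀I λ y →
  ⟪ x , y ⟫ ≐⟨⟩ tri (x + y) + y ≐⟨ add-comm ∙ tri (x + y) ∙ y ⟩ y + tri (x + y) □) ok

root-pair : Pf (all N λ x → all N λ y → root ⟪ x , y ⟫ ≐ x + y)
root-pair = seal (∀I λ x → ∀I λ y → root ⟪ x , y ⟫ ≐⟨ ap root (pair-eq ∙ x ∙ y) ⟩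
  root (y + tri (x + y)) ≐⟨ root-step ∙ (x + y) $ (root-tri ∙ (x + y)) ∙ y $ (∸-add ∙ y ∙ x) ⟩
  x + y □) ok

right-pair : Pf (all N λ x → all N λ y → right ⟪ x , y ⟫ ≐ y)
right-pair = seal (∀I λ x → ∀I λ y →
  right ⟪ x , y ⟫                     ≐⟨⟩
  ⟪ x , y ⟫ ∸ tri (root ⟪ x , y ⟫)    ≐⟨ ap (λ r → ⟪ x , y ⟫ ∸ tri r) (root-pair ∙ x ∙ y) ⟩
  ⟪ x , y ⟫ ∸ tri (x + y)             ≐⟨ ap (_∸ tri (x + y)) (pair-eq ∙ x ∙ y) ⟩
  (y + tri (x + y)) ∸ tri (x + y)     ≐⟨ add-∸ ∙ y ∙ tri (x + y) ⟩
  y                                   □) ok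

left-pair : Pf (all N λ x → all N λ y → left ⟪ x , y ⟫ ≐ x)
left-pair = seal (∀I λ x → ∀I λ y →
  left ⟪ x , y ⟫                         ≐⟨⟩
  root ⟪ x , y ⟫ ∸ right ⟪ x , y ⟫       ≐⟨ ap (_∸ right ⟪ x , y ⟫) (root-pair ∙ x ∙ y) ⟩
  (x + y) ∸ right ⟪ x , y ⟫              ≐⟨ ap ((x + y) ∸_) (right-pair ∙ x ∙ y) ⟩
  (x + y) ∸ y                            ≐⟨ add-∸ ∙ x ∙ y ⟩
  x                                      □) ok

tri-≥ : Pf (all N λ x → tri x ≐ x + tri (pre x))
tri-≥ = seal (∀I λ x → ncase x
  (λ z → rw (λ v → tri v ≐ v + tri (pre v)) (symᵖ z) ≐β)
  (λ p → rw (λ v → tri v ≐ v + tri (pre v)) (symᵖ p) ≐β)) ok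

≤-pairˡ : Pf (all N λ x → all N λ a → all N λ b → x ∸ a ≐ O ⇒ x ∸ ⟪ a , b ⟫ ≐ O)
≤-pairˡ = seal (∀I λ x → ∀I λ a → ∀I λ b → Λʰ λ h →
  x ∸ ⟪ a , b ⟫                                  ≐⟨⟩
  x ∸ (tri (a + b) + b)                          ≐⟨ ap (λ t → x ∸ (t + b)) (tri-≥ ∙ (a + b)) ⟩
  x ∸ ((a + b) + tri (pre (a + b)) + b)          ≐⟨ ≤-+ ∙ x ∙ ((a + b) + tri (pre (a + b))) ∙ b $
    (≤-+ ∙ x ∙ (a + b) ∙ tri (pre (a + b)) $ (≤-+ ∙ x ∙ a ∙ b $ h)) ⟩
  O                                              □) ok

≤-pairʳ : Pf (all N λ x → all N λ a → all N λ b → x ∸ b ≐ O ⇒ x ∸ ⟪ a , b ⟫ ≐ O)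
≤-pairʳ = seal (∀I λ x → ∀I λ a → ∀I λ b → Λʰ λ h →
  x ∸ ⟪ a , b ⟫ ≐⟨ ap (x ∸_) (pair-eq ∙ a ∙ b) ⟩ x ∸ (b + tri (a + b)) ≐⟨ ≤-+ ∙ x ∙ b ∙ tri (a + b) $ h ⟩ O □) ok

-- Codes of finite sequences

init-⁀ : Pf (all N λ c → all N λ n → init (c ⁀ n) ≐ c)
init-⁀ = seal (∀I λ c → ∀I λ n → init (c ⁀ n) ≐⟨⟩ left ⟪ c , n ⟫ ≐⟨ left-pair ∙ c ∙ n ⟩ c □) ok

last-⁀ : Pf (all N λ c → all N λ n → last (c ⁀ n) ≐ n)
last-⁀ = seal (∀I λ c → ∀I λ n → last (c ⁀ n) ≐⟨⟩ right ⟪ c , n ⟫ ≐⟨ right-pair ∙ c ∙ n ⟩ n □) ok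

drop-init : Pf (all N λ c → all N λ k → drop (init c) k ≐ init (drop c k))
drop-init = seal (∀I λ c → ind (λ k → drop (init c) k ≐ init (drop c k)) ≐β (∀I λ k → Λʰ λ h →
  drop (init c) (1+ k) ≐⟨⟩ init (drop (init c) k) ≐⟨ ap init h ⟩ init (init (drop c k)) ≐⟨⟩
  init (drop c (1+ k)) □)) ok

drop-⁀ : Pf (all N λ c → all N λ n → all N λ k → drop (c ⁀ n) (1+ k) ≐ drop c k)
drop-⁀ = seal (∀I λ c → ∀I λ n → ∀I λ k →
  drop (c ⁀ n) (1+ k)   ≐⟨⟩
  init (drop (c ⁀ n) k) ≐⟨ symᵖ (drop-init ∙ (c ⁀ n) ∙ k) ⟩
  drop (init (c ⁀ n)) k ≐⟨ ap (λ d → drop d k) (init-⁀ ∙ c ∙ n) ⟩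
  drop c k              □) ok

drop-↾ : Pf (all type1 λ h → all N λ k → all N λ j → drop (h ↾ (k + j)) j ≐ h ↾ k)
drop-↾ = seal (∀I λ h → ∀I λ k → ind (λ j → drop (h ↾ (k + j)) j ≐ h ↾ k) ≐β (∀I λ j → Λʰ λ ih →
  drop (h ↾ (k + 1+ j)) (1+ j)                 ≐⟨⟩
  drop (h ↾ (k + j) ⁀ (h · (k + j))) (1+ j)    ≐⟨ drop-⁀ ∙ (h ↾ (k + j)) ∙ (h · (k + j)) ∙ j ⟩
  drop (h ↾ (k + j)) j                         ≐⟨ ih ⟩
  h ↾ k                                        □)) ok

drop-+ : Pf (all N λ c → all N λ x → all N λ j → drop c (x + j) ≐ drop (drop c x) j)
drop-+ = seal (∀I λ c → ∀I λ x → ind (λ j → drop c (x + j) ≐ drop (drop c x) j) ≐β (∀I λ j → Λʰ λ ih →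
  drop c (x + 1+ j) ≐⟨⟩ init (drop c (x + j)) ≐⟨ ap init ih ⟩ init (drop (drop c x) j) ≐⟨⟩
  drop (drop c x) (1+ j) □)) ok

drop-0 : Pf (all N λ j → drop O j ≐ O)
drop-0 = seal (ind (λ j → drop O j ≐ O) ≐β (∀I λ j → Λʰ λ ih →
  drop O (1+ j) ≐⟨⟩ init (drop O j) ≐⟨ ap init ih ⟩ init O ≐⟨⟩ O □)) ok

drop-↾-all : Pf (all type1 λ h → all N λ x → all N λ j → drop (h ↾ x) (x + j) ≐ O)
drop-↾-all = seal (∀I λ h → ∀I λ x → ∀I λ j →
  drop (h ↾ x) (x + j)               ≐⟨ drop-+ ∙ (h ↾ x) ∙ x ∙ j ⟩
  drop (drop (h ↾ x) x) j            ≐⟨ ap (λ v → drop (drop (h ↾ v) x) j) (symᵖ (add-0ˡ ∙ x)) ⟩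
  drop (drop (h ↾ (O + x)) x) j      ≐⟨ ap (λ v → drop v j) (drop-↾ ∙ h ∙ O ∙ x) ⟩
  drop (h ↾ O) j                     ≐⟨⟩
  drop O j                           ≐⟨ drop-0 ∙ j ⟩
  O                                  □) ok

drop-↾-< : Pf (all type1 λ h → all N λ x → all N λ m → m < x ⇒
  drop (h ↾ x) m ≐ h ↾ (x ∸ 1+ m) ⁀ (h · (x ∸ 1+ m)))
drop-↾-< = seal (∀I λ h → ∀I λ x → ∀I λ m → Λʰ λ lt →
  drop (h ↾ x) m                     ≐⟨ ap (λ v → drop (h ↾ v) m) (symᵖ (
    1+ (x ∸ 1+ m) + m    ≐⟨ add-comm ∙ 1+ (x ∸ 1+ m) ∙ m ⟩
    m + 1+ (x ∸ 1+ m)    ≐⟨⟩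
    1+ (m + (x ∸ 1+ m))  ≐⟨ symᵖ (add-sˡ ∙ m ∙ (x ∸ 1+ m)) ⟩
    1+ m + (x ∸ 1+ m)    ≐⟨ ≤-add ∙ x ∙ 1+ m $ lt ⟩
    x                    □)) ⟩
  drop (h ↾ (1+ (x ∸ 1+ m) + m)) m   ≐⟨ drop-↾ ∙ h ∙ 1+ (x ∸ 1+ m) ∙ m ⟩
  h ↾ (1+ (x ∸ 1+ m))                ≐⟨⟩
  h ↾ (x ∸ 1+ m) ⁀ (h · (x ∸ 1+ m))  □) ok

-- ∣ c ∣ is count c c.
count : HTm N → HTm N → HTm N
count c m = rec m O λ a i → if0 (drop c i) a (1+ a)

count-< : Pf (all type1 λ h → all N λ x → all N λ m → m ∸ x ≐ O ⇒ count (h ↾ x) m ≐ m)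
count-< = seal (∀I λ h → ∀I λ x → ind (λ m → m ∸ x ≐ O ⇒ count (h ↾ x) m ≐ m)
  (Λʰ λ _ → ≐β) (∀I λ m → Λʰ λ ih → Λʰ λ lt →
    count (h ↾ x) (1+ m) ≐⟨⟩
    if0 (drop (h ↾ x) m) (count (h ↾ x) m) (1+ count (h ↾ x) m)
      ≐⟨ ap (λ d → if0 d (count (h ↾ x) m) (1+ count (h ↾ x) m)) (drop-↾-< ∙ h ∙ x ∙ m $ lt) ⟩
    if0 (h ↾ (x ∸ 1+ m) ⁀ (h · (x ∸ 1+ m))) (count (h ↾ x) m) (1+ count (h ↾ x) m) ≐⟨⟩
    1+ count (h ↾ x) m  ≐⟨ ap 1+_ (ih $ (≤-pred ∙ m ∙ x $ lt)) ⟩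
    1+ m □)) ok

count-≥ : Pf (all type1 λ h → all N λ x → all N λ j → count (h ↾ x) (x + j) ≐ x)
count-≥ = seal (∀I λ h → ∀I λ x → ind (λ j → count (h ↾ x) (x + j) ≐ x)
  (count (h ↾ x) (x + O) ≐⟨⟩ count (h ↾ x) x ≐⟨ count-< ∙ h ∙ x ∙ x $ (∸-self ∙ x) ⟩ x □)
  (∀I λ j → Λʰ λ ih →
    count (h ↾ x) (x + 1+ j) ≐⟨⟩
    if0 (drop (h ↾ x) (x + j)) (count (h ↾ x) (x + j)) (1+ count (h ↾ x) (x + j))
      ≐⟨ ap (λ d → if0 d (count (h ↾ x) (x + j)) (1+ count (h ↾ x) (x + j))) (drop-↾-all ∙ h ∙ x ∙ j) ⟩
    if0 O (count (h ↾ x) (x + j)) (1+ count (h ↾ x) (x + j)) ≐⟨⟩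
    count (h ↾ x) (x + j) ≐⟨ ih ⟩
    x □)) ok

-- Each entry enlarges the code, so that counting up to the code itself reaches every nonempty
-- initial segment.
≤-↾ : Pf (all type1 λ h → all N λ x → x ∸ (h ↾ x) ≐ O)
≤-↾ = seal (∀I λ h → ind (λ x → x ∸ (h ↾ x) ≐ O) ≐β (∀I λ x → Λʰ λ ih →
  1+ x ∸ h ↾ (1+ x)                 ≐⟨⟩
  1+ x ∸ 1+ ⟪ h ↾ x , h · x ⟫        ≐⟨ s∸s ∙ x ∙ ⟪ h ↾ x , h · x ⟫ ⟩
  x ∸ ⟪ h ↾ x , h · x ⟫              ≐⟨ ≤-pairˡ ∙ x ∙ (h ↾ x) ∙ (h · x) $ ih ⟩
  O                                 □)) ok

length-↾ : Pf (all type1 λ h → all N λ x → ∣ h ↾ x ∣ ≐ x)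
length-↾ = seal (∀I λ h → ∀I λ x →
  ∣ h ↾ x ∣                              ≐⟨⟩
  count (h ↾ x) (h ↾ x)                  ≐⟨ ap (count (h ↾ x)) (symᵖ (≤-add ∙ (h ↾ x) ∙ x $ (≤-↾ ∙ h ∙ x))) ⟩
  count (h ↾ x) (x + ((h ↾ x) ∸ x))      ≐⟨ count-≥ ∙ h ∙ x ∙ ((h ↾ x) ∸ x) ⟩
  x                                      □) ok

entry-↾ : Pf (all type1 λ h → all N λ x → all N λ i → i < x ⇒ h ↾ x ‼ i ≐ h · i)
entry-↾ = seal (∀I λ h → ∀I λ x → ∀I λ i → Λʰ λ lt →
  h ↾ x ‼ i                               ≐⟨⟩
  last (drop (h ↾ x) (∣ h ↾ x ∣ ∸ 1+ i))   ≐⟨ ap (λ l → last (drop (h ↾ x) (l ∸ 1+ i))) (length-↾ ∙ h ∙ x) ⟩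
  last (drop (h ↾ x) (x ∸ 1+ i))          ≐⟨ ap (λ v → last (drop (h ↾ v) (x ∸ 1+ i))) (symᵖ (≤-add ∙ x ∙ 1+ i $ lt)) ⟩
  last (drop (h ↾ (1+ i + (x ∸ 1+ i))) (x ∸ 1+ i)) ≐⟨ ap last (drop-↾ ∙ h ∙ 1+ i ∙ (x ∸ 1+ i)) ⟩
  last (h ↾ (1+ i))                       ≐⟨⟩
  last (h ↾ i ⁀ (h · i))                  ≐⟨ last-⁀ ∙ (h ↾ i) ∙ (h · i) ⟩
  h · i                                   □) ok

-- Plays

par-cases : Pf (all N λ n → par n ≐ O ∨ par n ≐ 1+ O)
par-cases = seal (ind (λ n → par n ≐ O ∨ par n ≐ 1+ O) (∨I₁ ≐β) (∀I λ n → Λʰ λ ih → cases ih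
  (λ e → ∨I₂ (par (1+ n) ≐⟨⟩ 1+ O ∸ par n ≐⟨ ap (1+ O ∸_) e ⟩ 1+ O ∸ O ≐⟨⟩ 1+ O □))
  (λ e → ∨I₁ (par (1+ n) ≐⟨⟩ 1+ O ∸ par n ≐⟨ ap (1+ O ∸_) e ⟩ 1+ O ∸ 1+ O ≐⟨⟩ O □)))) ok

play-↾ : Pf (all Strategy λ S₀ → all Strategy λ S₁ → all N λ k → plays S₀ S₁ ↾ k ≐ pos S₀ S₁ k)
play-↾ = seal (∀I λ S₀ → ∀I λ S₁ → ind (λ k → plays S₀ S₁ ↾ k ≐ pos S₀ S₁ k) ≐β (∀I λ k → Λʰ λ ih →
  plays S₀ S₁ ↾ (1+ k)                            ≐⟨⟩
  plays S₀ S₁ ↾ k ⁀ mv S₀ S₁ k (pos S₀ S₁ k)      ≐⟨ ap (_⁀ mv S₀ S₁ k (pos S₀ S₁ k)) ih ⟩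
  pos S₀ S₁ k ⁀ mv S₀ S₁ k (pos S₀ S₁ k)          ≐⟨⟩
  pos S₀ S₁ (1+ k)                                □)) ok

pos-even : Pf (all Strategy λ S₀ → all Strategy λ S₁ → all N λ k → par k ≐ O ⇒
  pos S₀ S₁ (1+ k) ≐ pos S₀ S₁ k ⁀ (S₀ · pos S₀ S₁ k))
pos-even = seal (∀I λ S₀ → ∀I λ S₁ → ∀I λ k → Λʰ λ e →
  pos S₀ S₁ (1+ k) ≐⟨⟩
  pos S₀ S₁ k ⁀ if0 (par k) (S₀ · pos S₀ S₁ k) (S₁ · pos S₀ S₁ k)
    ≐⟨ ap (λ b → pos S₀ S₁ k ⁀ if0 b (S₀ · pos S₀ S₁ k) (S₁ · pos S₀ S₁ k)) e ⟩
  pos S₀ S₁ k ⁀ if0 O (S₀ · pos S₀ S₁ k) (S₁ · pos S₀ S₁ k) ≐⟨⟩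
  pos S₀ S₁ k ⁀ (S₀ · pos S₀ S₁ k) □) ok

pos-odd : Pf (all Strategy λ S₀ → all Strategy λ S₁ → all N λ k → par k ≐ 1+ O ⇒
  pos S₀ S₁ (1+ k) ≐ pos S₀ S₁ k ⁀ (S₁ · pos S₀ S₁ k))
pos-odd = seal (∀I λ S₀ → ∀I λ S₁ → ∀I λ k → Λʰ λ e →
  pos S₀ S₁ (1+ k) ≐⟨⟩
  pos S₀ S₁ k ⁀ if0 (par k) (S₀ · pos S₀ S₁ k) (S₁ · pos S₀ S₁ k)
    ≐⟨ ap (λ b → pos S₀ S₁ k ⁀ if0 b (S₀ · pos S₀ S₁ k) (S₁ · pos S₀ S₁ k)) e ⟩
  pos S₀ S₁ k ⁀ if0 (1+ O) (S₀ · pos S₀ S₁ k) (S₁ · pos S₀ S₁ k) ≐⟨⟩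
  pos S₀ S₁ k ⁀ (S₁ · pos S₀ S₁ k) □) ok

par-even : Pf (all N λ k → par k ≐ O ⇒ par (1+ k) ≐ 1+ O)
par-even = seal (∀I λ k → Λʰ λ e → par (1+ k) ≐⟨⟩ 1+ O ∸ par k ≐⟨ ap (1+ O ∸_) e ⟩ 1+ O ∸ O ≐⟨⟩ 1+ O □) ok

par-odd : Pf (all N λ k → par k ≐ 1+ O ⇒ par (1+ k) ≐ O)
par-odd = seal (∀I λ k → Λʰ λ e → par (1+ k) ≐⟨⟩ 1+ O ∸ par k ≐⟨ ap (1+ O ∸_) e ⟩ 1+ O ∸ 1+ O ≐⟨⟩ O □) ok

-- The principles of the theorem in higher-order syntax

Wins : HTm type1 → HTm type1 → HFm
Wins h f = exi N λ k → f · (h ↾ k) ≐ O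

DET* Uˢᵗ S²ˢᵗ : HFm
DET* = allˢᵗ type1 λ f →
    (exiˢᵗ Strategy λ S₀ → all Strategy λ S₁ → Wins (plays S₀ S₁) f)
  ∨ (exiˢᵗ Strategy λ S₁ → all Strategy λ S₀ → ~ Wins (plays S₀ S₁) f)

Winsˢᵗ : HTm type1 → HTm type1 → HFm
Winsˢᵗ h f = exiˢᵗ N λ k → f · (h ↾ k) ≐ O

Uˢᵗ = exiˢᵗ (type1 ⟶ N ⟶ Strategy) λ Φ → allˢᵗ type1 λ f →
    (allˢᵗ Strategy λ S₁ → Winsˢᵗ (plays (Φ · f · (1+ O)) S₁) f)
  ∨ (allˢᵗ Strategy λ S₀ → ~ Winsˢᵗ (plays S₀ (Φ · f · (1+ 1+ O))) f)

S²ˢᵗ = exiˢᵗ type2 suslinᴴ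

-- The Suslin functional

Path : HTm type1 → HTm type1 → HFm
Path f g = all N λ x → ~ (f · (g ↾ x) ≐ O)

Π⁰₁-trans Suslin : HFm
Π⁰₁-trans = allˢᵗ type1 λ f → (exi N λ x → f · x ≐ O) ⇒ (exiˢᵗ N λ x → f · x ≐ O)
Suslin = all type1 λ f → con Ξ₀ · f ≐ O ↔ (exi type1 λ g → Path f g)

-- The axiom compares `Ξ₀` only with functionals valued in 0 and 1; hence the normalisation S′ of S.
S²⇒Ξ₀ˢᵗ : Pf (S²ˢᵗ ⇒ suslinᴴ (con Ξ₀))
S²⇒Ξ₀ˢᵗ = seal (Λʰ λ h → unpack h λ S stS →
  let S′ : HTm type2
      S′ = lam λ f → if0 (S · f) O (1+ O) in
  have (∧E₁ stS) λ st-S →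
  have (∀I λ f →
    ∧I (Λʰ λ e → ncase (S · f) (λ z → z) λ p →
          0≢1+ e (S′ · f ≐⟨⟩ if0 (S · f) O (1+ O) ≐⟨ ap (λ v → if0 v O (1+ O)) p ⟩
                  if0 (1+ pre (S · f)) O (1+ O) ≐⟨⟩ 1+ O □))
       (Λʰ λ z → S′ · f ≐⟨⟩ if0 (S · f) O (1+ O) ≐⟨ ap (λ v → if0 v O (1+ O)) z ⟩ if0 O O (1+ O) ≐⟨⟩ O □))
    λ (S′-0 : Pf (all type1 λ f → S′ · f ≐ O ↔ S · f ≐ O)) →
  have (∧I
    (∀I λ f → Λʰ λ st-f →
      ∧I (Λʰ λ e → ∧E₁ (∧E₂ stS ∙ f $ st-f) $ (∧E₁ (S′-0 ∙ f) $ e))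
         (Λʰ λ e → ∧E₂ (S′-0 ∙ f) $ (∧E₂ (∧E₂ stS ∙ f $ st-f) $ e)))
    (∀I λ f → Λʰ λ st-f → ncase (S · f) (λ z → ∨I₁ (∧E₂ (S′-0 ∙ f) $ z)) λ p → ∨I₂
      (S′ · f ≐⟨⟩ if0 (S · f) O (1+ O) ≐⟨ ap (λ v → if0 v O (1+ O)) p ⟩
                  if0 (1+ pre (S · f)) O (1+ O) ≐⟨⟩ 1+ O □)))
    λ (u : Pf (uniqueˢᵗ S′)) →
  have (∧E₂ ξ-ax ∙ S′ $ stᵖ S′ $ u) λ agree →
  ∀I λ f → Λʰ λ st-f → have (agree ∙ f $ st-f) λ e →
    ∧I (Λʰ λ z → ∧E₁ (∧E₁ u ∙ f $ st-f) $ (symᵖ e ⟫ z))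
       (Λʰ λ p → e ⟫ (∧E₂ (∧E₁ u ∙ f $ st-f) $ p))) ok

-- A path through this tree consists of zeros of f.
zeros : HTm type1 → HTm type1
zeros f = lam λ c → if0 c (1+ O) (if0 (f · last c) (1+ O) O)

-- PF-TP∀ admits a single variable, so two functions are transferred together, as the values of one
-- functional at 0 and at 1.
two : HTm type1 → HTm type1 → HTm (N ⟶ type1)
two f g = lam λ n → lam λ m → if0 n (f · m) (g · m)

zeros-⁀ : Pf (all type1 λ f → all type1 λ g → all N λ x →
  zeros f · (g ↾ (1+ x)) ≐ if0 (f · (g · x)) (1+ O) O)
zeros-⁀ = seal (∀I λ f → ∀I λ g → ∀I λ x →
  zeros f · (g ↾ (1+ x))                         ≐⟨⟩
  if0 (f · last (g ↾ x ⁀ (g · x))) (1+ O) O      ≐⟨ ap (λ v → if0 (f · v) (1+ O) O) (last-⁀ ∙ (g ↾ x) ∙ (g · x)) ⟩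
  if0 (f · (g · x)) (1+ O) O                     □) ok

zeros-path : Pf (all type1 λ f → all type1 λ g → (all N λ x → f · (g · x) ≐ O) ⇒ Path (zeros f) g)
zeros-path = seal (∀I λ f → ∀I λ g → Λʰ λ h → ∀I λ x → Λʰ λ e → ncase x
  (λ z → 0≢1+ e (ap (λ v → zeros f · (g ↾ v)) z ⟫ ≐β {zeros f · (g ↾ O)} {1+ O}))
  (λ p → 0≢1+ e (
    zeros f · (g ↾ x)                     ≐⟨ ap (λ v → zeros f · (g ↾ v)) p ⟩
    zeros f · (g ↾ (1+ pre x))            ≐⟨ zeros-⁀ ∙ f ∙ g ∙ pre x ⟩
    if0 (f · (g · pre x)) (1+ O) O        ≐⟨ ap (λ v → if0 v (1+ O) O) (h ∙ pre x) ⟩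
    if0 O (1+ O) O                        ≐⟨⟩
    1+ O                                  □))) ok

-- For standard u, repeating the zero gives a standard path, so (S²)ˢᵗ applies. The implication has
-- no parameter besides u and transfers, which covers nonstandard zeros.
Ξ₀-zeros : Pf (suslinᴴ (con Ξ₀) ⇒ all type1 λ f → all N λ x → f · x ≐ O ⇒ con Ξ₀ · zeros f ≐ O)
Ξ₀-zeros = seal (Λʰ λ ξ →
  have (pftp (λ u → u · O · (u · (1+ O) · O) ≐ O ⇒ con Ξ₀ · zeros (u · O) ≐ O)
    (∀I λ u → Λʰ λ st-u → Λʰ λ e →
      let g : HTm type1
          g = lam λ _ → u · (1+ O) · O in
      ∧E₂ (ξ ∙ zeros (u · O) $ stᵖ (zeros (u · O))) $ witness g (∧I (stᵖ g)
        (∀I λ x → Λʰ λ _ → zeros-path ∙ (u · O) ∙ g $ (∀I λ y → conv every e) ∙ x))))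
  λ all-u → ∀I λ f → ∀I λ x → Λʰ λ e →
    let u = two f (lam λ _ → x) in
    leib (λ F → con Ξ₀ · F ≐ O) {zeros (u · O)} {zeros f} (∀I λ c → ≐β) (all-u ∙ u $ conv every e)) ok

-- A zero of a standard f, itself possibly nonstandard, makes `Ξ₀` vanish at the standard `zeros f`.
-- This tree then has a standard path, whose first entry is a standard zero.
Ξ₀ˢᵗ⇒Π⁰₁-trans : Pf (suslinᴴ (con Ξ₀) ⇒ Π⁰₁-trans)
Ξ₀ˢᵗ⇒Π⁰₁-trans = seal (Λʰ λ ξ → ∀I λ f → Λʰ λ st-f → Λʰ λ h → unpack h λ x e →
  unpack (∧E₁ (ξ ∙ zeros f $ stᵖ (zeros f)) $ (Ξ₀-zeros $ ξ ∙ f ∙ x $ e)) λ g hg →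
  have (∧E₁ hg) λ st-g →
  witness (g · O) (∧I (stᵖ (g · O)) (byContra λ ne → ∧E₂ hg ∙ 1+ O $ stᵖ (1+ O) $ (
    zeros f · (g ↾ (1+ O))       ≐⟨ zeros-⁀ ∙ f ∙ g ∙ O ⟩
    if0 (f · (g · O)) (1+ O) O   ≐⟨ if0-s ∙ (f · (g · O)) ∙ 1+ O ∙ O $ ne ⟩
    O                            □)))) ok

Π⁰₁-∀ : Pf (Π⁰₁-trans ⇒ allˢᵗ type1 λ f → (allˢᵗ N λ x → ~ (f · x ≐ O)) ⇒ all N λ x → ~ (f · x ≐ O))
Π⁰₁-∀ = seal (Λʰ λ t → ∀I λ f → Λʰ λ st-f → Λʰ λ h → ∀I λ x → Λʰ λ e →
  unpack (t ∙ f $ st-f $ witness x e) λ y hy → h ∙ y $ ∧E₁ hy $ ∧E₂ hy) ok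

Π⁰₁-Path : Pf (Π⁰₁-trans ⇒ allˢᵗ type1 λ f → allˢᵗ type1 λ g →
  (allˢᵗ N λ x → ~ (f · (g ↾ x) ≐ O)) ⇒ Path f g)
Π⁰₁-Path = seal (Λʰ λ t → ∀I λ f → Λʰ λ st-f → ∀I λ g → Λʰ λ st-g → Λʰ λ h →
  let k : HTm type1
      k = lam λ x → f · (g ↾ x) in
  ∀I λ x → Λʰ λ e → (Π⁰₁-∀ $ t ∙ k $ stᵖ k $ (∀I λ y → Λʰ λ st-y → Λʰ λ e′ → h ∙ y $ st-y $ β e′) ∙ x) $ β e) ok

-- A standard f might a priori have only nonstandard paths. Hence the implication from a path to a
-- zero of `Ξ₀` is transferred on its own, with f and g packed together, before the equivalence is
-- transferred from standard f to all f.
Ξ₀ˢᵗ⇒Suslin : Pf (suslinᴴ (con Ξ₀) ⇒ Suslin)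
Ξ₀ˢᵗ⇒Suslin = seal (Λʰ λ ξ → have (Ξ₀ˢᵗ⇒Π⁰₁-trans $ ξ) λ t →
  have (pftp (λ u → Path (u · O) (u · (1+ O)) ⇒ con Ξ₀ · (u · O) ≐ O)
    (∀I λ u → Λʰ λ st-u → Λʰ λ p → ∧E₂ (ξ ∙ (u · O) $ stᵖ (u · O)) $ witness (u · (1+ O))
      (∧I (stᵖ (u · (1+ O))) (∀I λ x → Λʰ λ _ → p ∙ x))))
  λ all-u → pftp (λ f → con Ξ₀ · f ≐ O ↔ (exi type1 λ g → Path f g)) (∀I λ f → Λʰ λ st-f → ∧I
    (Λʰ λ e → unpack (∧E₁ (ξ ∙ f $ st-f) $ e) λ g hg →
      witness g (Π⁰₁-Path $ t ∙ f $ st-f ∙ g $ ∧E₁ hg $ ∧E₂ hg))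
    (Λʰ λ h → unpack h λ g p →
      leib (λ F → con Ξ₀ · F ≐ O) {two f g · O} {f} (∀I λ c → ≐β) (all-u ∙ two f g $
        leib (λ F → Path F (two f g · (1+ O))) {f} {two f g · O} (∀I λ c → ≐β)
          (leib (Path f) {g} {two f g · (1+ O)} (∀I λ c → ≐β) p))))) ok

-- Selecting zeros of standard functions

≤-antisym : Pf (all N λ x → all N λ y → x ∸ y ≐ O ⇒ y ∸ x ≐ O ⇒ x ≐ y)
≤-antisym = seal (∀I λ x → ∀I λ y → Λʰ λ p → Λʰ λ q →
  x ≐⟨⟩ x + O ≐⟨ ap (x +_) (symᵖ q) ⟩ x + (y ∸ x) ≐⟨ ≤-add ∙ y ∙ x $ p ⟩ y □) ok

<-1+ : Pf (all N λ i → all N λ n → i < 1+ n ⇒ i ≐ n ∨ i < n)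
<-1+ = seal (∀I λ i → ∀I λ n → Λʰ λ h → have (symᵖ (s∸s ∙ i ∙ n) ⟫ h) λ le →
  ncase (n ∸ i) (λ z → ∨I₁ (≤-antisym ∙ i ∙ n $ le $ z)) (λ p → ∨I₂ (
    1+ i ∸ n                          ≐⟨ ap (1+ i ∸_) (symᵖ (≤-add ∙ n ∙ i $ le)) ⟩
    1+ i ∸ (i + (n ∸ i))              ≐⟨ ap (λ v → 1+ i ∸ (i + v)) p ⟩
    1+ i ∸ (i + 1+ pre (n ∸ i))       ≐⟨⟩
    1+ i ∸ 1+ (i + pre (n ∸ i))       ≐⟨ s∸s ∙ i ∙ (i + pre (n ∸ i)) ⟩
    i ∸ (i + pre (n ∸ i))             ≐⟨ ≤-+ ∙ i ∙ i ∙ pre (n ∸ i) $ (∸-self ∙ i) ⟩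
    O                                 □))) ok

search-zero : Pf (all (N ✶) λ L → all type1 λ f → all N λ i → all N λ n →
  i < n ⇒ f · (con ent · L · i) ≐ O ⇒ f · search L f n ≐ O)
search-zero = seal (∀I λ L → ∀I λ f → ∀I λ i →
  ind (λ n → i < n ⇒ f · (con ent · L · i) ≐ O ⇒ f · search L f n ≐ O)
    (Λʰ λ lt → absurd (1+≢0 {i} (conv every lt)))
    (∀I λ n → Λʰ λ ih → Λʰ λ lt → Λʰ λ z →
      let step : Pf (f · search L f (1+ n) ≐ f · if0 (f · (con ent · L · n)) (con ent · L · n) (search L f n))
          step = ≐β in
      em (f · (con ent · L · n) ≐ O)
        (λ e → step ⟫ ap (f ·_) (if0-0 ∙ _ ∙ _ ∙ _ $ e) ⟫ e)
        (λ ne → step ⟫ ap (f ·_) (if0-s ∙ _ ∙ _ ∙ _ $ ne) ⟫ cases (<-1+ ∙ i ∙ n $ lt)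
          (λ e → absurd (ne $ rw (λ v → f · (con ent · L · v) ≐ O) e z))
          (λ lt′ → ih $ lt′ $ z)))) ok

Mu : HTm type2 → HFm
Mu W = allˢᵗ type1 λ f → (exi N λ x → f · x ≐ O) ⇒ f · (W · f) ≐ O

-- HAC-int offers a finite list of candidates; being a zero is decidable, so `search` finds a right
-- one in the list. The implication in the matrix provides a candidate, namely 0, for functions
-- without zeros as well.
Π⁰₁-trans⇒Mu : Pf (Π⁰₁-trans ⇒ exiˢᵗ type2 Mu)
Π⁰₁-trans⇒Mu = seal (Λʰ λ t →
  unpack (hac (λ f n → (exi N λ x → f · x ≐ O) ⇒ f · n ≐ O) (∀I λ f → Λʰ λ st-f →
    em (exi N λ x → f · x ≐ O)
      (λ h → unpack (t ∙ f $ st-f $ h) λ x hx → witness x (∧I (∧E₁ hx) (Λʰ λ _ → ∧E₂ hx)))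
      (λ n → witness O (∧I (stᵖ O) (Λʰ λ h → absurd (n $ h)))))) λ Φ hΦ →
  have (∧E₁ hΦ) λ st-Φ →
  let W : HTm type2
      W = lam λ f → search (Φ · f) f (con len · (Φ · f)) in
  witness W (∧I (stᵖ W) (∀I λ f → Λʰ λ st-f → Λʰ λ h →
    unpack (∧E₂ hΦ ∙ f $ st-f) λ n hn → unpack (∧E₁ hn) λ i hi →
    f · (W · f) ≐⟨⟩ f · search (Φ · f) f (con len · (Φ · f))
      ≐⟨ search-zero ∙ (Φ · f) ∙ f ∙ i ∙ (con len · (Φ · f)) $ ∧E₁ hi $
         rw (λ v → f · v ≐ O) (∧E₂ hi) (∧E₂ hn $ h) ⟩ O □))) ok

-- Greatest fixed points

valʰ : HTm type3 → HTm type3 → HTm N → HTm type1 → HTm N → HTm N → HTm N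
valʰ c nx x₀ h x a = val c nx x₀ x a (h · ⟪ x , O ⟫) r (h · ⟪ nx · x · a · r , O ⟫)
  where r = h · ⟪ x , 1+ a ⟫

-- h encodes the set of all x with h ⟪ x , 0 ⟫ = 0, to which x₀ is added, and
-- the replies h ⟪ x , 1+ a ⟫.
Closed : HTm type3 → HTm type3 → HTm N → HTm type1 → HFm
Closed c nx x₀ h = all N λ x → all N λ a →
  eqOr x₀ x (h · ⟪ x , O ⟫) ≐ O ⇒
  ~ (c · x · a · (h · ⟪ x , 1+ a ⟫) ≐ O) ∧ h · ⟪ nx · x · a · (h · ⟪ x , 1+ a ⟫) , O ⟫ ≐ O

params : (HTm type3 → HTm type3 → HTm N → HFm) → HFm
params A = all type3 λ c → all type3 λ nx → all N λ x₀ → A c nx x₀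

tree-↾ : Pf (params λ c nx x₀ → all type1 λ h → all N λ y → all N λ x → all N λ a →
  left (left y) ≐ x ⇒ right (left y) ≐ a ⇒ tree c nx x₀ · (h ↾ y) ≐ guarded c nx x₀ y x a (h ↾ y))
tree-↾ = seal (∀I λ c → ∀I λ nx → ∀I λ x₀ → ∀I λ h → ∀I λ y → ∀I λ x → ∀I λ a → Λʰ λ ex → Λʰ λ ea →
  let d = h ↾ y
      E = guarded c nx x₀ in
  conv {tree c nx x₀ · d ≐ tree c nx x₀ · d} none rfl ⟫
  (E ∣ d ∣ (left (left ∣ d ∣)) (right (left ∣ d ∣)) d ≐⟨ ap (λ l → E l (left (left l)) (right (left l)) d) (length-↾ ∙ h ∙ y) ⟩
  E y (left (left y)) (right (left y)) d ≐⟨ ap (λ v → E y v (right (left y)) d) ex ⟩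
  E y x (right (left y)) d ≐⟨ ap (λ v → E y x v d) ea ⟩
  E y x a d □)) ok

tree-val : Pf (params λ c nx x₀ → all type1 λ h → all N λ y → all N λ x → all N λ a →
  ⟪ x , O ⟫ < y ⇒ ⟪ x , 1+ a ⟫ < y ⇒ ⟪ nx · x · a · (h · ⟪ x , 1+ a ⟫) , O ⟫ < y ⇒
  guarded c nx x₀ y x a (h ↾ y) ≐ valʰ c nx x₀ h x a)
tree-val = seal (∀I λ c → ∀I λ nx → ∀I λ x₀ → ∀I λ h → ∀I λ y → ∀I λ x → ∀I λ a →
  Λʰ λ g₀ → Λʰ λ g₁ → Λʰ λ g₂ →
  let d = h ↾ y
      r = h · ⟪ x , 1+ a ⟫
      i₂ = ⟪ nx · x · a · r , O ⟫ in
  guarded c nx x₀ y x a d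
    ≐⟨ ap (λ v → if0 (guard c nx x₀ y x a v) (val c nx x₀ x a (d ‼ ⟪ x , O ⟫) v (d ‼ ⟪ nx · x · a · v , O ⟫)) (1+ O))
          (entry-↾ ∙ h ∙ y ∙ ⟪ x , 1+ a ⟫ $ g₁) ⟩
  if0 (guard c nx x₀ y x a r) (val c nx x₀ x a (d ‼ ⟪ x , O ⟫) r (d ‼ i₂)) (1+ O)
    ≐⟨ ap (λ v → if0 ((1+ ⟪ x , O ⟫ ∸ y) + (1+ ⟪ x , 1+ a ⟫ ∸ y) + v) (val c nx x₀ x a (d ‼ ⟪ x , O ⟫) r (d ‼ i₂)) (1+ O)) g₂ ⟩
  if0 ((1+ ⟪ x , O ⟫ ∸ y) + (1+ ⟪ x , 1+ a ⟫ ∸ y) + O) (val c nx x₀ x a (d ‼ ⟪ x , O ⟫) r (d ‼ i₂)) (1+ O)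
    ≐⟨ ap (λ v → if0 ((1+ ⟪ x , O ⟫ ∸ y) + v + O) (val c nx x₀ x a (d ‼ ⟪ x , O ⟫) r (d ‼ i₂)) (1+ O)) g₁ ⟩
  if0 ((1+ ⟪ x , O ⟫ ∸ y) + O + O) (val c nx x₀ x a (d ‼ ⟪ x , O ⟫) r (d ‼ i₂)) (1+ O)
    ≐⟨ ap (λ v → if0 (v + O + O) (val c nx x₀ x a (d ‼ ⟪ x , O ⟫) r (d ‼ i₂)) (1+ O)) g₀ ⟩
  if0 (O + O + O) (val c nx x₀ x a (d ‼ ⟪ x , O ⟫) r (d ‼ i₂)) (1+ O)
    ≐⟨ if0-0 ∙ (O + O + O) ∙ val c nx x₀ x a (d ‼ ⟪ x , O ⟫) r (d ‼ i₂) ∙ 1+ O $ ≐β ⟩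
  val c nx x₀ x a (d ‼ ⟪ x , O ⟫) r (d ‼ i₂)
    ≐⟨ ap (λ v → val c nx x₀ x a v r (d ‼ i₂)) (entry-↾ ∙ h ∙ y ∙ ⟪ x , O ⟫ $ g₀) ⟩
  val c nx x₀ x a (h · ⟪ x , O ⟫) r (d ‼ i₂)
    ≐⟨ ap (val c nx x₀ x a (h · ⟪ x , O ⟫) r) (entry-↾ ∙ h ∙ y ∙ i₂ $ g₂) ⟩
  valʰ c nx x₀ h x a □) ok

if0-≐0 : Pf (all N λ t → all N λ u → all N λ w → if0 t u w ≐ O ⇒ t ≐ O ∨ w ≐ O)
if0-≐0 = seal (∀I λ t → ∀I λ u → ∀I λ w → Λʰ λ h → em (t ≐ O) ∨I₁
  (λ ne → ∨I₂ (symᵖ (if0-s ∙ t ∙ u ∙ w $ ne) ⟫ h))) ok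

eqOr-≐0 : Pf (all N λ x₀ → all N λ x → all N λ m → eqOr x₀ x m ≐ O ⇒ x ≐ x₀ ∨ m ≐ O)
eqOr-≐0 = seal (∀I λ x₀ → ∀I λ x → ∀I λ m → Λʰ λ h →
  cases (if0-≐0 ∙ ((x ∸ x₀) + (x₀ ∸ x)) ∙ O ∙ m $ h)
    (λ e → ∨I₁ (≤-antisym ∙ x ∙ x₀ $ (+≐0ˡ ∙ (x ∸ x₀) ∙ (x₀ ∸ x) $ e) $ (+≐0ʳ ∙ (x ∸ x₀) ∙ (x₀ ∸ x) $ e)))
    ∨I₂) ok

eqOr-0 : Pf (all N λ x₀ → all N λ x → all N λ m → m ≐ O ⇒ eqOr x₀ x m ≐ O)
eqOr-0 = seal (∀I λ x₀ → ∀I λ x → ∀I λ m → Λʰ λ h →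
  ap (eqOr x₀ x) h ⟫ em ((x ∸ x₀) + (x₀ ∸ x) ≐ O) (λ e → if0-0 ∙ _ ∙ O ∙ O $ e) (λ e → if0-s ∙ _ ∙ O ∙ O $ e)) ok

eqOr-refl : Pf (all N λ x → all N λ m → eqOr x x m ≐ O)
eqOr-refl = seal (∀I λ x → ∀I λ m → if0-0 ∙ ((x ∸ x) + (x ∸ x)) ∙ O ∙ m $
  (ap (λ v → v + v) (∸-self ∙ x) ⟫ ≐β)) ok

val-≢0 : Pf (params λ c nx x₀ → all N λ x → all N λ a → all N λ m → all N λ r → all N λ m′ →
  ~ (val c nx x₀ x a m r m′ ≐ O) ⇒ eqOr x₀ x m ≐ O ⇒ ~ (c · x · a · r ≐ O) ∧ m′ ≐ O)
val-≢0 = seal (∀I λ c → ∀I λ nx → ∀I λ x₀ → ∀I λ x → ∀I λ a → ∀I λ m → ∀I λ r → ∀I λ m′ → Λʰ λ h → Λʰ λ e →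
  have (if0-0 ∙ eqOr x₀ x m ∙ if0 (c · x · a · r) O (if0 m′ (1+ O) O) ∙ (1+ O) $ e) λ v →
  ∧I (Λʰ λ z → h $ (v ⟫ (if0-0 ∙ (c · x · a · r) ∙ O ∙ if0 m′ (1+ O) O $ z)))
     (byContra λ ne → h $ (v ⟫ ap (if0 (c · x · a · r) O) (if0-s ∙ m′ ∙ 1+ O ∙ O $ ne) ⟫
       em (c · x · a · r ≐ O) (λ z → if0-0 ∙ (c · x · a · r) ∙ O ∙ O $ z) (λ z → if0-s ∙ (c · x · a · r) ∙ O ∙ O $ z)))) ok

val-≐0 : Pf (params λ c nx x₀ → all N λ x → all N λ a → all N λ m → all N λ r → all N λ m′ →
  val c nx x₀ x a m r m′ ≐ O ⇒ eqOr x₀ x m ≐ O ∧ (~ (c · x · a · r ≐ O) ⇒ ~ (m′ ≐ O)))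
val-≐0 = seal (∀I λ c → ∀I λ nx → ∀I λ x₀ → ∀I λ x → ∀I λ a → ∀I λ m → ∀I λ r → ∀I λ m′ → Λʰ λ h →
  have (cases (if0-≐0 ∙ eqOr x₀ x m ∙ _ ∙ 1+ O $ h) (λ e → e) (λ e → absurd (1+≢0 e))) λ e →
  ∧I e (Λʰ λ nc → Λʰ λ z → 1+≢0 (
    symᵖ (if0-0 ∙ m′ ∙ 1+ O ∙ O $ z) ⟫ symᵖ (if0-s ∙ (c · x · a · r) ∙ O ∙ if0 m′ (1+ O) O $ nc) ⟫
    symᵖ (if0-0 ∙ eqOr x₀ x m ∙ if0 (c · x · a · r) O (if0 m′ (1+ O) O) ∙ 1+ O $ e) ⟫ h))) ok

Closed⇒Path : Pf (params λ c nx x₀ → all type1 λ h → Closed c nx x₀ h ⇒ Path (tree c nx x₀) h)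
Closed⇒Path = seal (∀I λ c → ∀I λ nx → ∀I λ x₀ → ∀I λ h → Λʰ λ cl → ∀I λ y → Λʰ λ e →
  let x = left (left y)
      a = right (left y)
      d = h ↾ y
      r = d ‼ ⟪ x , 1+ a ⟫ in
  have (symᵖ (tree-↾ ∙ c ∙ nx ∙ x₀ ∙ h ∙ y ∙ x ∙ a $ rfl $ rfl) ⟫ e) λ e′ →
  have (cases (if0-≐0 ∙ guard c nx x₀ y x a r ∙ _ ∙ 1+ O $ e′) (λ g → g) (λ e → absurd (1+≢0 e))) λ g →
  have (+≐0ˡ ∙ _ ∙ _ $ g) λ g₀₁ →
  have (+≐0ʳ ∙ _ ∙ _ $ g₀₁) λ g₁ →
  have (rw (λ v → ⟪ nx · x · a · v , O ⟫ < y) (entry-↾ ∙ h ∙ y ∙ ⟪ x , 1+ a ⟫ $ g₁) (+≐0ʳ ∙ _ ∙ _ $ g)) λ g₂ →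
  have (val-≐0 ∙ c ∙ nx ∙ x₀ ∙ x ∙ a ∙ _ ∙ _ ∙ _ $
    (symᵖ (tree-val ∙ c ∙ nx ∙ x₀ ∙ h ∙ y ∙ x ∙ a $ (+≐0ˡ ∙ _ ∙ _ $ g₀₁) $ g₁ $ g₂) ⟫ e′)) λ v →
  have (cl ∙ x ∙ a $ ∧E₁ v) λ w → ∧E₂ v $ ∧E₁ w $ ∧E₂ w) ok

Path⇒Closed : Pf (params λ c nx x₀ → all type1 λ h → Path (tree c nx x₀) h ⇒ Closed c nx x₀ h)
Path⇒Closed = seal (∀I λ c → ∀I λ nx → ∀I λ x₀ → ∀I λ h → Λʰ λ p → ∀I λ x → ∀I λ a →
  let r = h · ⟪ x , 1+ a ⟫
      i₀ = 1+ ⟪ x , O ⟫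
      i₁ = 1+ ⟪ x , 1+ a ⟫
      i₂ = 1+ ⟪ nx · x · a · r , O ⟫
      -- Padding: it makes y exceed the three indices consulted, while `left y` still determines x
      -- and a.
      b = i₀ + i₁ + i₂
      y = ⟪ ⟪ x , a ⟫ , b ⟫ in
  val-≢0 ∙ c ∙ nx ∙ x₀ ∙ x ∙ a ∙ (h · ⟪ x , O ⟫) ∙ r ∙ (h · ⟪ nx · x · a · r , O ⟫) $ (Λʰ λ e → p ∙ y $ (
    tree c nx x₀ · (h ↾ y)          ≐⟨ tree-↾ ∙ c ∙ nx ∙ x₀ ∙ h ∙ y ∙ x ∙ a
      $ (ap left (left-pair ∙ ⟪ x , a ⟫ ∙ b) ⟫ (left-pair ∙ x ∙ a))
      $ (ap right (left-pair ∙ ⟪ x , a ⟫ ∙ b) ⟫ (right-pair ∙ x ∙ a)) ⟩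
    guarded c nx x₀ y x a (h ↾ y)   ≐⟨ tree-val ∙ c ∙ nx ∙ x₀ ∙ h ∙ y ∙ x ∙ a
      $ (≤-pairʳ ∙ i₀ ∙ ⟪ x , a ⟫ ∙ b $ (≤-+ ∙ i₀ ∙ (i₀ + i₁) ∙ i₂ $ (≤-+ ∙ i₀ ∙ i₀ ∙ i₁ $ (∸-self ∙ i₀))))
      $ (≤-pairʳ ∙ i₁ ∙ ⟪ x , a ⟫ ∙ b $ (≤-+ ∙ i₁ ∙ (i₀ + i₁) ∙ i₂ $ (∸-add ∙ i₁ ∙ i₀)))
      $ (≤-pairʳ ∙ i₂ ∙ ⟪ x , a ⟫ ∙ b $ (∸-add ∙ i₂ ∙ (i₀ + i₁))) ⟩
    valʰ c nx x₀ h x a              ≐⟨ e ⟩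
    O                               □))) ok

-- The same h serves the successor x₁: since x₁ lies in the set that h encodes, adding x₁ to it in
-- place of x₀ yields no element outside the old closed set.
decᵗ-unfold : Pf (Suslin ⇒ params λ c nx x₀ → decᵗ c nx x₀ ≐ O ⇒
  all N λ a → exi N λ r → ~ (c · x₀ · a · r ≐ O) ∧ decᵗ c nx (nx · x₀ · a · r) ≐ O)
decᵗ-unfold = seal (Λʰ λ sus → ∀I λ c → ∀I λ nx → ∀I λ x₀ → Λʰ λ e → ∀I λ a →
  unpack (∧E₁ (sus ∙ tree c nx x₀) $ e) λ h p →
  have (Path⇒Closed ∙ c ∙ nx ∙ x₀ ∙ h $ p) λ cl →
  let r = h · ⟪ x₀ , 1+ a ⟫
      x₁ = nx · x₀ · a · r in
  have (cl ∙ x₀ ∙ a $ (eqOr-refl ∙ x₀ ∙ (h · ⟪ x₀ , O ⟫))) λ q →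
  witness r (∧I (∧E₁ q) (∧E₂ (sus ∙ tree c nx x₁) $ witness h (Closed⇒Path ∙ c ∙ nx ∙ x₁ ∙ h $
    (∀I λ x → ∀I λ a′ → Λʰ λ i → cl ∙ x ∙ a′ $ (eqOr-0 ∙ x₀ ∙ x ∙ (h · ⟪ x , O ⟫) $
      cases (eqOr-≐0 ∙ x₁ ∙ x ∙ (h · ⟪ x , O ⟫) $ i)
        (λ x≐ → rw (λ v → h · ⟪ v , O ⟫ ≐ O) (symᵖ x≐) (∧E₂ q)) (λ z → z))))))) ok

-- The post-fixed points of the operator in question; unlike in `Closed`, the replies are not yet
-- given by a function.
Prog : HTm type3 → HTm type3 → HTm type1 → HFm
Prog c nx Z = all N λ x → Z · x ≐ O ⇒ all N λ a → exi N λ r →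
  ~ (c · x · a · r ≐ O) ∧ Z · (nx · x · a · r) ≐ O

-- A path also has to contain the replies. QF-AC of type (1,0) chooses them, with the pair of x and
-- a presented as the type 1 object `two′ x a`; the matrix is quantifier-free because Z is a
-- function.
decᵗ-coind : Pf (Suslin ⇒ all type3 λ c → all type3 λ nx → all type1 λ Z →
  Prog c nx Z ⇒ all N λ x₀ → Z · x₀ ≐ O ⇒ decᵗ c nx x₀ ≐ O)
decᵗ-coind = seal (Λʰ λ sus → ∀I λ c → ∀I λ nx → ∀I λ Z → Λʰ λ pr → ∀I λ x₀ → Λʰ λ e →
  let A : HTm N → HTm N → HTm N → HFm
      A x a r = Z · x ≐ O ⇒ ~ (c · x · a · r ≐ O) ∧ Z · (nx · x · a · r) ≐ O
      two′ : HTm N → HTm N → HTm type1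
      two′ x a = lam λ n → if0 n x a in
  unpack (qfac (λ p r → A (p · O) (p · (1+ O)) r) (∀I λ p → em (Z · (p · O) ≐ O)
    (λ z → unpack (pr ∙ (p · O) $ z ∙ (p · (1+ O))) λ r hr → witness r (Λʰ λ _ → hr))
    (λ nz → witness O (Λʰ λ z → absurd (nz $ z))))) λ F hF →
  let h : HTm type1
      h = lam λ i → if0 (right i) (Z · left i) (F · two′ (left i) (pre (right i))) in
  have (∀I λ x →
    conv {h · ⟪ x , O ⟫ ≐ h · ⟪ x , O ⟫} none rfl ⟫
    (if0 (right ⟪ x , O ⟫) (Z · left ⟪ x , O ⟫) (F · two′ (left ⟪ x , O ⟫) (pre (right ⟪ x , O ⟫)))
      ≐⟨ if0-0 ∙ (right ⟪ x , O ⟫) ∙ (Z · left ⟪ x , O ⟫) ∙ _ $ (right-pair ∙ x ∙ O) ⟩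
    Z · left ⟪ x , O ⟫ ≐⟨ ap (Z ·_) (left-pair ∙ x ∙ O) ⟩
    Z · x □))
    λ (h₀ : Pf (all N λ x → h · ⟪ x , O ⟫ ≐ Z · x)) →
  have (∀I λ x → ∀I λ a → let i = ⟪ x , 1+ a ⟫ in
    conv {h · i ≐ h · i} none rfl ⟫
    (if0 (right i) (Z · left i) (F · two′ (left i) (pre (right i)))
      ≐⟨ ap (λ v → if0 v (Z · left i) (F · two′ (left i) (pre v))) (right-pair ∙ x ∙ 1+ a) ⟩
    if0 (1+ a) (Z · left i) (F · two′ (left i) (pre (1+ a)))
      ≐⟨ ap (λ v → if0 (1+ a) (Z · v) (F · two′ v (pre (1+ a)))) (left-pair ∙ x ∙ 1+ a) ⟩
    if0 (1+ a) (Z · x) (F · two′ x (pre (1+ a))) ≐⟨⟩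
    F · two′ x a □))
    λ (h₁ : Pf (all N λ x → all N λ a → h · ⟪ x , 1+ a ⟫ ≐ F · two′ x a)) →
  have (∀I λ x → ∀I λ a → rw (A x a) (symᵖ (h₁ ∙ x ∙ a)) (conv every (hF ∙ two′ x a)))
    λ (hA : Pf (all N λ x → all N λ a → A x a (h · ⟪ x , 1+ a ⟫))) →
  ∧E₂ (sus ∙ tree c nx x₀) $ witness h (Closed⇒Path ∙ c ∙ nx ∙ x₀ ∙ h $ (∀I λ x → ∀I λ a → Λʰ λ i →
    have (hA ∙ x ∙ a $ cases (eqOr-≐0 ∙ x₀ ∙ x ∙ (h · ⟪ x , O ⟫) $ i)
      (λ x≐ → rw (λ v → Z · v ≐ O) (symᵖ x≐) e) (λ z → symᵖ (h₀ ∙ x) ⟫ z)) λ q →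
    ∧I (∧E₁ q) ((h₀ ∙ (nx · x · a · (h · ⟪ x , 1+ a ⟫))) ⟫ ∧E₂ q)))) ok

only : ℕ → ℕ → Bool
only k n = k ≡ᵇ n

dec-unfold : Pf (Suslin ⇒ params λ c nx x₀ → dec c nx x₀ ≐ O ⇒
  all N λ a → exi N λ r → ~ (c · x₀ · a · r ≐ O) ∧ dec c nx (nx · x₀ · a · r) ≐ O)
dec-unfold = seal (Λʰ λ sus → conv (only 22) (decᵗ-unfold $ sus)) ok

dec-coind : Pf (Suslin ⇒ all type3 λ c → all type3 λ nx → all type1 λ Z →
  Prog c nx Z ⇒ all N λ x₀ → Z · x₀ ≐ O ⇒ dec c nx x₀ ≐ O)
dec-coind = seal (Λʰ λ sus → conv (only 22) (decᵗ-coind $ sus)) ok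

ex0-elim : Pf (Suslin ⇒ all type1 λ f → ex0 f ≐ O ⇒ exi N λ x → f · x ≐ O)
ex0-elim = seal (Λʰ λ sus → ∀I λ f → Λʰ λ e →
  unpack (dec-unfold $ sus ∙ ex0C f ∙ ex0N ∙ O $ conv (only 23) e ∙ O) λ r hr →
  witness r (byContra λ ne → ∧E₁ hr $ β (if0-s ∙ (f · r) ∙ 1+ O ∙ O $ ne))) ok

ex0-intro : Pf (Suslin ⇒ all type1 λ f → (exi N λ x → f · x ≐ O) ⇒ ex0 f ≐ O)
ex0-intro = seal (Λʰ λ sus → ∀I λ f → Λʰ λ h → unpack h λ x hx →
  let Z : HTm type1
      Z = lam λ _ → O in
  conv {dec (ex0C f) ex0N O ≐ O} (only 23)
  (dec-coind $ sus ∙ ex0C f ∙ ex0N ∙ Z $ (∀I λ y → Λʰ λ _ → ∀I λ a → witness x (∧I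
    (Λʰ λ e → 0≢1+ (β e) (if0-0 ∙ (f · x) ∙ 1+ O ∙ O $ hx)) ≐β)) ∙ O $ ≐β)) ok

-- Arithmetical comprehension

not0 : HTm N → HTm N
not0 t = if0 t (1+ O) O

-- 0 stands for truth.
χ : HFm → HTm N
χ (t ≐ u)        = (t ∸ u) + (u ∸ t)
χ (A ∧ B)        = χ A + χ B
χ (A ∨ B)        = if0 (χ A) O (χ B)
χ (A ⇒ B)        = if0 (χ A) (χ B) O
χ (all N A)      = not0 (ex0 (lam λ x → not0 (χ (A x))))
χ (exi N A)      = ex0 (lam λ x → χ (A x))
χ ⊥̇              = 1+ O
χ _              = O

Arithmetical : HFm → Set
Arithmetical (t ≐ u)   = ⊤
Arithmetical (st t)    = ⊥
Arithmetical ⊥̇         = ⊤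
Arithmetical (A ∧ B)   = Arithmetical A × Arithmetical B
Arithmetical (A ∨ B)   = Arithmetical A × Arithmetical B
Arithmetical (A ⇒ B)   = Arithmetical A × Arithmetical B
Arithmetical (all N A) = ∀ x → Arithmetical (A x)
Arithmetical (exi N A) = ∀ x → Arithmetical (A x)
Arithmetical (all _ A) = ⊥
Arithmetical (exi _ A) = ⊥

≐-char : Pf (all N λ t → all N λ u → (t ∸ u) + (u ∸ t) ≐ O ↔ t ≐ u)
≐-char = seal (∀I λ t → ∀I λ u → ∧I
  (Λʰ λ e → ≤-antisym ∙ t ∙ u $ (+≐0ˡ ∙ (t ∸ u) ∙ (u ∸ t) $ e) $ (+≐0ʳ ∙ (t ∸ u) ∙ (u ∸ t) $ e))
  (Λʰ λ e → ap (λ v → (v ∸ u) + (u ∸ v)) e ⟫ ap (λ v → v + v) (∸-self ∙ u) ⟫ ≐β)) ok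

∧-char : Pf (all N λ t → all N λ u → t + u ≐ O ↔ t ≐ O ∧ u ≐ O)
∧-char = seal (∀I λ t → ∀I λ u → ∧I (Λʰ λ e → ∧I (+≐0ˡ ∙ t ∙ u $ e) (+≐0ʳ ∙ t ∙ u $ e))
  (Λʰ λ e → ap (_+ u) (∧E₁ e) ⟫ ap (O +_) (∧E₂ e) ⟫ ≐β)) ok

∨-char : Pf (all N λ t → all N λ u → if0 t O u ≐ O ↔ t ≐ O ∨ u ≐ O)
∨-char = seal (∀I λ t → ∀I λ u → ∧I (if0-≐0 ∙ t ∙ O ∙ u) (Λʰ λ h →
  em (t ≐ O) (λ z → if0-0 ∙ t ∙ O ∙ u $ z) (λ nz → (if0-s ∙ t ∙ O ∙ u $ nz) ⟫
    cases h (λ z → absurd (nz $ z)) (λ z → z)))) ok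

⇒-char : Pf (all N λ t → all N λ u → if0 t u O ≐ O ↔ (t ≐ O ⇒ u ≐ O))
⇒-char = seal (∀I λ t → ∀I λ u → ∧I (Λʰ λ e → Λʰ λ z → symᵖ (if0-0 ∙ t ∙ u ∙ O $ z) ⟫ e)
  (Λʰ λ h → em (t ≐ O) (λ z → (if0-0 ∙ t ∙ u ∙ O $ z) ⟫ (h $ z)) (λ nz → if0-s ∙ t ∙ u ∙ O $ nz))) ok

not0-char : Pf (all N λ t → not0 t ≐ O ↔ ~ (t ≐ O))
not0-char = seal (∀I λ t → ∧I (Λʰ λ e → Λʰ λ z → 1+≢0 (symᵖ (if0-0 ∙ t ∙ 1+ O ∙ O $ z) ⟫ e))
  (Λʰ λ nz → if0-s ∙ t ∙ 1+ O ∙ O $ nz)) ok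

χ-spec : Pf Suslin → ∀ A → Arithmetical A → Pf (χ A ≐ O ↔ A)
χ-spec sus (t ≐ u) _ = ≐-char ∙ t ∙ u
χ-spec sus ⊥̇ _ = ∧I (Λʰ λ e → 1+≢0 e) (Λʰ absurd)
χ-spec sus (A ∧ B) (a , b) = have (χ-spec sus A a) λ p → have (χ-spec sus B b) λ q → ∧I
  (Λʰ λ e → have (∧E₁ (∧-char ∙ χ A ∙ χ B) $ e) λ h → ∧I (∧E₁ p $ ∧E₁ h) (∧E₁ q $ ∧E₂ h))
  (Λʰ λ h → ∧E₂ (∧-char ∙ χ A ∙ χ B) $ ∧I (∧E₂ p $ ∧E₁ h) (∧E₂ q $ ∧E₂ h))
χ-spec sus (A ∨ B) (a , b) = have (χ-spec sus A a) λ p → have (χ-spec sus B b) λ q → ∧I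
  (Λʰ λ e → cases (∧E₁ (∨-char ∙ χ A ∙ χ B) $ e) (λ h → ∨I₁ (∧E₁ p $ h)) (λ h → ∨I₂ (∧E₁ q $ h)))
  (Λʰ λ h → ∧E₂ (∨-char ∙ χ A ∙ χ B) $ cases h (λ h → ∨I₁ (∧E₂ p $ h)) (λ h → ∨I₂ (∧E₂ q $ h)))
χ-spec sus (A ⇒ B) (a , b) = have (χ-spec sus A a) λ p → have (χ-spec sus B b) λ q → ∧I
  (Λʰ λ e → Λʰ λ h → ∧E₁ q $ (∧E₁ (⇒-char ∙ χ A ∙ χ B) $ e $ (∧E₂ p $ h)))
  (Λʰ λ h → ∧E₂ (⇒-char ∙ χ A ∙ χ B) $ (Λʰ λ e → ∧E₂ q $ (h $ (∧E₁ p $ e))))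
χ-spec sus (exi N A) a = have (∀I λ x → χ-spec sus (A x) (a x)) λ p →
  let f : HTm type1
      f = lam λ x → χ (A x) in ∧I
  (Λʰ λ e → unpack (ex0-elim $ sus ∙ f $ e) λ x hx → witness x (∧E₁ (p ∙ x) $ β hx))
  (Λʰ λ h → unpack h λ x hx → ex0-intro $ sus ∙ f $ witness x (β (∧E₂ (p ∙ x) $ hx)))
χ-spec sus (all N A) a = have (∀I λ x → χ-spec sus (A x) (a x)) λ p →
  let f : HTm type1
      f = lam λ x → not0 (χ (A x)) in ∧I
  (Λʰ λ e → ∀I λ x → ∧E₁ (p ∙ x) $ byContra λ nz → ∧E₁ (not0-char ∙ ex0 f) $ e $
    (ex0-intro $ sus ∙ f $ witness x (β (∧E₂ (not0-char ∙ χ (A x)) $ nz))))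
  (Λʰ λ h → ∧E₂ (not0-char ∙ ex0 f) $ (Λʰ λ e → unpack (ex0-elim $ sus ∙ f $ e) λ x hx →
    ∧E₁ (not0-char ∙ χ (A x)) $ β hx $ (∧E₂ (p ∙ x) $ (h ∙ x))))

-- Atoms may contain `rel` and `chain`, which yield terms of type 0. Comprehension, and with it
-- coinduction, thus reaches sets defined from other greatest fixed points.
comp : Pf Suslin → (A : HTm N → HFm) → (∀ x → Arithmetical (A x)) →
       Pf (exi type1 λ Z → all N λ x → Z · x ≐ O ↔ A x)
comp sus A a = witness (lam λ x → χ (A x)) (∀I λ x → have (χ-spec sus (A x) (a x)) λ p →
  ∧I (Λʰ λ e → ∧E₁ p $ β e) (Λʰ λ h → β {χ (A x) ≐ O} (∧E₂ p $ h)))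

dec-coindᶠ : Pf Suslin → ∀ c nx (A : HTm N → HFm) → (∀ x → Arithmetical (A x)) →
  Pf (all N λ x → A x ⇒ all N λ a → exi N λ r → ~ (c · x · a · r ≐ O) ∧ A (nx · x · a · r)) →
  Pf (all N λ x → A x ⇒ dec c nx x ≐ O)
dec-coindᶠ sus c nx A a p = unpack (comp sus A a) λ Z hZ → ∀I λ x₀ → Λʰ λ h →
  dec-coind $ sus ∙ c ∙ nx ∙ Z $ (∀I λ x → Λʰ λ e → ∀I λ a →
    unpack (p ∙ x $ (∧E₁ (hZ ∙ x) $ e) ∙ a) λ r hr → witness r (∧I (∧E₁ hr) (∧E₂ (hZ ∙ _) $ ∧E₂ hr)))
    ∙ x₀ $ (∧E₂ (hZ ∙ x₀) $ h)

-- Comparing positions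

relation : (HTm type1 → HTm type1 → HTm N → HFm) → HFm
relation A = all type1 λ g → all type1 λ f → all N λ x → A g f x

relC-0 : Pf (relation λ g f x → all N λ a → all N λ r →
  g · left (right x) ≐ O ⇒ relC g f · x · a · r ≐ 1+ O)
relC-0 = seal (∀I λ g → ∀I λ f → ∀I λ x → ∀I λ a → ∀I λ r → Λʰ λ e →
  β (if0-0 ∙ _ ∙ 1+ O ∙ (f · right (right x)) $ e)) ok

relC-1 : Pf (relation λ g f x → all N λ a → all N λ r →
  ~ (g · left (right x) ≐ O) ⇒ relC g f · x · a · r ≐ f · right (right x))
relC-1 = seal (∀I λ g → ∀I λ f → ∀I λ x → ∀I λ a → ∀I λ r → Λʰ λ e →
  β (if0-s ∙ _ ∙ 1+ O ∙ (f · right (right x)) $ e)) ok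

relN-0 : Pf (relation λ g f x → all N λ a → all N λ r →
  g · left (right x) ≐ O ⇒ relN g f · x · a · r ≐ x)
relN-0 = seal (∀I λ g → ∀I λ f → ∀I λ x → ∀I λ a → ∀I λ r → Λʰ λ e →
  β (if0-0 ∙ _ ∙ x ∙ (if0 (left x) ⟪ 1+ O , ⟪ left (right x) ⁀ r , right (right x) ⁀ a ⟫ ⟫
                ⟪ O , ⟪ left (right x) ⁀ a , right (right x) ⁀ r ⟫ ⟫) $ e)) ok

relN-even : Pf (relation λ g f x → all N λ a → all N λ r →
  ~ (g · left (right x) ≐ O) ⇒ left x ≐ O ⇒
  relN g f · x · a · r ≐ ⟪ 1+ O , ⟪ left (right x) ⁀ r , right (right x) ⁀ a ⟫ ⟫)
relN-even = seal (∀I λ g → ∀I λ f → ∀I λ x → ∀I λ a → ∀I λ r → Λʰ λ e → Λʰ λ z →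
  β {if0 _ x _ ≐ ⟪ 1+ O , ⟪ left (right x) ⁀ r , right (right x) ⁀ a ⟫ ⟫}
    ((if0-s ∙ (g · left (right x)) ∙ x ∙ _ $ e) ⟫ (if0-0 ∙ left x ∙ _ ∙
    ⟪ O , ⟪ left (right x) ⁀ a , right (right x) ⁀ r ⟫ ⟫ $ z))) ok

relN-odd : Pf (relation λ g f x → all N λ a → all N λ r →
  ~ (g · left (right x) ≐ O) ⇒ ~ (left x ≐ O) ⇒
  relN g f · x · a · r ≐ ⟪ O , ⟪ left (right x) ⁀ a , right (right x) ⁀ r ⟫ ⟫)
relN-odd = seal (∀I λ g → ∀I λ f → ∀I λ x → ∀I λ a → ∀I λ r → Λʰ λ e → Λʰ λ z →
  β {if0 _ x _ ≐ ⟪ O , ⟪ left (right x) ⁀ a , right (right x) ⁀ r ⟫ ⟫}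
    ((if0-s ∙ (g · left (right x)) ∙ x ∙ _ $ e) ⟫ (if0-s ∙ left x ∙
    ⟪ 1+ O , ⟪ left (right x) ⁀ r , right (right x) ⁀ a ⟫ ⟫ ∙ _ $ z))) ok

-- The closure condition of which rel g f is the greatest solution.
RelStep : (HTm N → HTm N → HTm N → HFm) → HTm type1 → HTm type1 → HTm N → HTm N → HTm N → HFm
RelStep P g f b t u = ~ (g · t ≐ O) ⇒ ~ (f · u ≐ O)
  ∧ (b ≐ O ⇒ all N λ a → exi N λ r → P (1+ O) (t ⁀ r) (u ⁀ a))
  ∧ (~ (b ≐ O) ⇒ all N λ a → exi N λ r → P O (t ⁀ a) (u ⁀ r))

module _ (P : HTm N → HTm N → HTm N → HFm) where

  coded : HTm N → HFm
  coded x = P (left x) (left (right x)) (right (right x))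

  code : ∀ {b t u} → Pf (P b t u) → Pf (coded ⟪ b , ⟪ t , u ⟫ ⟫)
  code {b} {t} {u} p =
    rw (λ v → P v (left (right x)) (right (right x))) (symᵖ (left-pair ∙ b ∙ ⟪ t , u ⟫))
    (rw (λ v → P b (left v) (right v)) (symᵖ (right-pair ∙ b ∙ ⟪ t , u ⟫))
    (rw (λ v → P b v (right ⟪ t , u ⟫)) (symᵖ (left-pair ∙ t ∙ u))
    (rw (P b t) (symᵖ (right-pair ∙ t ∙ u)) p)))
    where x = ⟪ b , ⟪ t , u ⟫ ⟫

  decode : ∀ {b t u} → Pf (coded ⟪ b , ⟪ t , u ⟫ ⟫) → Pf (P b t u)
  decode {b} {t} {u} p =
    rw (P b t) (right-pair ∙ t ∙ u)
    (rw (λ v → P b v (right ⟪ t , u ⟫)) (left-pair ∙ t ∙ u)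
    (rw (λ v → P b (left v) (right v)) (right-pair ∙ b ∙ ⟪ t , u ⟫)
    (rw (λ v → P v (left (right x)) (right (right x))) (left-pair ∙ b ∙ ⟪ t , u ⟫) p)))
    where x = ⟪ b , ⟪ t , u ⟫ ⟫

rel-dec : ∀ {g f b t u} → Pf (dec (relC g f) (relN g f) ⟪ b , ⟪ t , u ⟫ ⟫ ≐ O) → Pf (rel g f b t u ≐ O)
rel-dec = conv (only 24)

rel-unfold : Pf (Suslin ⇒ all type1 λ g → all type1 λ f → all N λ b → all N λ t → all N λ u →
  rel g f b t u ≐ O ⇒ RelStep (λ b t u → rel g f b t u ≐ O) g f b t u)
rel-unfold = seal (Λʰ λ sus → ∀I λ g → ∀I λ f → ∀I λ b → ∀I λ t → ∀I λ u → Λʰ λ h →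
  decode (λ b t u → RelStep (λ b t u → rel g f b t u ≐ O) g f b t u) (
  let x = ⟪ b , ⟪ t , u ⟫ ⟫ in Λʰ λ nz →
  have (dec-unfold $ sus ∙ relC g f ∙ relN g f ∙ x $ conv (only 24) h) λ q →
  ∧I (unpack (q ∙ O) λ r hr → Λʰ λ z → ∧E₁ hr $ ((relC-1 ∙ g ∙ f ∙ x ∙ O ∙ r $ nz) ⟫ z))
  (∧I (Λʰ λ e → ∀I λ a → unpack (q ∙ a) λ r hr → witness r (rel-dec
         (rw (λ v → dec (relC g f) (relN g f) v ≐ O) (relN-even ∙ g ∙ f ∙ x ∙ a ∙ r $ nz $ e) (∧E₂ hr))))
      (Λʰ λ e → ∀I λ a → unpack (q ∙ a) λ r hr → witness r (rel-dec
         (rw (λ v → dec (relC g f) (relN g f) v ≐ O) (relN-odd ∙ g ∙ f ∙ x ∙ a ∙ r $ nz $ e) (∧E₂ hr)))))) ) ok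

rel-coind : Pf Suslin → ∀ g f (P : HTm N → HTm N → HTm N → HFm) → (∀ b t u → Arithmetical (P b t u)) →
  Pf (all N λ b → all N λ t → all N λ u → P b t u ⇒ RelStep P g f b t u) →
  Pf (all N λ b → all N λ t → all N λ u → P b t u ⇒ rel g f b t u ≐ O)
rel-coind sus g f P ar p =
  have (dec-coindᶠ sus (relC g f) (relN g f) (coded P) (λ x → ar _ _ _)
    (∀I λ x → Λʰ λ h → ∀I λ a → em (g · left (right x) ≐ O)
      (λ z → witness O (∧I (Λʰ λ e → 0≢1+ e (relC-0 ∙ g ∙ f ∙ x ∙ a ∙ O $ z))
        (rw (coded P) (symᵖ (relN-0 ∙ g ∙ f ∙ x ∙ a ∙ O $ z)) h)))
      (λ nz → have (p ∙ left x ∙ left (right x) ∙ right (right x) $ h $ nz) λ q →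
        have (∀I λ r → Λʰ λ e → ∧E₁ q $ (symᵖ (relC-1 ∙ g ∙ f ∙ x ∙ a ∙ r $ nz) ⟫ e))
          λ (c≢0 : Pf (all N λ r → ~ (relC g f · x · a · r ≐ O))) →
        em (left x ≐ O)
          (λ e → unpack (∧E₁ (∧E₂ q) $ e ∙ a) λ r hr → witness r (∧I (c≢0 ∙ r)
            (rw (coded P) (symᵖ (relN-even ∙ g ∙ f ∙ x ∙ a ∙ r $ nz $ e)) (code P hr))))
          (λ e → unpack (∧E₂ (∧E₂ q) $ e ∙ a) λ r hr → witness r (∧I (c≢0 ∙ r)
            (rw (coded P) (symᵖ (relN-odd ∙ g ∙ f ∙ x ∙ a ∙ r $ nz $ e)) (code P hr)))))))
  λ d → ∀I λ b → ∀I λ t → ∀I λ u → Λʰ λ h → rel-dec (d ∙ ⟪ b , ⟪ t , u ⟫ ⟫ $ code P h)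

-- A greatest post-fixed point is a fixed point: the relation together with the pairs that lead into
-- it in one step is again a post-fixed point.
rel-fold : Pf (Suslin ⇒ all type1 λ g → all type1 λ f → all N λ b → all N λ t → all N λ u →
  RelStep (λ b t u → rel g f b t u ≐ O) g f b t u ⇒ rel g f b t u ≐ O)
rel-fold = seal (Λʰ λ sus → ∀I λ g → ∀I λ f →
  let R : HTm N → HTm N → HTm N → HFm
      R b t u = rel g f b t u ≐ O
      P : HTm N → HTm N → HTm N → HFm
      P b t u = R b t u ∨ RelStep R g f b t u in
  have (∀I λ b → ∀I λ t → ∀I λ u → Λʰ λ h → Λʰ λ nz →
    have (cases h (λ e → rel-unfold $ sus ∙ g ∙ f ∙ b ∙ t ∙ u $ e) (λ e → e) $ nz) λ q →
    ∧I (∧E₁ q) (∧I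
      (Λʰ λ e → ∀I λ a → unpack (∧E₁ (∧E₂ q) $ e ∙ a) λ r hr → witness r (∨I₁ hr))
      (Λʰ λ e → ∀I λ a → unpack (∧E₂ (∧E₂ q) $ e ∙ a) λ r hr → witness r (∨I₁ hr))))
  λ s → have (rel-coind sus g f P _ s) λ d → ∀I λ b → ∀I λ t → ∀I λ u → Λʰ λ h → d ∙ b ∙ t ∙ u $ ∨I₂ h) ok

rel-escape : Pf (Suslin ⇒ all type1 λ g → all type1 λ f → all N λ b → all N λ t → all N λ u →
  g · t ≐ O ⇒ rel g f b t u ≐ O)
rel-escape = seal (Λʰ λ sus → ∀I λ g → ∀I λ f → ∀I λ b → ∀I λ t → ∀I λ u → Λʰ λ e →
  rel-fold $ sus ∙ g ∙ f ∙ b ∙ t ∙ u $ (Λʰ λ ne → absurd (ne $ e))) ok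

-- Replies compose through the middle position: a challenge at w is answered at u and then at t when
-- player 0 moves, and in the opposite direction when player 1 moves. If t is not won then neither
-- is u, so both relations unfold.
rel-trans : Pf (Suslin ⇒ all type1 λ f → all N λ b → all N λ t → all N λ u → all N λ w →
  rel f f b t u ≐ O ⇒ rel f f b u w ≐ O ⇒ rel f f b t w ≐ O)
rel-trans = seal (Λʰ λ sus → ∀I λ f →
  have (rel-coind sus f f (λ b t w → exi N λ u → rel f f b t u ≐ O ∧ rel f f b u w ≐ O) _
    (∀I λ b → ∀I λ t → ∀I λ w → Λʰ λ h → unpack h λ u hu → Λʰ λ nz →
      have (rel-unfold $ sus ∙ f ∙ f ∙ b ∙ t ∙ u $ ∧E₁ hu $ nz) λ p →
      have (rel-unfold $ sus ∙ f ∙ f ∙ b ∙ u ∙ w $ ∧E₂ hu $ ∧E₁ p) λ q →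
      ∧I (∧E₁ q) (∧I
        (Λʰ λ e → ∀I λ a → unpack (∧E₁ (∧E₂ q) $ e ∙ a) λ r hr →
          unpack (∧E₁ (∧E₂ p) $ e ∙ r) λ r′ hr′ → witness r′ (witness (u ⁀ r) (∧I hr′ hr)))
        (Λʰ λ e → ∀I λ a → unpack (∧E₂ (∧E₂ p) $ e ∙ a) λ r hr →
          unpack (∧E₂ (∧E₂ q) $ e ∙ r) λ r′ hr′ → witness r′ (witness (u ⁀ r) (∧I hr hr′))))))
  λ d → ∀I λ b → ∀I λ t → ∀I λ u → ∀I λ w → Λʰ λ p → Λʰ λ q → d ∙ b ∙ t ∙ w $ witness u (∧I p q)) ok

-- Open determinacy

chain-unfold : Pf (Suslin ⇒ all type1 λ f → all N λ b → all N λ v → chain f b v ≐ O ⇒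
  exi N λ r → ~ (rel f f b v r ≐ O) ∧ chain f b r ≐ O)
chain-unfold = seal (Λʰ λ sus → ∀I λ f → ∀I λ b → ∀I λ v → Λʰ λ h →
  unpack (dec-unfold $ sus ∙ chainC f b ∙ chainN ∙ v $ conv (only 25) h ∙ O) λ r hr →
  witness r (∧I (β (∧E₁ hr)) (conv {dec (chainC f b) chainN (chainN · v · O · r) ≐ O} (only 25) (∧E₂ hr)))) ok

chain-coind : Pf Suslin → ∀ f b (P : HTm N → HFm) → (∀ v → Arithmetical (P v)) →
  Pf (all N λ v → P v ⇒ exi N λ r → ~ (rel f f b v r ≐ O) ∧ P r) →
  Pf (all N λ v → P v ⇒ chain f b v ≐ O)
chain-coind sus f b P ar p = have (dec-coindᶠ sus (chainC f b) chainN P ar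
  (∀I λ v → Λʰ λ h → ∀I λ a → unpack (p ∙ v $ h) λ r hr → witness r (∧I (β (∧E₁ hr))
    (rw P (conv {r ≐ r} none rfl) (∧E₂ hr)))))
  λ d → ∀I λ v → Λʰ λ h → conv {dec (chainC f b) chainN v ≐ O} (only 25) (d ∙ v $ h)

-- A won position is related to every position, hence to any candidate for the next term.
chain-payoff : Pf (Suslin ⇒ all type1 λ f → all N λ b → all N λ v → chain f b v ≐ O ⇒ ~ (f · v ≐ O))
chain-payoff = seal (Λʰ λ sus → ∀I λ f → ∀I λ b → ∀I λ v → Λʰ λ h → Λʰ λ e →
  unpack (chain-unfold $ sus ∙ f ∙ b ∙ v $ h) λ r hr →
  ∧E₁ hr $ (rel-escape $ sus ∙ f ∙ f ∙ b ∙ v ∙ r $ e)) ok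

-- The rest of the chain of v also continues u: if u were related to the second term r, then so
-- would v be, by transitivity.
chain-rel : Pf (Suslin ⇒ all type1 λ f → all N λ b → all N λ v → all N λ u →
  chain f b v ≐ O ⇒ rel f f b v u ≐ O ⇒ chain f b u ≐ O)
chain-rel = seal (Λʰ λ sus → ∀I λ f → ∀I λ b → ∀I λ v → ∀I λ u → Λʰ λ h → Λʰ λ vu →
  chain-coind sus f b (λ w → w ≐ u ∨ chain f b w ≐ O) _
    (∀I λ w → Λʰ λ hw → cases hw
      (λ e → unpack (chain-unfold $ sus ∙ f ∙ b ∙ v $ h) λ r hr → witness r (∧I
        (Λʰ λ wr → ∧E₁ hr $ (rel-trans $ sus ∙ f ∙ b ∙ v ∙ u ∙ r $ vu $ rw (λ z → rel f f b z r ≐ O) e wr))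
        (∨I₂ (∧E₂ hr))))
      (λ c → unpack (chain-unfold $ sus ∙ f ∙ b ∙ w $ c) λ r hr → witness r (∧I (∧E₁ hr) (∨I₂ (∧E₂ hr)))))
    ∙ u $ ∨I₁ rfl) ok

not-all : ∀ {σ} {A : HTm σ → HFm} → Pf (~ (all σ A)) → Pf (exi σ λ x → ~ A x)
not-all p = byContra λ n → p $ (∀I λ x → byContra λ nx → n $ witness x nx)

-- As v is not won, the step condition can fail only at the moves: some move of player 0 at v is
-- matched by none at u.
unrelated-even : Pf (Suslin ⇒ all type1 λ f → all N λ u → all N λ v →
  ~ (rel f f O u v ≐ O) ⇒ ~ (f · v ≐ O) ⇒
  exi N λ a → all N λ r → ~ (rel f f (1+ O) (u ⁀ r) (v ⁀ a) ≐ O))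
unrelated-even = seal (Λʰ λ sus → ∀I λ f → ∀I λ u → ∀I λ v → Λʰ λ nr → Λʰ λ nv →
  byContra λ n → nr $ (rel-fold $ sus ∙ f ∙ f ∙ O ∙ u ∙ v $ (Λʰ λ _ → ∧I nv (∧I
    (Λʰ λ _ → ∀I λ a → byContra λ m → n $ witness a (∀I λ r → Λʰ λ e → m $ witness r e))
    (Λʰ λ ne → absurd (ne $ rfl)))))) ok

unrelated-odd : Pf (Suslin ⇒ all type1 λ f → all N λ u → all N λ v →
  ~ (rel f f (1+ O) u v ≐ O) ⇒ ~ (f · v ≐ O) ⇒
  exi N λ a → all N λ r → ~ (rel f f O (u ⁀ a) (v ⁀ r) ≐ O))
unrelated-odd = seal (Λʰ λ sus → ∀I λ f → ∀I λ u → ∀I λ v → Λʰ λ nr → Λʰ λ nv →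
  byContra λ n → nr $ (rel-fold $ sus ∙ f ∙ f ∙ (1+ O) ∙ u ∙ v $ (Λʰ λ _ → ∧I nv (∧I
    (Λʰ λ e → absurd (1+≢0 e))
    (Λʰ λ _ → ∀I λ a → byContra λ m → n $ witness a (∀I λ r → Λʰ λ e → m $ witness r e)))))) ok

-- If v follows u in a chain, then v has a move a′ that is matched by no move at u, so v ⁀ a′ may
-- follow u ⁀ a for every a.
chain-even : Pf (Suslin ⇒ all type1 λ f → all N λ u → chain f O u ≐ O ⇒
  all N λ a → chain f (1+ O) (u ⁀ a) ≐ O)
chain-even = seal (Λʰ λ sus → ∀I λ f → ∀I λ u₀ → Λʰ λ h₀ → ∀I λ a₀ →
  chain-coind sus f (1+ O) (λ w → exi N λ u → exi N λ a → w ≐ u ⁀ a ∧ chain f O u ≐ O) _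
    (∀I λ w → Λʰ λ hw → unpack hw λ u hu → unpack hu λ a ha →
      unpack (chain-unfold $ sus ∙ f ∙ O ∙ u $ ∧E₂ ha) λ v hv →
      unpack (unrelated-even $ sus ∙ f ∙ u ∙ v $ ∧E₁ hv $ (chain-payoff $ sus ∙ f ∙ O ∙ v $ ∧E₂ hv)) λ a′ ha′ →
      witness (v ⁀ a′) (∧I
        (rw (λ z → ~ (rel f f (1+ O) z (v ⁀ a′) ≐ O)) (symᵖ (∧E₁ ha)) (ha′ ∙ a))
        (witness v (witness a′ (∧I rfl (∧E₂ hv))))))
    ∙ (u₀ ⁀ a₀) $ witness u₀ (witness a₀ (∧I rfl h₀))) ok

-- The move at v can be fixed only in view of the term v′ after it. The invariant therefore lets w
-- be unrelated to all v ⁀ r, and the choice of r is made one step later.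
chain-odd : Pf (Suslin ⇒ all type1 λ f → all N λ u → chain f (1+ O) u ≐ O ⇒
  exi N λ r → chain f O (u ⁀ r) ≐ O)
chain-odd = seal (Λʰ λ sus → ∀I λ f → ∀I λ u₀ → Λʰ λ h₀ →
  have (∀I λ u → ∀I λ v → Λʰ λ nr → Λʰ λ cv →
    unrelated-odd $ sus ∙ f ∙ u ∙ v $ nr $ (chain-payoff $ sus ∙ f ∙ (1+ O) ∙ v $ cv))
  λ (next : Pf (all N λ u → all N λ v → ~ (rel f f (1+ O) u v ≐ O) ⇒ chain f (1+ O) v ≐ O ⇒
               exi N λ a → all N λ r → ~ (rel f f O (u ⁀ a) (v ⁀ r) ≐ O))) →
  unpack (chain-unfold $ sus ∙ f ∙ (1+ O) ∙ u₀ $ h₀) λ v₀ hv₀ →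
  unpack (next ∙ u₀ ∙ v₀ $ ∧E₁ hv₀ $ ∧E₂ hv₀) λ a₀ ha₀ → witness a₀
  (chain-coind sus f O (λ w → exi N λ v → chain f (1+ O) v ≐ O ∧ all N λ r → ~ (rel f f O w (v ⁀ r) ≐ O)) _
    (∀I λ w → Λʰ λ hw → unpack hw λ v hv →
      unpack (chain-unfold $ sus ∙ f ∙ (1+ O) ∙ v $ ∧E₁ hv) λ v′ hv′ →
      unpack (next ∙ v ∙ v′ $ ∧E₁ hv′ $ ∧E₂ hv′) λ a ha →
      witness (v ⁀ a) (∧I (∧E₂ hv ∙ a) (witness v′ (∧I (∧E₂ hv′) ha))))
    ∙ (u₀ ⁀ a₀) $ witness v₀ (∧I (∧E₂ hv₀) ha₀))) ok

rel-refl : Pf (Suslin ⇒ all type1 λ f → all N λ b → all N λ t → all N λ u → t ≐ u ⇒ rel f f b t u ≐ O)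
rel-refl = seal (Λʰ λ sus → ∀I λ f → rel-coind sus f f (λ b t u → t ≐ u) _
  (∀I λ b → ∀I λ t → ∀I λ u → Λʰ λ e → Λʰ λ nz → ∧I (rw (λ v → ~ (f · v ≐ O)) e nz) (∧I
    (Λʰ λ _ → ∀I λ a → witness a (ap (_⁀ a) e))
    (Λʰ λ _ → ∀I λ a → witness a (ap (_⁀ a) e))))) ok

Least : HTm type1 → HTm N → HTm N → HFm
Least f t n = all N λ m → rel f f (1+ O) (t ⁀ n) (t ⁀ m) ≐ O

-- Each t ⁀ n has a sibling to which it is not related, so the siblings alone supply the chain.
no-least : Pf (Suslin ⇒ all type1 λ f → all N λ t → ~ (exi N λ n → Least f t n) ⇒
  all N λ n → chain f (1+ O) (t ⁀ n) ≐ O)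
no-least = seal (Λʰ λ sus → ∀I λ f → ∀I λ t → Λʰ λ nl → ∀I λ n₀ →
  chain-coind sus f (1+ O) (λ w → exi N λ n → w ≐ t ⁀ n) _
    (∀I λ w → Λʰ λ hw → unpack hw λ n hn →
      unpack (not-all {A = λ m → rel f f (1+ O) (t ⁀ n) (t ⁀ m) ≐ O} (Λʰ λ l → nl $ witness n l)) λ m hm →
      witness (t ⁀ m) (∧I (rw (λ z → ~ (rel f f (1+ O) z (t ⁀ m) ≐ O)) (symᵖ hn) hm) (witness m rfl)))
    ∙ (t ⁀ n₀) $ witness n₀ rfl) ok

one : HTm type1
one = lam λ _ → 1+ O

-- Player 1 wins from u, where b is the parity of the length of u: a position of
-- a game that player 0 never wins is related only to such positions.
Wins₁ : HTm type1 → HTm N → HTm N → HFm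
Wins₁ f b u = rel one f b O u ≐ O

MinStrategy : HTm type1 → HTm Strategy → HFm
MinStrategy f S₀ = all N λ t → (exi N λ n → Least f t n) ⇒ Least f t (S₀ · t)

lost-play : Pf (Suslin ⇒ all type1 λ f → all Strategy λ S₀ → all Strategy λ S₁ →
  MinStrategy f S₀ ⇒ (all N λ k → ~ (f · pos S₀ S₁ k ≐ O)) ⇒ Wins₁ f O O)
lost-play = seal (Λʰ λ sus → ∀I λ f → ∀I λ S₀ → ∀I λ S₁ → Λʰ λ ms → Λʰ λ lost →
  let t : HTm N → HTm N
      t k = pos S₀ S₁ k
      -- The clause on b in the second case turns b ≠ 0 into b = 1, the form in which `chain-odd`
      -- applies.
      P : HTm N → HTm N → HTm N → HFm
      P b x u = (exi N λ k → par k ≐ b ∧ rel f f b (t k) u ≐ O)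
              ∨ ((b ≐ O ∨ b ≐ 1+ O) ∧ chain f b u ≐ O) in
  have (∀I λ b → ∀I λ u → Λʰ λ ru → unpack ru λ k hk →
     ∧E₁ (rel-unfold $ sus ∙ f ∙ f ∙ b ∙ t k ∙ u $ ∧E₂ hk $ (lost ∙ k)))
  λ (payoff : Pf (all N λ b → all N λ u → (exi N λ k → par k ≐ b ∧ rel f f b (t k) u ≐ O) ⇒ ~ (f · u ≐ O))) →
  have (∀I λ b → ∀I λ x → ∀I λ u → Λʰ λ h → Λʰ λ _ → ∧I
    (cases h (λ r → payoff ∙ b ∙ u $ r) (λ c → chain-payoff $ sus ∙ f ∙ b ∙ u $ ∧E₂ c))
    (∧I
      (Λʰ λ b0 → ∀I λ a → witness O (cases h
        (λ r → unpack r λ k hk →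
          have (rel-unfold $ sus ∙ f ∙ f ∙ b ∙ t k ∙ u $ ∧E₂ hk $ (lost ∙ k)) λ q →
          unpack (∧E₁ (∧E₂ q) $ b0 ∙ a) λ n hn →
          em (exi N λ n → Least f (t k) n)
            -- The move of S₀ is related to n, so by transitivity the next position of the play is
            -- related to u ⁀ a.
            (λ l → ∨I₁ (witness (1+ k) (∧I (par-even ∙ k $ (∧E₁ hk ⟫ b0))
              (rw (λ z → rel f f (1+ O) z (u ⁀ a) ≐ O) (symᵖ (pos-even ∙ S₀ ∙ S₁ ∙ k $ (∧E₁ hk ⟫ b0)))
                (rel-trans $ sus ∙ f ∙ (1+ O) ∙ (t k ⁀ (S₀ · t k)) ∙ (t k ⁀ n) ∙ (u ⁀ a) $
                  (ms ∙ t k $ l ∙ n) $ hn)))))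
            -- Without a least move t k ⁀ n starts a chain, and so does every position to which it
            -- is related.
            (λ nl → ∨I₂ (∧I (∨I₂ rfl) (chain-rel $ sus ∙ f ∙ (1+ O) ∙ (t k ⁀ n) ∙ (u ⁀ a) $
              (no-least $ sus ∙ f ∙ t k $ nl ∙ n) $ hn))))
        (λ c → ∨I₂ (∧I (∨I₂ rfl)
          (chain-even $ sus ∙ f ∙ u $ rw (λ z → chain f z u ≐ O) b0 (∧E₂ c) ∙ a)))))
      (Λʰ λ bn → ∀I λ a → cases h
        (λ r → unpack r λ k hk →
          have (rel-unfold $ sus ∙ f ∙ f ∙ b ∙ t k ∙ u $ ∧E₂ hk $ (lost ∙ k)) λ q →
          -- The actual move of S₁ at t k, taken as a challenge, is mirrored by the reply r at u.
          unpack (∧E₂ (∧E₂ q) $ bn ∙ (S₁ · t k)) λ r hr →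
          have (cases (par-cases ∙ k) (λ e → absurd (bn $ (symᵖ (∧E₁ hk) ⟫ e))) (λ e → e)) λ odd →
          witness r (∨I₁ (witness (1+ k) (∧I (par-odd ∙ k $ odd)
            (rw (λ z → rel f f O z (u ⁀ r) ≐ O) (symᵖ (pos-odd ∙ S₀ ∙ S₁ ∙ k $ odd)) hr)))))
        (λ c → unpack (chain-odd $ sus ∙ f ∙ u $
            rw (λ z → chain f z u ≐ O) (cases (∧E₁ c) (λ e → absurd (bn $ e)) (λ e → e)) (∧E₂ c))
          λ r hr → witness r (∨I₂ (∧I (∨I₁ rfl) hr))))))
  λ (step : Pf (all N λ b → all N λ x → all N λ u → P b x u ⇒ RelStep P one f b x u)) →
  have (rel-coind sus one f P _ step) λ d → d ∙ O ∙ O ∙ O $ ∨I₁ (witness O (∧I ≐β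
    (rel-refl $ sus ∙ f ∙ O ∙ t O ∙ O $ ≐β)))) ok

-- As `one` has no zeros, the escape clause never applies, and the moves recorded in the first
-- position can be altered freely.
Wins₁-any : Pf (Suslin ⇒ all type1 λ f → all N λ b → all N λ t → all N λ u →
  rel one f b t u ≐ O ⇒ Wins₁ f b u)
Wins₁-any = seal (Λʰ λ sus → ∀I λ f →
  have (rel-coind sus one f (λ b t u → exi N λ t′ → rel one f b t′ u ≐ O) _
    (∀I λ b → ∀I λ t → ∀I λ u → Λʰ λ h → unpack h λ t′ ht → Λʰ λ _ →
      have (rel-unfold $ sus ∙ one ∙ f ∙ b ∙ t′ ∙ u $ ht $ (Λʰ λ e → 1+≢0 {O} (β {A = one · t′ ≐ O} e))) λ q →
      ∧I (∧E₁ q) (∧I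
        (Λʰ λ e → ∀I λ a → unpack (∧E₁ (∧E₂ q) $ e ∙ a) λ r hr → witness r (witness (t′ ⁀ r) hr))
        (Λʰ λ e → ∀I λ a → unpack (∧E₂ (∧E₂ q) $ e ∙ a) λ r hr → witness r (witness (t′ ⁀ a) hr)))))
  λ d → ∀I λ b → ∀I λ t → ∀I λ u → Λʰ λ h → d ∙ b ∙ O ∙ u $ witness t h) ok

Wins₁-step : Pf (Suslin ⇒ all type1 λ f → all N λ b → all N λ u → Wins₁ f b u ⇒ ~ (f · u ≐ O)
  ∧ (b ≐ O ⇒ all N λ a → Wins₁ f (1+ O) (u ⁀ a))
  ∧ (~ (b ≐ O) ⇒ exi N λ r → Wins₁ f O (u ⁀ r)))
Wins₁-step = seal (Λʰ λ sus → ∀I λ f → ∀I λ b → ∀I λ u → Λʰ λ h →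
  have (rel-unfold $ sus ∙ one ∙ f ∙ b ∙ O ∙ u $ h $ (Λʰ λ e → 1+≢0 {O} (β {A = one · O ≐ O} e))) λ q →
  ∧I (∧E₁ q) (∧I
    (Λʰ λ e → ∀I λ a → unpack (∧E₁ (∧E₂ q) $ e ∙ a) λ r hr →
      Wins₁-any $ sus ∙ f ∙ (1+ O) ∙ (O ⁀ r) ∙ (u ⁀ a) $ hr)
    (Λʰ λ e → unpack (∧E₂ (∧E₂ q) $ e ∙ O) λ r hr → witness r
      (Wins₁-any $ sus ∙ f ∙ O ∙ (O ⁀ O) ∙ (u ⁀ r) $ hr)))) ok

SafeStrategy : HTm type1 → HTm Strategy → HFm
SafeStrategy f S₁ = all N λ u → (exi N λ r → Wins₁ f O (u ⁀ r)) ⇒ Wins₁ f O (u ⁀ (S₁ · u))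

-- `Wins₁` is an equation, so that the invariant falls under quantifier-free induction.
won-play : Pf (Suslin ⇒ all type1 λ f → all Strategy λ S₁ → SafeStrategy f S₁ ⇒ Wins₁ f O O ⇒
  all Strategy λ S₀ → all N λ k → ~ (f · pos S₀ S₁ k ≐ O))
won-play = seal (Λʰ λ sus → ∀I λ f → ∀I λ S₁ → Λʰ λ safe → Λʰ λ h → ∀I λ S₀ →
  have (ind (λ k → Wins₁ f (par k) (pos S₀ S₁ k))
    (rw (λ b → Wins₁ f b (pos S₀ S₁ O)) (≐β {O}) (rw (Wins₁ f O) (≐β {O}) h))
    (∀I λ k → Λʰ λ ih →
      have (Wins₁-step $ sus ∙ f ∙ par k ∙ pos S₀ S₁ k $ ih) λ q → cases (par-cases ∙ k)
      (λ e → rw (λ b → Wins₁ f b (pos S₀ S₁ (1+ k))) (symᵖ (par-even ∙ k $ e))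
        (rw (Wins₁ f (1+ O)) (symᵖ (pos-even ∙ S₀ ∙ S₁ ∙ k $ e)) (∧E₁ (∧E₂ q) $ e ∙ (S₀ · pos S₀ S₁ k))))
      (λ e → rw (λ b → Wins₁ f b (pos S₀ S₁ (1+ k))) (symᵖ (par-odd ∙ k $ e))
        (rw (Wins₁ f O) (symᵖ (pos-odd ∙ S₀ ∙ S₁ ∙ k $ e))
          (safe ∙ pos S₀ S₁ k $ (∧E₂ (∧E₂ q) $ (Λʰ λ z → 0≢1+ z e)))))))
  λ (inv : Pf (all N λ k → Wins₁ f (par k) (pos S₀ S₁ k))) →
  ∀I λ k → ∧E₁ (Wins₁-step $ sus ∙ f ∙ par k ∙ pos S₀ S₁ k $ (inv ∙ k))) ok

-- Standard winning strategies, uniform in the game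

-- These two apply if the parameters of A are standard.
arith-trans : Pf Suslin → Pf Π⁰₁-trans → (A : HTm N → HFm) → (∀ x → Arithmetical (A x)) →
  Pf (allˢᵗ N A) → Pf (all N A)
arith-trans sus t A ar p =
  let f : HTm type1
      f = lam λ x → not0 (χ (A x)) in
  have (Π⁰₁-∀ $ t ∙ f $ stᵖ f $ (∀I λ x → Λʰ λ st-x → Λʰ λ e →
    ∧E₁ (not0-char ∙ χ (A x)) $ β e $ (∧E₂ (χ-spec sus (A x) (ar x)) $ (p ∙ x $ st-x)))) λ q →
  ∀I λ x → ∧E₁ (χ-spec sus (A x) (ar x)) $ byContra λ ne →
    q ∙ x $ β {not0 (χ (A x)) ≐ O} (∧E₂ (not0-char ∙ χ (A x)) $ ne)

mu-select : Pf Suslin → ∀ W → Pf (Mu W) → (A : HTm N → HFm) → (∀ x → Arithmetical (A x)) →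
  Pf (exi N A) → Pf (A (W · lam λ x → χ (A x)))
mu-select sus W mu A ar h =
  let f : HTm type1
      f = lam λ x → χ (A x) in
  ∧E₁ (χ-spec sus (A (W · f)) (ar _)) $ β (mu ∙ f $ stᵖ f $
    unpack h λ x hx → witness x (β {χ (A x) ≐ O} (∧E₂ (χ-spec sus (A x) (ar x)) $ hx)))

minStrategy safeStrategy : HTm type2 → HTm type1 → HTm Strategy
minStrategy W f = lam λ t → W · lam λ n → χ (Least f t n)
safeStrategy W f = lam λ u → W · lam λ r → χ (Wins₁ f O (u ⁀ r))

-- W selects zeros of standard functions only, which settles standard positions t. The claim is
-- arithmetical in t with standard parameters, so it transfers to all t, as is needed against
-- nonstandard opponents.
minStrategy-min : Pf (Suslin ⇒ Π⁰₁-trans ⇒ allˢᵗ type2 λ W → Mu W ⇒ allˢᵗ type1 λ f →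
  MinStrategy f (minStrategy W f))
minStrategy-min = seal (Λʰ λ sus → Λʰ λ t → ∀I λ W → Λʰ λ st-W → Λʰ λ mu → ∀I λ f → Λʰ λ st-f →
  arith-trans sus t (λ t → (exi N λ n → Least f t n) ⇒ Least f t (minStrategy W f · t)) _
    (∀I λ t → Λʰ λ st-t → Λʰ λ h →
      β {Least f t (W · lam λ n → χ (Least f t n))} (mu-select sus W mu (Least f t) _ h))) ok

safeStrategy-safe : Pf (Suslin ⇒ Π⁰₁-trans ⇒ allˢᵗ type2 λ W → Mu W ⇒ allˢᵗ type1 λ f →
  SafeStrategy f (safeStrategy W f))
safeStrategy-safe = seal (Λʰ λ sus → Λʰ λ t → ∀I λ W → Λʰ λ st-W → Λʰ λ mu → ∀I λ f → Λʰ λ st-f →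
  arith-trans sus t (λ u → (exi N λ r → Wins₁ f O (u ⁀ r)) ⇒ Wins₁ f O (u ⁀ (safeStrategy W f · u))) _
    (∀I λ u → Λʰ λ st-u → Λʰ λ h →
      β {Wins₁ f O (u ⁀ (W · lam λ r → χ (Wins₁ f O (u ⁀ r))))}
        (mu-select sus W mu (λ r → Wins₁ f O (u ⁀ r)) _ h))) ok

determined : Pf (Suslin ⇒ all type1 λ f → all Strategy λ S₀ → all Strategy λ S₁ →
  MinStrategy f S₀ ⇒ SafeStrategy f S₁ ⇒
  (all Strategy λ S → Wins (plays S₀ S) f) ∨ (all Strategy λ S → ~ Wins (plays S S₁) f))
determined = seal (Λʰ λ sus → ∀I λ f → ∀I λ S₀ → ∀I λ S₁ → Λʰ λ ms → Λʰ λ ss →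
  em (all Strategy λ S → Wins (plays S₀ S) f) ∨I₁ (λ n → ∨I₂
    (unpack (not-all {A = λ S → Wins (plays S₀ S) f} n) λ S hS →
      have (lost-play $ sus ∙ f ∙ S₀ ∙ S $ ms $ (∀I λ k → Λʰ λ e → hS $ witness k
        (rw (λ p → f · p ≐ O) (symᵖ (play-↾ ∙ S₀ ∙ S ∙ k)) e))) λ w →
      ∀I λ S′ → Λʰ λ h → unpack h λ k hk → won-play $ sus ∙ f ∙ S₁ $ ss $ w ∙ S′ ∙ k $
        rw (λ p → f · p ≐ O) (play-↾ ∙ S′ ∙ S₁ ∙ k) hk))) ok

-- Uniform in f, but with opponents not restricted to standard ones; both forms of determinacy in
-- the theorem follow from it.
UniformDet : HFm
UniformDet = exiˢᵗ (type1 ⟶ N ⟶ Strategy) λ Φ → allˢᵗ type1 λ f →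
    (all Strategy λ S₁ → Wins (plays (Φ · f · (1+ O)) S₁) f)
  ∨ (all Strategy λ S₀ → ~ Wins (plays S₀ (Φ · f · (1+ 1+ O))) f)

S²⇒UniformDet : Pf (S²ˢᵗ ⇒ UniformDet)
S²⇒UniformDet = seal (Λʰ λ h →
  have (S²⇒Ξ₀ˢᵗ $ h) λ ξ →
  have (Ξ₀ˢᵗ⇒Suslin $ ξ) λ sus →
  have (Ξ₀ˢᵗ⇒Π⁰₁-trans $ ξ) λ t →
  unpack (Π⁰₁-trans⇒Mu $ t) λ W hW →
  have (∧E₁ hW) λ st-W →
  let Φ : HTm (type1 ⟶ N ⟶ Strategy)
      -- The components have indices 1 and 2, which `pre` turns into 0 and 1.
      Φ = lam λ f → lam λ i → lam λ p → if0 (pre i) (minStrategy W f · p) (safeStrategy W f · p)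
      -- Constants 1 and 3 are `pre` and `if0`; the fixed points inside the strategies stay folded.
      unfold : ℕ → Bool
      unfold k = (k ≡ᵇ 1) ∨ᵇ (k ≡ᵇ 3) in
  witness Φ (∧I (stᵖ Φ) (∀I λ f → Λʰ λ st-f →
    determined $ sus ∙ f ∙ (Φ · f · (1+ O)) ∙ (Φ · f · (1+ 1+ O))
    $ leib (MinStrategy f) {minStrategy W f} {Φ · f · (1+ O)}
        (∀I λ p → conv {minStrategy W f · p ≐ minStrategy W f · p} unfold rfl)
        (minStrategy-min $ sus $ t ∙ W $ st-W $ ∧E₂ hW ∙ f $ st-f)
    $ leib (SafeStrategy f) {safeStrategy W f} {Φ · f · (1+ 1+ O)}
        (∀I λ p → conv {safeStrategy W f · p ≐ safeStrategy W f · p} unfold rfl)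
        (safeStrategy-safe $ sus $ t ∙ W $ st-W $ ∧E₂ hW ∙ f $ st-f)))) ok

S²⇒DET* : Pf (S²ˢᵗ ⇒ DET*)
S²⇒DET* = seal (Λʰ λ h → unpack (S²⇒UniformDet $ h) λ Φ hΦ → have (∧E₁ hΦ) λ st-Φ →
  ∀I λ f → Λʰ λ st-f → cases (∧E₂ hΦ ∙ f $ st-f)
    (λ w → ∨I₁ (witness (Φ · f · (1+ O)) (∧I (stᵖ (Φ · f · (1+ O))) w)))
    (λ w → ∨I₂ (witness (Φ · f · (1+ 1+ O)) (∧I (stᵖ (Φ · f · (1+ 1+ O))) w)))) ok

-- Against a standard opponent the play is standard, and Π⁰₁-transfer supplies a standard stage at
-- which it is won.
S²⇒Uˢᵗ : Pf (S²ˢᵗ ⇒ Uˢᵗ)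
S²⇒Uˢᵗ = seal (Λʰ λ h → have (Ξ₀ˢᵗ⇒Π⁰₁-trans $ (S²⇒Ξ₀ˢᵗ $ h)) λ t →
  unpack (S²⇒UniformDet $ h) λ Φ hΦ → have (∧E₁ hΦ) λ st-Φ →
  witness Φ (∧I st-Φ (∀I λ f → Λʰ λ st-f → cases (∧E₂ hΦ ∙ f $ st-f)
    (λ w → ∨I₁ (∀I λ S₁ → Λʰ λ st-S →
      let k : HTm type1
          k = lam λ n → f · (plays (Φ · f · (1+ O)) S₁ ↾ n) in
      unpack (w ∙ S₁) λ n hn → unpack (t ∙ k $ stᵖ k $ witness n (β hn)) λ m hm →
      witness m (∧I (∧E₁ hm) (β (∧E₂ hm)))))
    (λ w → ∨I₂ (∀I λ S₀ → Λʰ λ st-S → Λʰ λ h → unpack h λ k hk → w ∙ S₀ $ witness k (∧E₂ hk)))))) ok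

-- Two games

-- Player 0 wins this game by a first move that is a zero of j.
firstMove : HTm type1 → HTm type1
firstMove j = lam λ c → if0 c (1+ O) (if0 (init c) (j · last c) (1+ O))

firstMove-1+ : Pf (all type1 λ j → all type1 λ h → all N λ k →
  firstMove j · (h ↾ (1+ k)) ≐ if0 (h ↾ k) (j · (h · k)) (1+ O))
firstMove-1+ = seal (∀I λ j → ∀I λ h → ∀I λ k →
  let c = h ↾ k ⁀ (h · k) in
  firstMove j · (h ↾ (1+ k))                    ≐⟨⟩
  if0 (init c) (j · last c) (1+ O)              ≐⟨ ap (λ v → if0 v (j · last c) (1+ O)) (init-⁀ ∙ (h ↾ k) ∙ (h · k)) ⟩
  if0 (h ↾ k) (j · last c) (1+ O)               ≐⟨ ap (λ v → if0 (h ↾ k) (j · v) (1+ O)) (last-⁀ ∙ (h ↾ k) ∙ (h · k)) ⟩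
  if0 (h ↾ k) (j · (h · k)) (1+ O)              □) ok

firstMove-1 : Pf (all type1 λ j → all type1 λ h → firstMove j · (h ↾ (1+ O)) ≐ j · (h · O))
firstMove-1 = seal (∀I λ j → ∀I λ h → (firstMove-1+ ∙ j ∙ h ∙ O) ⟫ ≐β) ok

firstMove-0 : Pf (all type1 λ j → all type1 λ h → all N λ k →
  firstMove j · (h ↾ k) ≐ O ⇒ j · (h · O) ≐ O)
firstMove-0 = seal (∀I λ j → ∀I λ h → ∀I λ k → Λʰ λ e → ncase k
  (λ z → 0≢1+ e (ap (λ v → firstMove j · (h ↾ v)) z ⟫ ≐β {firstMove j · (h ↾ O)} {1+ O}))
  (λ p → have (symᵖ (firstMove-1+ ∙ j ∙ h ∙ pre k) ⟫ rw (λ v → firstMove j · (h ↾ v) ≐ O) p e) λ e′ →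
    ncase (pre k)
      (λ z → conv {if0 (h ↾ O) (j · (h · O)) (1+ O) ≐ O} every (rw (λ v → if0 (h ↾ v) (j · (h · v)) (1+ O) ≐ O) z e′))
      (λ q → absurd (1+≢0 {O} (conv {if0 (h ↾ (1+ pre (pre k))) (j · (h · (1+ pre (pre k)))) (1+ O) ≐ O} every
        (rw (λ v → if0 (h ↾ v) (j · (h · v)) (1+ O) ≐ O) q e′)))))) ok

≤-trans : Pf (all N λ x → all N λ y → all N λ z → x ∸ y ≐ O ⇒ y ∸ z ≐ O ⇒ x ∸ z ≐ O)
≤-trans = seal (∀I λ x → ∀I λ y → ∀I λ z → Λʰ λ p → Λʰ λ q →
  rw (λ v → x ∸ v ≐ O) (≤-add ∙ z ∙ y $ q) (≤-+ ∙ x ∙ y ∙ (z ∸ y) $ p)) ok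

double-1+ : Pf (all N λ i → 1+ i + 1+ i ≐ 1+ 1+ (i + i))
double-1+ = seal (∀I λ i → 1+ i + 1+ i ≐⟨⟩ 1+ (1+ i + i) ≐⟨ ap 1+_ (add-sˡ ∙ i ∙ i) ⟩ 1+ 1+ (i + i) □) ok

half-par : Pf (all N λ k → half k + half k + par k ≐ k)
half-par = seal (ind (λ k → half k + half k + par k ≐ k) ≐β (∀I λ k → Λʰ λ ih →
  have (half (1+ k) ≐⟨⟩ half k + par k □) λ h →
  cases (par-cases ∙ k)
  (λ e → have (h ⟫ ap (half k +_) e ⟫ ≐β {half k + O} {half k}) λ h′ →
    half (1+ k) + half (1+ k) + par (1+ k)  ≐⟨ ap (λ v → v + v + par (1+ k)) h′ ⟩
    half k + half k + par (1+ k)            ≐⟨ ap (half k + half k +_) (par-even ∙ k $ e) ⟩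
    half k + half k + 1+ O                  ≐⟨⟩
    1+ (half k + half k + O)                ≐⟨ ap (λ v → 1+ (half k + half k + v)) (symᵖ e) ⟩
    1+ (half k + half k + par k)            ≐⟨ ap 1+_ ih ⟩
    1+ k                                    □)
  (λ e → have (h ⟫ ap (half k +_) e ⟫ ≐β {half k + 1+ O} {1+ half k}) λ h′ →
    half (1+ k) + half (1+ k) + par (1+ k)  ≐⟨ ap (λ v → v + v + par (1+ k)) h′ ⟩
    1+ half k + 1+ half k + par (1+ k)      ≐⟨ ap (1+ half k + 1+ half k +_) (par-odd ∙ k $ e) ⟩
    1+ half k + 1+ half k + O               ≐⟨⟩
    1+ half k + 1+ half k                   ≐⟨ double-1+ ∙ half k ⟩
    1+ 1+ (half k + half k)                 ≐⟨⟩
    1+ (half k + half k + 1+ O)             ≐⟨ ap (λ v → 1+ (half k + half k + v)) (symᵖ e) ⟩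
    1+ (half k + half k + par k)            ≐⟨ ap 1+_ ih ⟩
    1+ k                                    □))) ok

par-half-double : Pf (all N λ i → par (i + i) ≐ O ∧ half (i + i) ≐ i)
par-half-double = seal (ind (λ i → par (i + i) ≐ O ∧ half (i + i) ≐ i) (∧I ≐β ≐β) (∀I λ i → Λʰ λ ih →
  have (par-even ∙ (i + i) $ ∧E₁ ih) λ odd → ∧I
  (par (1+ i + 1+ i)      ≐⟨ ap par (double-1+ ∙ i) ⟩
   par (1+ 1+ (i + i))    ≐⟨ par-odd ∙ 1+ (i + i) $ odd ⟩
   O                      □)
  (half (1+ i + 1+ i)     ≐⟨ ap half (double-1+ ∙ i) ⟩
   half (1+ 1+ (i + i))   ≐⟨⟩
   half (i + i) + par (i + i) + par (1+ (i + i)) ≐⟨ ap (half (i + i) + par (i + i) +_) odd ⟩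
   half (i + i) + par (i + i) + 1+ O ≐⟨ ap (λ v → half (i + i) + v + 1+ O) (∧E₁ ih) ⟩
   half (i + i) + O + 1+ O ≐⟨⟩
   1+ half (i + i)         ≐⟨ ap 1+_ (∧E₂ ih) ⟩
   1+ i                    □))) ok

half-odd : Pf (all N λ i → half (1+ (i + i)) ≐ i)
half-odd = seal (∀I λ i →
  half (1+ (i + i))              ≐⟨⟩
  half (i + i) + par (i + i)     ≐⟨ ap (half (i + i) +_) (∧E₁ (par-half-double ∙ i)) ⟩
  half (i + i) + O               ≐⟨⟩
  half (i + i)                   ≐⟨ ∧E₂ (par-half-double ∙ i) ⟩
  i                              □) ok

<-half : Pf (all N λ k → all N λ i → i < half k ⇒ 1+ (i + i) < k)
<-half = seal (∀I λ k → ∀I λ i → Λʰ λ lt →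
  rw (λ v → v ∸ k ≐ O) (double-1+ ∙ i)
  (rw (λ v → 1+ i + 1+ i ∸ v ≐ O) (half-par ∙ k)
  (≤-+ ∙ (1+ i + 1+ i) ∙ (half k + half k) ∙ par k $
  (≤-trans ∙ (1+ i + 1+ i) ∙ (half k + 1+ i) ∙ (half k + half k)
    $ ((add-∸-cancel ∙ 1+ i ∙ half k ∙ 1+ i) ⟫ lt)
    $ (ap (λ v → v ∸ (half k + half k)) (add-comm ∙ half k ∙ 1+ i) ⟫
       (add-∸-cancel ∙ 1+ i ∙ half k ∙ half k) ⟫ lt))))) ok

↾-cong : Pf (all type1 λ g → all type1 λ h → all N λ y → (all N λ i → i < y ⇒ g · i ≐ h · i) ⇒ g ↾ y ≐ h ↾ y)
↾-cong = seal (∀I λ g → ∀I λ h → ∀I λ y → Λʰ λ agree →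
  ind (λ m → m ∸ y ≐ O ⇒ g ↾ m ≐ h ↾ m) (Λʰ λ _ → ≐β) (∀I λ m → Λʰ λ ih → Λʰ λ lt →
    g ↾ (1+ m)          ≐⟨⟩
    g ↾ m ⁀ (g · m)     ≐⟨ ap (_⁀ (g · m)) (ih $ (≤-pred ∙ m ∙ y $ lt)) ⟩
    h ↾ m ⁀ (g · m)     ≐⟨ ap (h ↾ m ⁀_) (agree ∙ m $ lt) ⟩
    h ↾ m ⁀ (h · m)     ≐⟨⟩
    h ↾ (1+ m)          □) ∙ y $ (∸-self ∙ y)) ok

-- Player 1 builds a path through f with the moves at odd positions.
odds : HTm type1 → HTm type1
odds h = lam λ i → h · (1+ (i + i))

pathGame : HTm type1 → HTm type1
pathGame f = lam λ c → f · ((lam λ i → c ‼ (1+ (i + i))) ↾ half ∣ c ∣)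

-- Player 1 moves at positions of length 1 + 2i, whose half, rounded down, is i.
follow : HTm type1 → HTm Strategy
follow g = lam λ p → g · half ∣ p ∣

pathGame-↾ : Pf (all type1 λ f → all type1 λ h → all N λ k →
  pathGame f · (h ↾ k) ≐ f · (odds h ↾ half k))
pathGame-↾ = seal (∀I λ f → ∀I λ h → ∀I λ k →
  let e : HTm type1
      e = lam λ i → h ↾ k ‼ (1+ (i + i)) in
  conv {pathGame f · (h ↾ k) ≐ pathGame f · (h ↾ k)} {pathGame f · (h ↾ k) ≐ f · (e ↾ half ∣ h ↾ k ∣)} none rfl ⟫
  (f · (e ↾ half ∣ h ↾ k ∣)   ≐⟨ ap (λ v → f · (e ↾ half v)) (length-↾ ∙ h ∙ k) ⟩
   f · (e ↾ half k)           ≐⟨ ap (f ·_) (↾-cong ∙ e ∙ odds h ∙ half k $ (∀I λ i → Λʰ λ lt →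
      β {h ↾ k ‼ (1+ (i + i)) ≐ h · (1+ (i + i))} (entry-↾ ∙ h ∙ k ∙ 1+ (i + i) $ (<-half ∙ k ∙ i $ lt)))) ⟩
   f · (odds h ↾ half k)      □)) ok

pathGame-double : Pf (all type1 λ f → all type1 λ h → all N λ x →
  pathGame f · (h ↾ (x + x)) ≐ f · (odds h ↾ x))
pathGame-double = seal (∀I λ f → ∀I λ h → ∀I λ x →
  (pathGame-↾ ∙ f ∙ h ∙ (x + x)) ⟫ ap (λ v → f · (odds h ↾ v)) (∧E₂ (par-half-double ∙ x))) ok

odds-follow : Pf (all Strategy λ S₀ → all type1 λ g → all N λ i → odds (plays S₀ (follow g)) · i ≐ g · i)
odds-follow = seal (∀I λ S₀ → ∀I λ g → ∀I λ i →
  let S₁ = follow g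
      n = 1+ (i + i)
      p = pos S₀ S₁ n
      unfold : ℕ → Bool
      unfold k = (k ≡ᵇ 11) ∨ᵇ (k ≡ᵇ 9) in
  conv {if0 (par n) (S₀ · p) (g · half ∣ p ∣) ≐ if0 (par n) (S₀ · p) (g · half ∣ p ∣)}
       {odds (plays S₀ S₁) · i ≐ if0 (par n) (S₀ · p) (g · half ∣ p ∣)} unfold rfl ⟫
  (if0 (par n) (S₀ · p) (g · half ∣ p ∣)   ≐⟨ ap (λ v → if0 v (S₀ · p) (g · half ∣ p ∣))
      (par-even ∙ (i + i) $ ∧E₁ (par-half-double ∙ i)) ⟩
   if0 (1+ O) (S₀ · p) (g · half ∣ p ∣)    ≐⟨ if0-s ∙ 1+ O ∙ (S₀ · p) ∙ (g · half ∣ p ∣) $ (Λʰ λ e → 1+≢0 {O} e) ⟩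
   g · half ∣ p ∣                          ≐⟨ ap (λ v → g · half ∣ v ∣) (symᵖ (play-↾ ∙ S₀ ∙ S₁ ∙ n)) ⟩
   g · half ∣ plays S₀ S₁ ↾ n ∣            ≐⟨ ap (λ v → g · half v) (length-↾ ∙ plays S₀ S₁ ∙ n) ⟩
   g · half n                              ≐⟨ ap (g ·_) (half-odd ∙ i) ⟩
   g · i                                   □)) ok

follow-wins : Pf (all type1 λ f → all Strategy λ S₀ → all type1 λ g → all N λ k →
  pathGame f · (plays S₀ (follow g) ↾ k) ≐ f · (g ↾ half k))
follow-wins = seal (∀I λ f → ∀I λ S₀ → ∀I λ g → ∀I λ k → (pathGame-↾ ∙ f ∙ plays S₀ (follow g) ∙ k) ⟫
  ap (f ·_) (↾-cong ∙ odds (plays S₀ (follow g)) ∙ g ∙ half k $ (∀I λ i → Λʰ λ _ → odds-follow ∙ S₀ ∙ g ∙ i))) ok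

-- From determinacy to (S²)

const : HTm N → HTm Strategy
const n = lam λ _ → n

firstMove-wins : Pf (all type1 λ j → all N λ n → all Strategy λ S₁ → j · n ≐ O ⇒
  firstMove j · (plays (const n) S₁ ↾ (1+ O)) ≐ O)
firstMove-wins = seal (∀I λ j → ∀I λ n → ∀I λ S₁ → Λʰ λ e →
  (firstMove-1 ∙ j ∙ plays (const n) S₁) ⟫ ap (j ·_) (≐β {plays (const n) S₁ · O} {n}) ⟫ e) ok

-- The opponents in `DET*` may be nonstandard, so opening with a zero n, standard or not, defeats
-- every S₁. What remains is a standard S₀, whose opening move is a standard zero.
DET*⇒Π⁰₁-trans : Pf (DET* ⇒ Π⁰₁-trans)
DET*⇒Π⁰₁-trans = seal (Λʰ λ det → ∀I λ j → Λʰ λ st-j → Λʰ λ h → unpack h λ n hn →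
  cases (det ∙ firstMove j $ stᵖ (firstMove j))
    (λ w → unpack w λ S₀ hS → have (∧E₁ hS) λ st-S → unpack (∧E₂ hS ∙ const O) λ k hk →
      witness (S₀ · O) (∧I (stᵖ (S₀ · O))
        (ap (j ·_) (≐β {S₀ · O} {plays S₀ (const O) · O}) ⟫ (firstMove-0 ∙ j ∙ plays S₀ (const O) ∙ k $ hk))))
    (λ w → unpack w λ S₁ hS → absurd (∧E₂ hS ∙ const n $ witness (1+ O)
      (firstMove-wins ∙ j ∙ n ∙ S₁ $ hn)))) ok

Σ¹₁-trans : HFm
Σ¹₁-trans = allˢᵗ type1 λ f → (exi type1 λ g → Path f g) ⇒ exiˢᵗ type1 λ g → Path f g

-- A path g, standard or not, defeats every S₀ by means of `follow g`. What remains is a standard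
-- S₁, whose moves against the standard opponent `const O` form a standard path.
DET*⇒Σ¹₁-trans : Pf (DET* ⇒ Σ¹₁-trans)
DET*⇒Σ¹₁-trans = seal (Λʰ λ det → ∀I λ f → Λʰ λ st-f → Λʰ λ h → unpack h λ g p →
  cases (det ∙ pathGame f $ stᵖ (pathGame f))
    (λ w → unpack w λ S₀ hS → absurd (unpack (∧E₂ hS ∙ follow g) λ k hk →
      p ∙ half k $ (symᵖ (follow-wins ∙ f ∙ S₀ ∙ g ∙ k) ⟫ hk)))
    (λ w → unpack w λ S₁ hS → have (∧E₁ hS) λ st-S →
      let h = plays (const O) S₁ in
      witness (odds h) (∧I (stᵖ (odds h)) (∀I λ x → Λʰ λ e →
        ∧E₂ hS ∙ const O $ witness (x + x) ((pathGame-double ∙ f ∙ h ∙ x) ⟫ e))))) ok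

-- Some path through f is among the entries of Φ f, if f has a path; θ f i = 0
-- if the i-th entry is one.
module _ (W : HTm type2) (Φ : HTm (type1 ⟶ type1 ✶)) where

  entry : HTm type1 → HTm N → HTm type1
  entry f i = con ent · (Φ · f) · i

  probe : HTm type1 → HTm N → HTm type1
  probe f i = lam λ x → f · (entry f i ↾ x)

  value : HTm type1 → HTm N → HTm N
  value f i = probe f i · (W · probe f i)

  θ : HTm type1 → HTm N → HTm N
  θ f i = (1+ i ∸ con len · (Φ · f)) + not0 (value f i)

  S : HTm type2
  S = lam λ f → θ f (W · lam λ i → θ f i)

-- The list from HAC-int must be tested for paths. For a standard candidate this is decidable, since
-- W finds a position at which it fails if there is one; a second use of W searches the list.
Σ¹₁-trans⇒S² : Pf (Π⁰₁-trans ⇒ Σ¹₁-trans ⇒ S²ˢᵗ)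
Σ¹₁-trans⇒S² = seal (Λʰ λ t → Λʰ λ t₁ →
  unpack (Π⁰₁-trans⇒Mu $ t) λ W hW →
  have (∧E₁ hW) λ st-W →
  unpack (hac (λ f g → (exi type1 λ g → Path f g) ⇒ Path f g) (∀I λ f → Λʰ λ st-f →
    em (exi type1 λ g → Path f g)
      (λ h → unpack (t₁ ∙ f $ st-f $ h) λ g hg → witness g (∧I (∧E₁ hg) (Λʰ λ _ → ∧E₂ hg)))
      (λ n → witness (const O) (∧I (stᵖ (const O)) (Λʰ λ h → absurd (n $ h)))))) λ Φ hΦ →
  have (∧E₁ hΦ) λ st-Φ →
  have (∀I λ f → Λʰ λ st-f → ∀I λ i → Λʰ λ st-i → ∧I
    (Λʰ λ e → have (∧E₁ (∧-char ∙ (1+ i ∸ con len · (Φ · f)) ∙ not0 (value W Φ f i)) $ e) λ q →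
      ∀I λ x → Λʰ λ z → ∧E₁ (not0-char ∙ value W Φ f i) $ ∧E₂ q $
        (∧E₂ hW ∙ probe W Φ f i $ stᵖ (probe W Φ f i) $ witness x (β z)))
    (Λʰ λ q → ∧E₂ (∧-char ∙ (1+ i ∸ con len · (Φ · f)) ∙ not0 (value W Φ f i)) $ ∧I (∧E₁ q)
      (∧E₂ (not0-char ∙ value W Φ f i) $ (Λʰ λ z → ∧E₂ q ∙ (W · probe W Φ f i) $ β z))))
  λ (θ-spec : Pf (allˢᵗ type1 λ f → allˢᵗ N λ i →
       (θ W Φ f i ≐ O ⇒ Path f (entry W Φ f i)) ∧ (i < con len · (Φ · f) ∧ Path f (entry W Φ f i) ⇒ θ W Φ f i ≐ O))) →
  witness (S W Φ) (∧I (stᵖ (S W Φ)) (∀I λ f → Λʰ λ st-f →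
    let θf : HTm type1
        θf = lam λ i → θ W Φ f i
        i₀ = W · θf in ∧I
    (Λʰ λ e → witness (entry W Φ f i₀) (∧I (stᵖ (entry W Φ f i₀)) (∀I λ x → Λʰ λ _ →
      ∧E₁ (θ-spec ∙ f $ st-f ∙ i₀ $ stᵖ i₀) $ β {S W Φ · f ≐ O} e ∙ x)))
    (Λʰ λ h → unpack h λ g hg →
      have (Π⁰₁-Path $ t ∙ f $ st-f ∙ g $ ∧E₁ hg $ ∧E₂ hg) λ p →
      unpack (∧E₂ hΦ ∙ f $ st-f) λ y hy → unpack (∧E₁ hy) λ i hi →
      -- An index below a standard length is standard, and hence so is the entry; `θ-spec` applies
      -- to standard indices only.
      have (st< (stᵖ (con len · (Φ · f))) (∧E₁ hi)) λ st-i →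
      β {θf · i₀ ≐ O} (∧E₂ hW ∙ θf $ stᵖ θf $ witness i (β {θ W Φ f i ≐ O}
        (∧E₂ (θ-spec ∙ f $ st-f ∙ i $ st-i) $ ∧I (∧E₁ hi)
          (leib (Path f) {y} {entry W Φ f i} (∧E₂ hi) (∧E₂ hy $ witness g p))))))))) ok

module _ (Φ : HTm (type1 ⟶ N ⟶ Strategy)) where

  strategy₀ strategy₁ : HTm type1 → HTm Strategy
  strategy₀ f = Φ · f · (1+ O)
  strategy₁ f = Φ · f · (1+ 1+ O)

  -- The opening move of player 0, as 0 codes the empty position.
  zeroOf : HTm type2
  zeroOf = lam λ j → strategy₀ (firstMove j) · O

  -- Φ does not tell which of its two strategies wins. In the play of one against the other the
  -- winning strategy prevails, and `zeroOf` decides the outcome of this play.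
  tested : HTm type1 → HTm type1
  tested f = lam λ k → pathGame f · (plays (strategy₀ (pathGame f)) (strategy₁ (pathGame f)) ↾ k)

  hasPath : HTm type2
  hasPath = lam λ f → not0 (tested f · (zeroOf · tested f))

U⇒S² : Pf (Uˢᵗ ⇒ S²ˢᵗ)
U⇒S² = seal (Λʰ λ h → unpack h λ Φ hΦ →
  have (∧E₁ hΦ) λ st-Φ →
  let Φ₀ = strategy₀ Φ ; Φ₁ = strategy₁ Φ ; W = zeroOf Φ ; run = tested Φ ; S = hasPath Φ in
  have (∀I λ j → Λʰ λ st-j → Λʰ λ h → unpack h λ n hn → have (∧E₁ hn) λ st-n →
    cases (∧E₂ hΦ ∙ firstMove j $ stᵖ (firstMove j))
      (λ w → unpack (w ∙ const O $ stᵖ (const O)) λ k hk →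
        let S₀ = Φ₀ (firstMove j) in
        ap (j ·_) (conv {S₀ · O ≐ S₀ · O} {W · j ≐ S₀ · O} none rfl ⟫ ≐β {S₀ · O} {plays S₀ (const O) · O}) ⟫
        (firstMove-0 ∙ j ∙ plays S₀ (const O) ∙ k $ ∧E₂ hk))
      (λ w → absurd (w ∙ const n $ stᵖ (const n) $ witness (1+ O) (∧I (stᵖ (1+ O))
        (firstMove-wins ∙ j ∙ n ∙ Φ₁ (firstMove j) $ ∧E₂ hn)))))
  λ (mu : Pf (allˢᵗ type1 λ j → (exiˢᵗ N λ n → j · n ≐ O) ⇒ j · (W · j) ≐ O)) →
  witness S (∧I (stᵖ S) (∀I λ f → Λʰ λ st-f → ∧I
    (Λʰ λ e →
      let h = plays (Φ₀ (pathGame f)) (Φ₁ (pathGame f)) in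
      witness (odds h) (∧I (stᵖ (odds h)) (∀I λ x → Λʰ λ st-x → Λʰ λ z →
        ∧E₁ (not0-char ∙ (run f · (W · run f))) $ β {S · f ≐ O} e $ (mu ∙ run f $ stᵖ (run f) $
          witness (x + x) (∧I (stᵖ (x + x)) (β {pathGame f · (h ↾ (x + x)) ≐ O}
            ((pathGame-double ∙ f ∙ h ∙ x) ⟫ z)))))))
    (Λʰ λ hg → unpack hg λ g hg → have (∧E₁ hg) λ st-g →
      β {not0 (run f · (W · run f)) ≐ O} (∧E₂ (not0-char ∙ (run f · (W · run f))) $ (Λʰ λ z →
        -- Both cases are refuted: the path g defeats the first strategy, and the tested play is a
        -- loss for the second.
        cases (∧E₂ hΦ ∙ pathGame f $ stᵖ (pathGame f))
          (λ w → unpack (w ∙ follow g $ stᵖ (follow g)) λ k hk → have (∧E₁ hk) λ st-k →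
            ∧E₂ hg ∙ half k $ stᵖ (half k) $ (symᵖ (follow-wins ∙ f ∙ Φ₀ (pathGame f) ∙ g ∙ k) ⟫ ∧E₂ hk))
          (λ w → w ∙ Φ₀ (pathGame f) $ stᵖ (Φ₀ (pathGame f)) $ witness (W · run f)
            (∧I (stᵖ (W · run f)) (β {run f · (W · run f) ≐ O} z))))))))) ok

DET*⇒S² : Pf (DET* ⇒ S²ˢᵗ)
DET*⇒S² = seal (Λʰ λ d → Σ¹₁-trans⇒S² $ (DET*⇒Π⁰₁-trans $ d) $ (DET*⇒Σ¹₁-trans $ d)) ok

theorem7p8 : (RCA₀Ω+STP ⊢ Σ⁰₁-DET* ⇔ UΣ⁰₁-DET ˢᵗ) ×
    (RCA₀Ω+STP ⊢ UΣ⁰₁-DET ˢᵗ ⇔ S² ˢᵗ)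
theorem7p8 =
    derivation (∧I (Λʰ λ d → S²⇒Uˢᵗ $ (DET*⇒S² $ d)) (Λʰ λ u → S²⇒DET* $ (U⇒S² $ u))) ok
  , derivation (∧I U⇒S² S²⇒Uˢᵗ) ok
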